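{- Let $D$ be a (nonempty) skew Young diagram, viewed as a finite set of cells $(i,j)$ ($i$ = row index, $j$ = column index), and let $\mathbf{k}=(k_{ij})_{(i,j)\in D}$ be a diagonally constant index on $D$. Let $N$ be a positive integer. Then \[\zeta_{<N}(\mathbf{k})=\zeta^\flat_{<N}(\mathbf{k}),\] where \[\zeta_{<N}(\mathbf{k})=\sum_{(m_{ij})\in\mathrm{SSYT}_{<N}(D)}\ \prod_{(i,j)\in D}\frac{1}{m_{ij}^{k_{ij}}}\] and \[\zeta^\flat_{<N}(\mathbf{k})=\sum\ \prod_{p=p_0}^{p_1}\frac{1}{\Pi(\mathbf{N}-\mathbf{n}^{(1)}_p)\,\Pi(\mathbf{n}^{(2)}_p)\cdots\Pi(\mathbf{n}^{(k_p)}_p)},\] the last sum running over all families of tuples $\mathbf{n}^{(l)}_p\in[1,N-1]^{J_p}$ ($p_0\le p\le p_1$, $1\le l\le k_p$) such that $\mathbf{n}^{(l)}_p\trianglelefteq\mathbf{n}^{(l+1)}_p$ for all $p$ and all $1\le l<k_p$, and $\mathbf{n}^{(k_p)}_p\vartriangleleft\mathbf{n}^{(1)}_{p+1}$ for all $p_0\le p<p_1$.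
   Context: $[a,b]=\{x\in\mathbb{Z}: a\le x\le b\}$ (possibly empty); such sets are called intervals. An index on $D$ is a tuple of positive integers indexed by the cells of $D$; it is diagonally constant if $k_{ij}$ depends only on $i-j$. $\mathrm{SSYT}_{<N}(D)$ is the set of semi-standard Young tableaux on $D$ with entries in $[1,N-1]$, i.e. fillings $(m_{ij})$ with $m_{ij}\le m_{i(j+1)}$ whenever $(i,j),(i,j+1)\in D$ and $m_{ij}<m_{(i+1)j}$ whenever $(i,j),(i+1,j)\in D$. For $p\in\mathbb{Z}$ let $D_p=\{(i,j)\in D: i-j=p\}$, $p_0=\min\{p: D_p\neq\emptyset\}$, $p_1=\max\{p:D_p\ne\emptyset\}$, $k_p=k_{ij}$ for any $(i,j)\in D_p$, with the convention $k_p=1$ if $D_p=\emptyset$, and $J_p=\{j\in\mathbb{Z}:(j+p,j)\in D\}$ (an interval). For a tuple $\mathbf{m}=(m_j)_{j\in J}$ let $\Pi(\mathbf{m})=\prod_{j\in J}m_j$ (empty product $=1$) and $\mathbf{N}-\mathbf{m}=(N-m_j)_{j\in J}$. For tuples $\mathbf{m}=(m_j)_{j\in J}$, $\mathbf{n}=(n_j)_{j\in J'}$ indexed by intervals $J,J'$: $\mathbf{m}\vartriangleleft\mathbf{n}$ means $m_j<n_j$ whenever $j\in J\cap J'$, and $n_{j-1}\le m_j$ whenever $j\in J$ and $j-1\in J'$; $\mathbf{m}\trianglelefteq\mathbf{n}$ means $m_j\le n_j$ whenever $j\in J\cap J'$, and $n_{j-1}<m_j$ whenever $j\in J$ and $j-1\in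 J'$. (Note $\trianglelefteq$ is not "$\vartriangleleft$ or equal".) -}

module Defs where

open import Data.Nat as ℕ using (ℕ; zero; suc; _+_; _∸_; _^_; _≤_; _<_)
import Data.Nat.Properties as ℕP
open import Data.Integer as ℤ using (ℤ; +_; _⊓_; _⊔_)
import Data.Integer.Properties as ℤP
open import Data.Rational as ℚ using (ℚ; 0ℚ; 1ℚ)
open import Data.Bool using (if_then_else_)
open import Data.List using (List; []; _∷_; map; filter; concatMap; applyUpTo; foldr; length)
open import Data.Nat.ListAction using (product)
open import Data.List.Relation.Unary.All using (All; all?)
open import Data.List.Relation.Unary.Linked using (Linked)
open import Data.Product using (_×_; _,_; proj₁; proj₂)
open import Data.Product.Properties using (≡-dec)
open import Relation.Binary.PropositionalEquality using (_≡_)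
open import Relation.Binary.Definitions using (DecidableEquality)
open import Relation.Nullary using (Dec; does; yes; no)
open import Relation.Nullary.Decidable using (_×-dec_; _→-dec_)
import Data.List.Membership.DecPropositional as DecMem

nrange : ℕ → ℕ → List ℕ
nrange a b = applyUpTo (λ t → a + t) (suc b ∸ a)

zrange : ℤ → ℤ → List ℤ
zrange a b = map (λ t → a ℤ.+ + t) (applyUpTo (λ t → t) ℤ.∣ ((b ℤ.+ ℤ.1ℤ) ℤ.- a) ⊔ ℤ.0ℤ ∣)

sumℚ : List ℚ → ℚ
sumℚ = foldr ℚ._+_ 0ℚ

prodℚ : List ℚ → ℚ
prodℚ = foldr ℚ._*_ 1ℚ

-- 1/x as a rational number (only ever applied to x ≥ 1; inv 0 = 0 is a junk value)
inv : ℕ → ℚ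
inv zero    = 0ℚ
inv (suc n) = + 1 ℚ./ suc n

update : {S : Set} → DecidableEquality S → S → ℕ → (S → ℕ) → (S → ℕ)
update _≟_ s v f x with x ≟ s
... | yes _ = v
... | no  _ = f x

-- all functions S → ℕ with values in [1,N-1] on the given (duplicate-free) list
-- of slots (and value 0 elsewhere), each listed once
assignments : {S : Set} → DecidableEquality S → ℕ → List S → List (S → ℕ)
assignments _≟_ N []       = (λ _ → 0) ∷ []
assignments _≟_ N (s ∷ ss) =
  concatMap (λ f → map (λ v → update _≟_ s v f) (nrange 1 (N ∸ 1)))
            (assignments _≟_ N ss)

Cell : Set
Cell = ℕ × ℕ

_≟C_ : DecidableEquality Cell
_≟C_ = ≡-dec ℕ._≟_ ℕ._≟_

open DecMem _≟C_ using () renaming (_∈_ to _∈C_; _∈?_ to _∈C?_)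
open DecMem ℕ._≟_ using () renaming (_∈_ to _∈ℕ_; _∈?_ to _∈ℕ?_)

-- i-th part (i ≥ 1) of a partition given as a list; 0 beyond its length
part : List ℕ → ℕ → ℕ
part []       _             = 0
part (x ∷ xs) zero          = 0
part (x ∷ xs) (suc zero)    = x
part (x ∷ xs) (suc (suc i)) = part xs (suc i)

IsPartition : List ℕ → Set
IsPartition l = Linked (λ a b → b ≤ a) l

IsSkew : List ℕ → List ℕ → Set
IsSkew lam mu = IsPartition lam × IsPartition mu × (∀ i → part mu i ≤ part lam i)

cells : List ℕ → List ℕ → List Cell
cells lam mu = concatMap (λ i → map (λ j → (i , j)) (nrange (suc (part mu i)) (part lam i)))
                         (nrange 1 (length lam))

diag : Cell → ℤ
diag (i , j) = + i ℤ.- + j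

IsIndex : List Cell → (Cell → ℕ) → Set
IsIndex D k = All (λ c → 1 ≤ k c) D

DiagConst : List Cell → (Cell → ℕ) → Set
DiagConst D k = All (λ c → All (λ c' → diag c ≡ diag c' → k c ≡ k c') D) D

-- SSYT conditions (entries in [1,N-1] are guaranteed by the enumeration)
SSYT : List Cell → (Cell → ℕ) → Set
SSYT D m = All (λ { (i , j) →
              ((i , suc j) ∈C D → m (i , j) ≤ m (i , suc j)) ×
              ((suc i , j) ∈C D → m (i , j) < m (suc i , j)) }) D

SSYT? : (D : List Cell) → (m : Cell → ℕ) → Dec (SSYT D m)
SSYT? D m = all? (λ { (i , j) →
              (((i , suc j) ∈C? D) →-dec (m (i , j) ℕ.≤? m (i , suc j))) ×-dec
              (((suc i , j) ∈C? D) →-dec (m (i , j) ℕ.<? m (suc i , j))) }) D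

zeta : List Cell → (Cell → ℕ) → ℕ → ℚ
zeta D k N = sumℚ (map (λ m → if does (SSYT? D m)
                                 then prodℚ (map (λ c → inv (m c ^ k c)) D)
                                 else 0ℚ)
                       (assignments _≟C_ N D))

-- a tuple indexed by an interval J (given as a list of its elements)
Tuple : Set
Tuple = List ℕ × (ℕ → ℕ)

_◁_ : Tuple → Tuple → Set
(J , m) ◁ (J' , n) =
  All (λ j → (j ∈ℕ J' → m j < n j) ×
             All (λ j' → suc j' ≡ j → n j' ≤ m j) J') J

_◁?_ : (a b : Tuple) → Dec (a ◁ b)
(J , m) ◁? (J' , n) =
  all? (λ j → ((j ∈ℕ? J') →-dec (m j ℕ.<? n j)) ×-dec
              all? (λ j' → (suc j' ℕ.≟ j) →-dec (n j' ℕ.≤? m j)) J') J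

_⊴_ : Tuple → Tuple → Set
(J , m) ⊴ (J' , n) =
  All (λ j → (j ∈ℕ J' → m j ≤ n j) ×
             All (λ j' → suc j' ≡ j → n j' < m j) J') J

_⊴?_ : (a b : Tuple) → Dec (a ⊴ b)
(J , m) ⊴? (J' , n) =
  all? (λ j → ((j ∈ℕ? J') →-dec (m j ℕ.≤? n j)) ×-dec
              all? (λ j' → (suc j' ℕ.≟ j) →-dec (n j' ℕ.<? m j)) J') J

module Flat (D : List Cell) (k : Cell → ℕ) (N : ℕ) where

  diags : List ℤ
  diags = map diag D

  -- p₀ and p₁ (D is assumed nonempty; 0 is a junk value otherwise)
  p₀ p₁ : ℤ
  p₀ with diags
  ... | []     = ℤ.0ℤ
  ... | d ∷ ds = foldr _⊓_ d ds
  p₁ with diags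
  ... | []     = ℤ.0ℤ
  ... | d ∷ ds = foldr _⊔_ d ds

  Dp : ℤ → List Cell
  Dp p = filter (λ c → diag c ℤ.≟ p) D

  -- k_p (value of k on any cell of D_p, or 1 if D_p is empty)
  kp : ℤ → ℕ
  kp p with Dp p
  ... | []    = 1
  ... | c ∷ _ = k c

  Jp : ℤ → List ℕ
  Jp p = map proj₂ (Dp p)

  Slot : Set
  Slot = ℤ × ℕ × ℕ

  _≟S_ : DecidableEquality Slot
  _≟S_ = ≡-dec ℤ._≟_ (≡-dec ℕ._≟_ ℕ._≟_)

  slots : List Slot
  slots = concatMap (λ p → concatMap (λ l → map (λ j → (p , l , j)) (Jp p))
                                     (nrange 1 (kp p)))
                    (zrange p₀ p₁)

  tup : (Slot → ℕ) → ℤ → ℕ → Tuple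
  tup n p l = Jp p , (λ j → n (p , l , j))

  Admissible : (Slot → ℕ) → Set
  Admissible n =
    All (λ p → All (λ l → tup n p l ⊴ tup n p (suc l)) (nrange 1 (kp p ∸ 1))) (zrange p₀ p₁) ×
    All (λ p → tup n p (kp p) ◁ tup n (p ℤ.+ ℤ.1ℤ) 1) (zrange p₀ (p₁ ℤ.- ℤ.1ℤ))

  Admissible? : (n : Slot → ℕ) → Dec (Admissible n)
  Admissible? n =
    all? (λ p → all? (λ l → tup n p l ⊴? tup n p (suc l)) (nrange 1 (kp p ∸ 1))) (zrange p₀ p₁) ×-dec
    all? (λ p → tup n p (kp p) ◁? tup n (p ℤ.+ ℤ.1ℤ) 1) (zrange p₀ (p₁ ℤ.- ℤ.1ℤ))

  Π : Tuple → ℕ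
  Π (J , m) = product (map m J)

  N-_ : Tuple → Tuple
  N- (J , m) = J , (λ j → N ∸ m j)

  denom : (Slot → ℕ) → ℤ → ℕ
  denom n p = Π (N- tup n p 1) ℕ.* product (map (λ l → Π (tup n p l)) (nrange 2 (kp p)))

  weight : (Slot → ℕ) → ℚ
  weight n = prodℚ (map (λ p → inv (denom n p)) (zrange p₀ p₁))

  zetaFlat : ℚ
  zetaFlat = sumℚ (map (λ n → if does (Admissible? n) then weight n else 0ℚ)
                       (assignments _≟S_ N slots))

zetaFlat : List Cell → (Cell → ℕ) → ℕ → ℚ
zetaFlat = Flat.zetaFlat

{-# OPTIONS --safe #-}

-- The proof transports a connected sum.  With M = N - 1, let X m n = C(n,m) / C(M,m).  Both
--   (1/m) (X m n - X m (n-1)) = (1/n) X m n   and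
--   (1/m) (X m n - X m (n-1)) = 1/(N-n) (X (m-1) (n-1) - X m (n-1))
-- hold, so summing over windows moves a factor 1/m on one side of X to a factor 1/n or 1/(N-n) on the other.
-- Consecutive diagonals of a tableau interlace, and an interlacing sum of determinants is, by multilinearity,
-- the determinant of the sums over the windows between consecutive bounds.  Hence both relations lift to
-- the determinants K m c = det (X mᵢ cⱼ - X mᵢ cⱼ₋₁) attached to a tuple m on a diagonal and a
-- list c of bounds on the flat side; passing to a diagonal of a different length amounts to bordering the
-- determinant by a row (m = 0) or a column (n = M) of ones.  Starting from the last diagonal, where K = 1,
-- the sum over tableaux is turned diagonal by diagonal into the flat sum.
module Submission where

open import Defs
open import Data.Nat as ℕ using (ℕ; zero; suc; pred; _∸_; _≤_; _<_; z≤n; s≤s; _≤?_; _<?_; _⊓_)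
import Data.Nat.Properties as ℕ
open import Data.Nat.ListAction using (product)
open import Data.Integer as ℤ using (ℤ; +_)
import Data.Integer.Properties as ℤ
import Data.Integer.Tactic.RingSolver as ℤSolver
open import Data.Rational as ℚ using (ℚ; 0ℚ; 1ℚ; _+_; _*_; _-_; toℚᵘ)
open import Data.Rational.Properties
  using (+-*-commutativeRing; +-identityˡ; +-identityʳ; *-identityˡ; *-identityʳ; *-zeroˡ; *-zeroʳ;
         toℚᵘ-injective; toℚᵘ-homo-+; toℚᵘ-homo-*; toℚᵘ-fromℚᵘ)
  renaming (_≟_ to _≟ℚ_)
import Data.Rational.Unnormalised as ℚᵘ
import Data.Rational.Unnormalised.Properties as ℚᵘ
open import Data.Bool using (Bool; if_then_else_; true; false; not)
open import Data.Empty using (⊥)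
open import Data.Unit using (⊤; tt)
open import Data.Product using (_×_; _,_; proj₁; proj₂; ∃; ∃₂)
open import Data.Product.Function.NonDependent.Propositional using (_×-⇔_)
open import Data.Sum using (_⊎_; inj₁; inj₂)
open import Data.List
  using (List; []; _∷_; _++_; _∷ʳ_; map; length; concatMap; replicate; applyUpTo; upTo; filter; foldr)
open import Data.List.Properties
  using (map-id; map-∘; map-cong; map-cong-local; map-++; map-applyUpTo; length-map; length-++;
         length-replicate; applyUpTo-∷ʳ; concatMap-++; concatMap-map)
open import Data.List.Membership.Propositional using (_∈_; _∉_; find; lose)
open import Data.List.Membership.Propositional.Properties
  using (∈-++⁺ˡ; ∈-++⁺ʳ; ∈-map⁺; ∈-map⁻; ∈-concatMap⁺; ∈-concatMap⁻; ∈-applyUpTo⁺; ∈-applyUpTo⁻;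
         ∈-filter⁺; ∈-filter⁻)
open import Data.List.Membership.Propositional.Properties.WithK using (unique∧set⇒bag)
open import Data.List.Relation.Binary.BagAndSetEquality using (∼bag⇒↭)
open import Data.List.Relation.Binary.Disjoint.Propositional using (Disjoint)
open import Data.List.Relation.Binary.Permutation.Propositional as ↭ using (_↭_; refl; prep; swap)
import Data.List.Relation.Binary.Permutation.Setoid.Properties as ↭ₛ
open import Data.List.Relation.Unary.All as All using (All; []; _∷_; all?)
import Data.List.Relation.Unary.All.Properties as All
open import Data.List.Relation.Unary.AllPairs as AllPairs using (AllPairs; []; _∷_)
import Data.List.Relation.Unary.AllPairs.Properties as AllPairs
open import Data.List.Relation.Unary.Any using (here; there)
open import Data.List.Relation.Unary.Any.Properties using (¬Any[])
open import Data.List.Relation.Unary.Linked as Linked using (Linked; []; [-]; _∷_)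
open import Data.List.Relation.Unary.Unique.Propositional using (Unique)
import Data.List.Relation.Unary.Unique.Propositional.Properties as Unique
open import Algebra.Properties.AbelianGroup ℤ.+-0-abelianGroup using (∙-cancelˡ; ∙-cancelʳ)
open import Function using (_∘_; flip; id; _⇔_; mk⇔; Equivalence)
open import Function.Construct.Composition using (_⇔-∘_)
open import Function.Construct.Identity using (⇔-id)
open import Function.Construct.Symmetry using (⇔-sym)
open import Level using (0ℓ)
open import Relation.Binary.Definitions using (Decidable; DecidableEquality)
open import Relation.Binary.PropositionalEquality hiding (J)
open import Relation.Nullary using (Dec; does; yes; no; ¬_; contradiction)
open import Relation.Nullary.Decidable using (_×-dec_; does-⇔; dec-true; dec-false; dec⇒maybe)
open import Tactic.RingSolver using (solve-∀)
open import Tactic.RingSolver.Core.AlmostCommutativeRing using (AlmostCommutativeRing; fromCommutativeRing)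
open Equivalence using (to; from)
open ≡-Reasoning

-- `X` is normalised for its boundary values: `X 0 n` and `X m M` are 1, which gives the borders of
-- ones, and `X m n` is 0 for `n < m`, which gives zero rows. The windows `a < x ≤ b` are half-open
-- because the increments `F x - F (x - 1)` then telescope to `F b - F a`. So every relation between
-- tuples has to be brought into the form `c₁ < x₁ ≤ c₂ < x₂ ≤ ...`; on the flat side this costs a
-- shift from `y` to `y - 1`. An exponent k is spent on one crossing, which creates the tuple
-- weighted by 1/(N-n), and on k-1 scalings, each of which creates one tuple weighted by 1/n. The
-- obstacle is that these relations concern a single `K m`, whereas the flat sum is deeply nested.
-- The flat sum is therefore set up as a linear functional of a kernel, the link to what was chosen
-- before. The kernel is `K m` while that is a diagonal `m` of the tableau, and an indicator of
-- interlacing once it is a flat tuple; a relation for `K` expands the first kind into the second.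
-- The functional evaluates its kernel on unsorted tuples as well, so both relations must hold there
-- too.

private variable
  A B C : Set
  P Q : Set

ℚ-ring : AlmostCommutativeRing 0ℓ 0ℓ
ℚ-ring = fromCommutativeRing +-*-commutativeRing λ x → dec⇒maybe (0ℚ ≟ℚ x)

*-zeroˡ′ : ∀ {x} → x ≡ 0ℚ → ∀ y → x * y ≡ 0ℚ
*-zeroˡ′ refl = *-zeroˡ

*-zeroʳ′ : ∀ x {y} → y ≡ 0ℚ → x * y ≡ 0ℚ
*-zeroʳ′ x refl = *-zeroʳ x

-- Finite sums

∑ : List A → (A → ℚ) → ℚ
∑ xs f = sumℚ (map f xs)

∑-cong∈ : ∀ {P : A → Set} {f g : A → ℚ} → (∀ x → P x → f x ≡ g x) →
          ∀ {xs} → All P xs → ∑ xs f ≡ ∑ xs g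
∑-cong∈ h []         = refl
∑-cong∈ h (px ∷ pxs) = cong₂ _+_ (h _ px) (∑-cong∈ h pxs)

∑-cong : ∀ {f g : A → ℚ} → (∀ x → f x ≡ g x) → ∀ xs → ∑ xs f ≡ ∑ xs g
∑-cong h []       = refl
∑-cong h (x ∷ xs) = cong₂ _+_ (h x) (∑-cong h xs)

∑-0 : ∀ (xs : List A) → ∑ xs (λ _ → 0ℚ) ≡ 0ℚ
∑-0 []       = refl
∑-0 (x ∷ xs) = trans (+-identityˡ _) (∑-0 xs)

∑-+ : ∀ (f g : A → ℚ) xs → ∑ xs (λ x → f x + g x) ≡ ∑ xs f + ∑ xs g
∑-+ f g []       = refl
∑-+ f g (x ∷ xs) = trans (cong (f x + g x ℚ.+_) (∑-+ f g xs)) (lem (f x) (g x) (∑ xs f) (∑ xs g))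
  where
  lem : ∀ a b c d → a + b + (c + d) ≡ a + c + (b + d)
  lem = solve-∀ ℚ-ring

∑-* : ∀ c (f : A → ℚ) xs → c * ∑ xs f ≡ ∑ xs (λ x → c * f x)
∑-* c f []       = *-zeroʳ c
∑-* c f (x ∷ xs) = trans (lem c (f x) (∑ xs f)) (cong (c * f x ℚ.+_) (∑-* c f xs))
  where
  lem : ∀ a b c → a * (b + c) ≡ a * b + a * c
  lem = solve-∀ ℚ-ring

∑-minus : ∀ (f g : A → ℚ) xs → ∑ xs (λ x → f x - g x) ≡ ∑ xs f - ∑ xs g
∑-minus f g []       = refl
∑-minus f g (x ∷ xs) = trans (cong (f x - g x ℚ.+_) (∑-minus f g xs)) (lem (f x) (g x) (∑ xs f) (∑ xs g))
  where
  lem : ∀ a b c d → a - b + (c - d) ≡ a + c - (b + d)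
  lem = solve-∀ ℚ-ring

∑-swap : ∀ (f : A → B → ℚ) xs ys → ∑ xs (λ x → ∑ ys (f x)) ≡ ∑ ys (λ y → ∑ xs (λ x → f x y))
∑-swap f []       ys = sym (∑-0 ys)
∑-swap f (x ∷ xs) ys = trans (cong (∑ ys (f x) ℚ.+_) (∑-swap f xs ys)) (sym (∑-+ (f x) _ ys))

∑-++ : ∀ (f : A → ℚ) xs ys → ∑ (xs ++ ys) f ≡ ∑ xs f + ∑ ys f
∑-++ f []       ys = sym (+-identityˡ _)
∑-++ f (x ∷ xs) ys = trans (cong (f x ℚ.+_) (∑-++ f xs ys)) (lem (f x) (∑ xs f) (∑ ys f))
  where
  lem : ∀ a b c → a + (b + c) ≡ a + b + c
  lem = solve-∀ ℚ-ring

∑-map : ∀ (f : B → ℚ) (g : A → B) xs → ∑ (map g xs) f ≡ ∑ xs (f ∘ g)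
∑-map f g []       = refl
∑-map f g (x ∷ xs) = cong (f (g x) ℚ.+_) (∑-map f g xs)

∑-concatMap : ∀ (f : B → ℚ) (g : A → List B) xs → ∑ (concatMap g xs) f ≡ ∑ xs (λ x → ∑ (g x) f)
∑-concatMap f g []       = refl
∑-concatMap f g (x ∷ xs) = trans (∑-++ f (g x) _) (cong (∑ (g x) f ℚ.+_) (∑-concatMap f g xs))

∏ : List A → (A → ℚ) → ℚ
∏ xs f = prodℚ (map f xs)

-- Determinants

-- The second argument of `f` is the list with the chosen entry deleted, as in a Laplace expansion;
-- nested subtraction produces the alternating signs.
∑± : (A → List A → ℚ) → List A → ℚ
∑± f []       = 0ℚ
∑± f (x ∷ xs) = f x xs - ∑± (λ y ys → f y (x ∷ ys)) xs

∑±-cong∈ : ∀ {P : A → Set} {f g : A → List A → ℚ} →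
           (∀ x xs → P x → All P xs → f x xs ≡ g x xs) → ∀ {xs} → All P xs → ∑± f xs ≡ ∑± g xs
∑±-cong∈ h []         = refl
∑±-cong∈ h (px ∷ pxs) =
  cong₂ _-_ (h _ _ px pxs) (∑±-cong∈ (λ y ys py pys → h y _ py (px ∷ pys)) pxs)

∑±-cong : ∀ {f g : A → List A → ℚ} → (∀ x xs → f x xs ≡ g x xs) → ∀ xs → ∑± f xs ≡ ∑± g xs
∑±-cong h []       = refl
∑±-cong h (x ∷ xs) = cong₂ _-_ (h x xs) (∑±-cong (λ y ys → h y (x ∷ ys)) xs)

∑±-0 : ∀ (xs : List A) → ∑± (λ _ _ → 0ℚ) xs ≡ 0ℚ
∑±-0 []       = refl
∑±-0 (x ∷ xs) = cong (0ℚ -_) (∑±-0 xs)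

∑±-minus : ∀ (f g : A → List A → ℚ) xs → ∑± (λ x ys → f x ys - g x ys) xs ≡ ∑± f xs - ∑± g xs
∑±-minus f g []       = refl
∑±-minus f g (x ∷ xs) = trans (cong (f x xs - g x xs -_) (∑±-minus _ _ xs)) (lem (f x xs) (g x xs) _ _)
  where
  lem : ∀ a b c d → a - b - (c - d) ≡ a - c - (b - d)
  lem = solve-∀ ℚ-ring

∑±-* : ∀ c (f : A → List A → ℚ) xs → c * ∑± f xs ≡ ∑± (λ x ys → c * f x ys) xs
∑±-* c f []       = *-zeroʳ c
∑±-* c f (x ∷ xs) = trans (lem c (f x xs) _) (cong (c * f x xs -_) (∑±-* c _ xs))
  where
  lem : ∀ a b c → a * (b - c) ≡ a * b - a * c
  lem = solve-∀ ℚ-ring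

∑±-∑ : ∀ (f : B → A → List A → ℚ) ws xs →
       ∑± (λ x ys → ∑ ws (λ w → f w x ys)) xs ≡ ∑ ws (λ w → ∑± (f w) xs)
∑±-∑ f ws []       = sym (∑-0 ws)
∑±-∑ f ws (x ∷ xs) =
  trans (cong (∑ ws (λ w → f w x xs) -_) (∑±-∑ (λ w y ys → f w y (x ∷ ys)) ws xs)) (sym (∑-minus _ _ ws))

∑±-swap : ∀ (f : A → List A → B → List B → ℚ) xs ys →
          ∑± (λ x xs′ → ∑± (f x xs′) ys) xs ≡ ∑± (λ y ys′ → ∑± (λ x xs′ → f x xs′ y ys′) xs) ys
∑±-swap f []       ys = sym (∑±-0 ys)
∑±-swap f (x ∷ xs) ys =
  trans (cong (∑± (f x xs) ys -_) (∑±-swap (λ x′ xs′ → f x′ (x ∷ xs′)) xs ys)) (sym (∑±-minus _ _ ys))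

∑±-map : ∀ (f : B → List B → ℚ) (g : A → B) xs →
         ∑± f (map g xs) ≡ ∑± (λ x ys → f (g x) (map g ys)) xs
∑±-map f g []       = refl
∑±-map f g (x ∷ xs) = cong (f (g x) (map g xs) -_) (∑±-map (λ y ys → f y (g x ∷ ys)) g xs)

∑±-∷ʳ : ∀ (f : A → List A → ℚ) z → (∀ ys → f z ys ≡ 0ℚ) →
        ∀ xs → ∑± f (xs ∷ʳ z) ≡ ∑± (λ x ys → f x (ys ∷ʳ z)) xs
∑±-∷ʳ f z h []       = cong (_- 0ℚ) (h [])
∑±-∷ʳ f z h (x ∷ xs) = cong (f x (xs ∷ʳ z) -_) (∑±-∷ʳ (λ y ys → f y (x ∷ ys)) z (h ∘ (x ∷_)) xs)

-- Laplace expansion along the first row. A non-square matrix gets the value 0, which keeps the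
-- identities below true for lists of any lengths.
det : (A → B → ℚ) → List A → List B → ℚ
det φ []       []      = 1ℚ
det φ []       (_ ∷ _) = 0ℚ
det φ (a ∷ as) bs      = ∑± (λ b bs′ → φ a b * det φ as bs′) bs

det-cong : ∀ {P : A → Set} {Q : B → Set} {φ ψ : A → B → ℚ} → (∀ a b → P a → Q b → φ a b ≡ ψ a b) →
           ∀ {as bs} → All P as → All Q bs → det φ as bs ≡ det ψ as bs
det-cong h []         []      = refl
det-cong h []         (_ ∷ _) = refl
det-cong h (pa ∷ pas) qbs     =
  ∑±-cong∈ (λ b bs qb qbs′ → cong₂ _*_ (h _ b pa qb) (det-cong h pas qbs′)) qbs

det-map : ∀ (φ : A → B → ℚ) {A′ B′ : Set} (f : A′ → A) (g : B′ → B) as bs →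
          det φ (map f as) (map g bs) ≡ det (λ a b → φ (f a) (g b)) as bs
det-map φ f g []       []       = refl
det-map φ f g []       (b ∷ bs) = refl
det-map φ f g (a ∷ as) bs       =
  trans (∑±-map _ g bs) (∑±-cong (λ b bs′ → cong (φ (f a) (g b) *_) (det-map φ f g as bs′)) bs)

-- After expansion along the first row, every minor that still contains the column `b` is expanded
-- along it by induction; the two alternating sums then commute.
det-column : ∀ (φ : A → B → ℚ) as b bs →
             det φ as (b ∷ bs) ≡ ∑± (λ a as′ → φ a b * det φ as′ bs) as
det-column φ []       b bs = refl
det-column φ (a ∷ as) b bs = cong (φ a b * det φ as bs -_) (begin
  ∑± (λ b′ bs′ → φ a b′ * det φ as (b ∷ bs′)) bs
    ≡⟨ ∑±-cong (λ b′ bs′ → trans (cong (φ a b′ *_) (det-column φ as b bs′)) (∑±-* (φ a b′) (λ a′ as′ → φ a′ b * det φ as′ bs′) as)) bs ⟩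
  ∑± (λ b′ bs′ → ∑± (λ a′ as′ → φ a b′ * (φ a′ b * det φ as′ bs′)) as) bs
    ≡⟨ ∑±-swap _ bs as ⟩
  ∑± (λ a′ as′ → ∑± (λ b′ bs′ → φ a b′ * (φ a′ b * det φ as′ bs′)) bs) as
    ≡⟨ ∑±-cong (λ a′ as′ → trans (∑±-cong (λ b′ bs′ → lem (φ a b′) (φ a′ b) (det φ as′ bs′)) bs)
                                 (sym (∑±-* (φ a′ b) (λ b′ bs′ → φ a b′ * det φ as′ bs′) bs))) as ⟩
  ∑± (λ a′ as′ → φ a′ b * det φ (a ∷ as′) bs) as ∎)
  where
  lem : ∀ x y z → x * (y * z) ≡ y * (x * z)
  lem = solve-∀ ℚ-ring

det-transpose : ∀ (φ : A → B → ℚ) as bs → det φ as bs ≡ det (flip φ) bs as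
det-transpose φ []       []       = refl
det-transpose φ []       (b ∷ bs) = refl
det-transpose φ (a ∷ as) bs       =
  trans (∑±-cong (λ b bs′ → cong (φ a b *_) (det-transpose φ as bs′)) bs)
        (sym (det-column (flip φ) bs a as))

det-scale : ∀ (w : A → ℚ) (φ : A → B → ℚ) as bs →
            ∏ as w * det φ as bs ≡ det (λ a b → w a * φ a b) as bs
det-scale w φ []       []       = refl
det-scale w φ []       (b ∷ bs) = refl
det-scale w φ (a ∷ as) bs       =
  trans (∑±-* (w a * ∏ as w) _ bs)
        (∑±-cong (λ b bs′ → trans (lem (w a) (∏ as w) (φ a b) (det φ as bs′))
                                  (cong (w a * φ a b *_) (det-scale w φ as bs′))) bs)
  where
  lem : ∀ x y z t → x * y * (z * t) ≡ x * z * (y * t)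
  lem = solve-∀ ℚ-ring

-- In the first-row expansion the terms of the two equal columns cancel; in all other minors both
-- columns survive in front.
det-equal-columns : ∀ (φ : A → B → ℚ) as b bs → det φ as (b ∷ b ∷ bs) ≡ 0ℚ
det-equal-columns φ []       b bs = refl
det-equal-columns φ (a ∷ as) b bs = begin
  x - (x - ∑± (λ b′ bs′ → φ a b′ * det φ as (b ∷ b ∷ bs′)) bs)
    ≡⟨ lem x _ ⟩
  ∑± (λ b′ bs′ → φ a b′ * det φ as (b ∷ b ∷ bs′)) bs
    ≡⟨ ∑±-cong (λ b′ bs′ → *-zeroʳ′ (φ a b′) (det-equal-columns φ as b bs′)) bs ⟩
  ∑± (λ _ _ → 0ℚ) bs
    ≡⟨ ∑±-0 bs ⟩
  0ℚ ∎
  where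
  x : ℚ
  x = φ a b * det φ as (b ∷ bs)
  lem : ∀ x y → x - (x - y) ≡ y
  lem = solve-∀ ℚ-ring

-- Row operations and bordered determinants

rows : List (B → ℚ) → List B → ℚ
rows = det id

infixl 6 _⊖_
_⊖_ : (B → ℚ) → (B → ℚ) → B → ℚ
(u ⊖ v) b = u b - v b

rows-⊖ : ∀ (u v : B → ℚ) us bs → rows ((u ⊖ v) ∷ us) bs ≡ rows (u ∷ us) bs - rows (v ∷ us) bs
rows-⊖ u v us bs = trans (∑±-cong (λ b bs′ → lem (u b) (v b) (rows us bs′)) bs) (∑±-minus _ _ bs)
  where
  lem : ∀ x y z → (x - y) * z ≡ x * z - y * z
  lem = solve-∀ ℚ-ring

rows-cong-tail : ∀ (u : B → ℚ) us vs → (∀ bs → rows us bs ≡ rows vs bs) →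
                 ∀ bs → rows (u ∷ us) bs ≡ rows (u ∷ vs) bs
rows-cong-tail u us vs h bs = ∑±-cong (λ b bs′ → cong (u b *_) (h bs′)) bs

rows-equal : ∀ (u : B → ℚ) us bs → rows (u ∷ u ∷ us) bs ≡ 0ℚ
rows-equal u us bs = trans (det-transpose id (u ∷ u ∷ us) bs) (det-equal-columns (flip id) bs u us)

rows-zero : ∀ (u : B → ℚ) us {bs} → All (λ b → u b ≡ 0ℚ) bs → rows (u ∷ us) bs ≡ 0ℚ
rows-zero u us {bs} h =
  trans (∑±-cong∈ (λ b bs′ ub _ → *-zeroˡ′ ub (rows us bs′)) h) (∑±-0 bs)

columns-zero : ∀ {us : List (B → ℚ)} b bs → All (λ u → u b ≡ 0ℚ) us → rows us (b ∷ bs) ≡ 0ℚ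
columns-zero {us = us} b bs h =
  trans (det-column id us b bs)
  (trans (∑±-cong∈ (λ u us′ ub _ → *-zeroˡ′ ub (rows us′ bs)) h) (∑±-0 us))

subtract-next : ∀ (u v : B → ℚ) us bs → rows ((u ⊖ v) ∷ v ∷ us) bs ≡ rows (u ∷ v ∷ us) bs
subtract-next u v us bs =
  trans (rows-⊖ u v (v ∷ us) bs) (trans (cong (rows (u ∷ v ∷ us) bs -_) (rows-equal v us bs)) (lem _))
  where
  lem : ∀ x → x - 0ℚ ≡ x
  lem = solve-∀ ℚ-ring

subtract-zero : ∀ (u z : B → ℚ) us {bs} → All (λ b → z b ≡ 0ℚ) bs → rows ((u ⊖ z) ∷ us) bs ≡ rows (u ∷ us) bs
subtract-zero u z us {bs} h =
  trans (rows-⊖ u z us bs) (trans (cong (rows (u ∷ us) bs -_) (rows-zero z us h)) (lem _))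
  where
  lem : ∀ x → x - 0ℚ ≡ x
  lem = solve-∀ ℚ-ring

steps : List A → List (A × A)
steps []           = []
steps (x ∷ [])     = []
steps (x ∷ y ∷ xs) = (x , y) ∷ steps (y ∷ xs)

steps-map : ∀ (f : A → B) xs → steps (map f xs) ≡ map (λ (x , y) → f x , f y) (steps xs)
steps-map f []           = refl
steps-map f (x ∷ [])     = refl
steps-map f (x ∷ y ∷ xs) = cong ((f x , f y) ∷_) (steps-map f (y ∷ xs))

length-steps : ∀ (x : A) xs → length (steps (x ∷ xs)) ≡ length xs
length-steps x []       = refl
length-steps x (y ∷ xs) = cong suc (length-steps y xs)

drops rises : List (B → ℚ) → List (B → ℚ)
drops = map (λ (u , v) → u ⊖ v) ∘ steps
rises = map (λ (u , v) → v ⊖ u) ∘ steps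

-- The subtractions are undone from the bottom up: the last difference is the last row minus a zero
-- row, and each earlier one differs from its row by a row already restored.
drops-∷ʳ-zero : ∀ us (z : B → ℚ) {bs} → All (λ b → z b ≡ 0ℚ) bs → rows (drops (us ∷ʳ z)) bs ≡ rows us bs
drops-∷ʳ-zero []           z h = refl
drops-∷ʳ-zero (u ∷ [])     z h = subtract-zero u z [] h
drops-∷ʳ-zero (u ∷ v ∷ us) z {bs} h =
  trans (∑±-cong∈ (λ b bs′ _ h′ → cong ((u ⊖ v) b *_) (drops-∷ʳ-zero (v ∷ us) z h′)) h) (subtract-next u v us bs)

-- The halfway stage of the bordering argument: every row except the last has been replaced by a
-- difference.
last-row : (B → ℚ) → List (B → ℚ) → List (B → ℚ)
last-row u []       = u ∷ []
last-row u (v ∷ us) = (u ⊖ v) ∷ last-row v us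

rows-last-row : ∀ (u : B → ℚ) us bs → rows (last-row u us) bs ≡ rows (u ∷ us) bs
rows-last-row u []       bs = refl
rows-last-row u (v ∷ us) bs =
  trans (rows-cong-tail (u ⊖ v) (last-row v us) (v ∷ us) (rows-last-row v us) bs) (subtract-next u v us bs)

-- In the column `o` of ones all differences vanish and only the undifferenced last row keeps its 1.
-- Expanding there leaves the differences, with positive sign since row and column are both last.
drops-ones : ∀ (u : B → ℚ) us bs {o} → All (λ v → v o ≡ 1ℚ) (u ∷ us) →
             rows (drops (u ∷ us)) bs ≡ rows (u ∷ us) (bs ∷ʳ o)
drops-ones {B} u us bs {o} h = trans (go u us bs h) (rows-last-row u us (bs ∷ʳ o))
  where
  go : ∀ u us bs → All (λ v → v o ≡ 1ℚ) (u ∷ us) → rows (drops (u ∷ us)) bs ≡ rows (last-row u us) (bs ∷ʳ o)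
  go u []       []       (uo ∷ []) = sym (cong (λ x → x * 1ℚ - 0ℚ) uo)
  go u []       (b ∷ bs) (uo ∷ []) = sym (many bs)
    where
    many : ∀ bs → rows (u ∷ []) (b ∷ bs ∷ʳ o) ≡ 0ℚ
    many []       = trans (det-column id (u ∷ []) b (o ∷ [])) (cong (_- 0ℚ) (*-zeroʳ (u b)))
    many (c ∷ bs) = trans (det-column id (u ∷ []) b (c ∷ bs ∷ʳ o)) (cong (_- 0ℚ) (*-zeroʳ (u b)))
  go u (v ∷ us) bs (uo ∷ vo ∷ h) = sym (trans
    (∑±-∷ʳ _ o (λ ys → *-zeroˡ′ (cong₂ _-_ uo vo) (rows (last-row v us) ys)) bs)
    (∑±-cong (λ b bs′ → cong ((u ⊖ v) b *_) (sym (go v us bs′ (vo ∷ h)))) bs))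

-- The second row is split by linearity; its part `u` repeats the first row and drops out.
rises-first-row : ∀ (u : B → ℚ) us bs → rows (u ∷ rises (u ∷ us)) bs ≡ rows (u ∷ us) bs
rises-first-row u []       bs = refl
rises-first-row u (v ∷ us) bs = begin
  rows (u ∷ (v ⊖ u) ∷ r) bs
    ≡⟨ ∑±-cong (λ b bs′ → trans (cong (u b *_) (rows-⊖ v u r bs′)) (lem (u b) _ _)) bs ⟩
  ∑± (λ b bs′ → u b * rows (v ∷ r) bs′ - u b * rows (u ∷ r) bs′) bs
    ≡⟨ ∑±-minus _ _ bs ⟩
  rows (u ∷ v ∷ r) bs - rows (u ∷ u ∷ r) bs
    ≡⟨ cong₂ _-_ (rows-cong-tail u (v ∷ r) (v ∷ us) (rises-first-row v us) bs) (rows-equal u r bs) ⟩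
  rows (u ∷ v ∷ us) bs - 0ℚ
    ≡⟨ lem′ _ ⟩
  rows (u ∷ v ∷ us) bs ∎
  where
  r = rises (v ∷ us)
  lem : ∀ x y z → x * (y - z) ≡ x * y - x * z
  lem = solve-∀ ℚ-ring
  lem′ : ∀ x → x - 0ℚ ≡ x
  lem′ = solve-∀ ℚ-ring

rises-zero : ∀ (z : B → ℚ) us {bs} → All (λ b → z b ≡ 0ℚ) bs → rows (rises (z ∷ us)) bs ≡ rows us bs
rises-zero z []       h = refl
rises-zero z (u ∷ us) {bs} h =
  trans (subtract-zero u z (rises (u ∷ us)) h) (rises-first-row u us bs)

-- With the first row kept and the others replaced by differences, the column `o` is cleared except
-- for its top entry 1, and expansion along it leaves the differences.
rises-ones : ∀ (u : B → ℚ) us bs {o} → All (λ v → v o ≡ 1ℚ) (u ∷ us) →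
             rows (rises (u ∷ us)) bs ≡ rows (u ∷ us) (o ∷ bs)
rises-ones u us bs {o} h@(uo ∷ _) = sym (begin
  rows (u ∷ us) (o ∷ bs)
    ≡⟨ rises-first-row u us (o ∷ bs) ⟨
  u o * rows r bs - ∑± (λ b bs′ → u b * rows r (o ∷ bs′)) bs
    ≡⟨ cong₂ (λ x y → x * rows r bs - y) uo
         (trans (∑±-cong (λ b bs′ → *-zeroʳ′ (u b) (columns-zero o bs′ (vanish u us h))) bs)
                (∑±-0 bs)) ⟩
  1ℚ * rows r bs - 0ℚ
    ≡⟨ lem (rows r bs) ⟩
  rows r bs ∎)
  where
  r = rises (u ∷ us)
  lem : ∀ x → 1ℚ * x - 0ℚ ≡ x
  lem = solve-∀ ℚ-ring
  vanish : ∀ u us → All (λ v → v o ≡ 1ℚ) (u ∷ us) → All (λ v → v o ≡ 0ℚ) (rises (u ∷ us))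
  vanish u []       _             = []
  vanish u (v ∷ us) (uo ∷ vo ∷ h) = cong₂ _-_ vo uo ∷ vanish v us (vo ∷ h)

-- Naturals, reciprocals and indicators as rational numbers

⟦_⟧ : ℕ → ℚ
⟦ n ⟧ = ℤ.+ n ℚ./ 1

toℚᵘ-/ : ∀ i n → toℚᵘ (i ℚ./ suc n) ℚᵘ.≃ ℚᵘ.mkℚᵘ i n
toℚᵘ-/ i n = toℚᵘ-fromℚᵘ (ℚᵘ.mkℚᵘ i n)

⟦+⟧ : ∀ m n → ⟦ m ℕ.+ n ⟧ ≡ ⟦ m ⟧ + ⟦ n ⟧
⟦+⟧ m n = toℚᵘ-injective (ℚᵘ.≃-trans (toℚᵘ-/ (ℤ.+ (m ℕ.+ n)) 0) (ℚᵘ.≃-trans (ℚᵘ.*≡* lem)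
  (ℚᵘ.≃-sym (ℚᵘ.≃-trans (toℚᵘ-homo-+ ⟦ m ⟧ ⟦ n ⟧) (ℚᵘ.+-cong (toℚᵘ-/ (ℤ.+ m) 0) (toℚᵘ-/ (ℤ.+ n) 0))))))
  where
  lem : ℤ.+ (m ℕ.+ n) ℤ.* (ℤ.+ 1 ℤ.* ℤ.+ 1) ≡ (ℤ.+ m ℤ.* ℤ.+ 1 ℤ.+ ℤ.+ n ℤ.* ℤ.+ 1) ℤ.* ℤ.+ 1
  lem rewrite ℤ.*-identityʳ (ℤ.+ m) | ℤ.*-identityʳ (ℤ.+ n) = refl

inv-* : ∀ m n → inv (m ℕ.* n) ≡ inv m * inv n
inv-* zero    n       = sym (*-zeroˡ (inv n))
inv-* (suc m) zero    = trans (cong inv (ℕ.*-zeroʳ (suc m))) (sym (*-zeroʳ (inv (suc m))))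
inv-* (suc m) (suc n) = toℚᵘ-injective (ℚᵘ.≃-trans (toℚᵘ-/ (ℤ.+ 1) (n ℕ.+ m ℕ.* suc n)) (ℚᵘ.≃-sym
  (ℚᵘ.≃-trans (toℚᵘ-homo-* (inv (suc m)) (inv (suc n))) (ℚᵘ.*-cong (toℚᵘ-/ (ℤ.+ 1) m) (toℚᵘ-/ (ℤ.+ 1) n)))))

inv-inverse : ∀ n → 1 ≤ n → ⟦ n ⟧ * inv n ≡ 1ℚ
inv-inverse (suc n) _ = toℚᵘ-injective (ℚᵘ.≃-trans (toℚᵘ-homo-* ⟦ suc n ⟧ (inv (suc n)))
  (ℚᵘ.≃-trans (ℚᵘ.*-cong (toℚᵘ-/ (ℤ.+ suc n) 0) (toℚᵘ-/ (ℤ.+ 1) n)) (ℚᵘ.*≡* lem)))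
  where
  lem : (ℤ.+ suc n ℤ.* ℤ.+ 1) ℤ.* ℤ.+ 1 ≡ ℤ.+ 1 ℤ.* (ℤ.+ 1 ℤ.* ℤ.+ suc n)
  lem rewrite ℕ.*-identityʳ (n ℕ.* 1) | ℕ.*-identityʳ n | ℕ.+-identityʳ (n ℕ.+ 0) | ℕ.+-identityʳ n = refl

⟦∸⟧ : ∀ {m n} → m ≤ n → ⟦ n ∸ m ⟧ ≡ ⟦ n ⟧ - ⟦ m ⟧
⟦∸⟧ {m} {n} m≤n = begin
  ⟦ n ∸ m ⟧                   ≡⟨ lem ⟦ n ∸ m ⟧ ⟦ m ⟧ ⟩
  ⟦ n ∸ m ⟧ + ⟦ m ⟧ - ⟦ m ⟧   ≡⟨ cong (_- ⟦ m ⟧) (⟦+⟧ (n ∸ m) m) ⟨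
  ⟦ n ∸ m ℕ.+ m ⟧ - ⟦ m ⟧     ≡⟨ cong (λ k → ⟦ k ⟧ - ⟦ m ⟧) (ℕ.m∸n+n≡m m≤n) ⟩
  ⟦ n ⟧ - ⟦ m ⟧ ∎
  where
  lem : ∀ x y → x ≡ x + y - y
  lem = solve-∀ ℚ-ring

ind : Dec P → ℚ
ind p? = if does p? then 1ℚ else 0ℚ

ind-yes : (p? : Dec P) → P → ind p? ≡ 1ℚ
ind-yes p? p rewrite dec-true p? p = refl

ind-no : (p? : Dec P) → ¬ P → ind p? ≡ 0ℚ
ind-no p? ¬p rewrite dec-false p? ¬p = refl

ind-× : (p? : Dec P) (q? : Dec Q) → ind (p? ×-dec q?) ≡ ind p? * ind q?
ind-× (yes p) q? = sym (*-identityˡ (ind q?))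
ind-× (no ¬p) q? = sym (*-zeroˡ (ind q?))

ind-⇔ : P ⇔ Q → (p? : Dec P) (q? : Dec Q) → ind p? ≡ ind q?
ind-⇔ e p? q? = cong (if_then 1ℚ else 0ℚ) (does-⇔ e p? q?)

ind-guard : (p? : Dec P) {x y : ℚ} → (P → x ≡ y) → ind p? * x ≡ ind p? * y
ind-guard (yes p) h = cong (1ℚ *_) (h p)
ind-guard (no ¬p) {x} {y} h = trans (*-zeroˡ x) (sym (*-zeroˡ y))

-- C(n, m) / C(M, m), extended by 0 to n < m
connector : ℕ → ℕ → ℕ → ℚ
connector M zero    n = 1ℚ
connector M (suc m) n = connector M m n * (⟦ n ∸ m ⟧ * inv (M ∸ m))

window : ℕ → ℕ → ℕ → ℚ
window a b x = ind ((a <? x) ×-dec (x ≤? b))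

-- The binomial connector

module Connector (M : ℕ) where

  X : ℕ → ℕ → ℚ
  X = connector M

  X-< : ∀ {m n} → n < m → X m n ≡ 0ℚ
  X-< {suc m} {n} (s≤s n≤m) with ℕ.m≤n⇒m<n∨m≡n n≤m
  ... | inj₁ n<m  = *-zeroˡ′ (X-< n<m) (⟦ n ∸ m ⟧ * inv (M ∸ m))
  ... | inj₂ refl = *-zeroʳ′ (X m m) (*-zeroˡ′ (cong ⟦_⟧ (ℕ.n∸n≡0 m)) (inv (M ∸ m)))

  X-M : ∀ {m} → m ≤ M → X m M ≡ 1ℚ
  X-M {zero}  _   = refl
  X-M {suc m} m<M = cong₂ _*_ (X-M (ℕ.<⇒≤ m<M)) (inv-inverse (M ∸ m) (ℕ.m<n⇒0<n∸m m<M))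

  -- Truncated and true subtraction differ only for `n < m`, where `X m n` vanishes; afterwards the
  -- ring solver can treat the factor as a difference.
  X-∸ : ∀ m n → X m n * ⟦ n ∸ m ⟧ ≡ X m n * (⟦ n ⟧ - ⟦ m ⟧)
  X-∸ m n with ℕ.≤-<-connex m n
  ... | inj₁ m≤n = cong (X m n *_) (⟦∸⟧ m≤n)
  ... | inj₂ n<m = trans (*-zeroˡ′ (X-< n<m) ⟦ n ∸ m ⟧) (sym (*-zeroˡ′ (X-< n<m) (⟦ n ⟧ - ⟦ m ⟧)))

  -- Absorption, C(n+1,m+1) = (n+1)/(m+1) C(n,m); the factor m+1 cancels against the one in C(M,m+1)
  -- = (M-m)/(m+1) C(M,m).
  X-suc-suc : ∀ m n → X (suc m) (suc n) ≡ ⟦ suc n ⟧ * (X m n * inv (M ∸ m))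
  X-suc-suc zero    n = lem ⟦ suc n ⟧ (inv M)
    where
    lem : ∀ x y → 1ℚ * (x * y) ≡ x * (1ℚ * y)
    lem = solve-∀ ℚ-ring
  X-suc-suc (suc m) n =
    trans (cong (_* (⟦ n ∸ m ⟧ * inv (M ∸ suc m))) (X-suc-suc m n))
          (lem ⟦ suc n ⟧ (X m n) (inv (M ∸ m)) ⟦ n ∸ m ⟧ (inv (M ∸ suc m)))
    where
    lem : ∀ a x i d j → a * (x * i) * (d * j) ≡ a * (x * (d * i) * j)
    lem = solve-∀ ℚ-ring

  -- This lemma and the next two bring three expressions to the common value `X m n * inv (M ∸ m)`,
  -- and each transport relation equates two of them. The present one is Pascal's rule, normalised.
  X-diff-n : ∀ m n → inv (suc m) * (X (suc m) (suc n) - X (suc m) n) ≡ X m n * inv (M ∸ m)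
  X-diff-n m n = begin
    inv (suc m) * (X (suc m) (suc n) - X (suc m) n)
      ≡⟨ cong (inv (suc m) *_) (begin
        X (suc m) (suc n) - X m n * (⟦ n ∸ m ⟧ * i)
          ≡⟨ cong₂ _-_ (X-suc-suc m n) (trans (assoc (X m n) ⟦ n ∸ m ⟧ i) (cong (_* i) (X-∸ m n))) ⟩
        ⟦ suc n ⟧ * (X m n * i) - X m n * (⟦ n ⟧ - ⟦ m ⟧) * i
          ≡⟨ cong (λ t → t * (X m n * i) - X m n * (⟦ n ⟧ - ⟦ m ⟧) * i) (⟦+⟧ 1 n) ⟩
        (1ℚ + ⟦ n ⟧) * (X m n * i) - X m n * (⟦ n ⟧ - ⟦ m ⟧) * i
          ≡⟨ lem 1ℚ ⟦ n ⟧ ⟦ m ⟧ (X m n) i ⟩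
        (1ℚ + ⟦ m ⟧) * (X m n * i)
          ≡⟨ cong (_* (X m n * i)) (⟦+⟧ 1 m) ⟨
        ⟦ suc m ⟧ * (X m n * i) ∎) ⟩
    inv (suc m) * (⟦ suc m ⟧ * (X m n * i))
      ≡⟨ lem′ (inv (suc m)) ⟦ suc m ⟧ (X m n * i) ⟩
    ⟦ suc m ⟧ * inv (suc m) * (X m n * i)
      ≡⟨ cong (_* (X m n * i)) (inv-inverse (suc m) (s≤s z≤n)) ⟩
    1ℚ * (X m n * i)
      ≡⟨ *-identityˡ _ ⟩
    X m n * i ∎
    where
    i : ℚ
    i = inv (M ∸ m)
    assoc : ∀ x y z → x * (y * z) ≡ x * y * z
    assoc = solve-∀ ℚ-ring
    lem : ∀ o n m x i → (o + n) * (x * i) - x * (n - m) * i ≡ (o + m) * (x * i)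
    lem = solve-∀ ℚ-ring
    lem′ : ∀ x y z → x * (y * z) ≡ y * x * z
    lem′ = solve-∀ ℚ-ring

  X-scale-n : ∀ m n → inv (suc n) * X (suc m) (suc n) ≡ X m n * inv (M ∸ m)
  X-scale-n m n = begin
    inv (suc n) * X (suc m) (suc n)
      ≡⟨ cong (inv (suc n) *_) (X-suc-suc m n) ⟩
    inv (suc n) * (⟦ suc n ⟧ * (X m n * inv (M ∸ m)))
      ≡⟨ lem (inv (suc n)) ⟦ suc n ⟧ (X m n * inv (M ∸ m)) ⟩
    ⟦ suc n ⟧ * inv (suc n) * (X m n * inv (M ∸ m))
      ≡⟨ cong (_* (X m n * inv (M ∸ m))) (inv-inverse (suc n) (s≤s z≤n)) ⟩
    1ℚ * (X m n * inv (M ∸ m))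
      ≡⟨ *-identityˡ _ ⟩
    X m n * inv (M ∸ m) ∎
    where
    lem : ∀ x y z → x * (y * z) ≡ y * x * z
    lem = solve-∀ ℚ-ring

  -- Both terms contain `X m n`, and 1 - (n-m)/(M-m) = (M-n)/(M-m).
  X-diff-m : ∀ {m n} → m < M → n < M → inv (M ∸ n) * (X m n - X (suc m) n) ≡ X m n * inv (M ∸ m)
  X-diff-m {m} {n} m<M n<M = begin
    j * (x - x * (⟦ n ∸ m ⟧ * i))
      ≡⟨ cong₂ (λ s t → j * (s - t)) (trans (sym (*-identityʳ x)) (cong (x *_) (sym (inv-inverse (M ∸ m) (ℕ.m<n⇒0<n∸m m<M)))))
               (trans (assoc x ⟦ n ∸ m ⟧ i) (cong (_* i) (X-∸ m n))) ⟩
    j * (x * (⟦ M ∸ m ⟧ * i) - x * (⟦ n ⟧ - ⟦ m ⟧) * i)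
      ≡⟨ cong (λ t → j * (x * (t * i) - x * (⟦ n ⟧ - ⟦ m ⟧) * i)) (⟦∸⟧ (ℕ.<⇒≤ m<M)) ⟩
    j * (x * ((⟦ M ⟧ - ⟦ m ⟧) * i) - x * (⟦ n ⟧ - ⟦ m ⟧) * i)
      ≡⟨ lem j x i ⟦ M ⟧ ⟦ m ⟧ ⟦ n ⟧ ⟩
    (⟦ M ⟧ - ⟦ n ⟧) * j * (x * i)
      ≡⟨ cong (λ t → t * j * (x * i)) (⟦∸⟧ (ℕ.<⇒≤ n<M)) ⟨
    ⟦ M ∸ n ⟧ * j * (x * i)
      ≡⟨ cong (_* (x * i)) (inv-inverse (M ∸ n) (ℕ.m<n⇒0<n∸m n<M)) ⟩
    1ℚ * (x * i)
      ≡⟨ *-identityˡ _ ⟩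
    x * i ∎
    where
    x i j : ℚ
    x = X m n
    i = inv (M ∸ m)
    j = inv (M ∸ n)
    assoc : ∀ x y z → x * (y * z) ≡ x * y * z
    assoc = solve-∀ ℚ-ring
    lem : ∀ j x i M m n → j * (x * ((M - m) * i) - x * (n - m) * i) ≡ (M - n) * j * (x * i)
    lem = solve-∀ ℚ-ring

  InRange : ℕ → Set
  InRange x = 1 ≤ x × x ≤ M

  rng : List ℕ
  rng = nrange 1 M

  rng-InRange : All InRange rng
  rng-InRange = All.applyUpTo⁺₁ suc M (λ i<M → s≤s z≤n , i<M)

  -- The two transport relations for the connector.
  transport-scale : ∀ {m n} → InRange m → InRange n → inv n * X m n ≡ inv m * (X m n - X m (pred n))
  transport-scale {suc m} {suc n} _ _ = trans (X-scale-n m n) (sym (X-diff-n m n))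

  transport-diff : ∀ {m n} → InRange m → InRange n →
    inv m * (X m n - X m (pred n)) ≡ inv (suc M ∸ n) * (X (pred m) (pred n) - X m (pred n))
  transport-diff {suc m} {suc n} (_ , m<M) (_ , n<M) = trans (X-diff-n m n) (sym (X-diff-m m<M n<M))

  -- Induction on the upper end of the range: the partial sum up to n is the difference of `F` at
  -- the ends of the window, cut off at n. The step `last` separates whether n+1 lies below, inside
  -- or above the window.
  telescope : ∀ (F : ℕ → ℚ) {a b} → a ≤ b → b ≤ M →
              ∑ rng (λ x → window a b x * (F x - F (pred x))) ≡ F b - F a
  telescope F {a} {b} a≤b b≤M =
    trans (go M) (cong₂ (λ s t → F s - F t) (ℕ.m≤n⇒m⊓n≡m b≤M) (ℕ.m≤n⇒m⊓n≡m (ℕ.≤-trans a≤b b≤M)))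
    where
    term : ℕ → ℚ
    term x = window a b x * (F x - F (pred x))
    z-z : ∀ x → 0ℚ ≡ x - x
    z-z = solve-∀ ℚ-ring
    last : ∀ n → F (b ⊓ n) - F (a ⊓ n) + (window a b (suc n) * (F (suc n) - F n) + 0ℚ) ≡ F (b ⊓ suc n) - F (a ⊓ suc n)
    last n with ℕ.≤-<-connex (suc n) a
    ... | inj₁ n<a rewrite ind-no ((a <? suc n) ×-dec (suc n ≤? b)) (λ (p , _) → ℕ.<⇒≱ p n<a)
                         | ℕ.m≥n⇒m⊓n≡n (ℕ.<⇒≤ n<a) | ℕ.m≥n⇒m⊓n≡n n<a
                         | ℕ.m≥n⇒m⊓n≡n (ℕ.≤-trans (ℕ.<⇒≤ n<a) a≤b) | ℕ.m≥n⇒m⊓n≡n (ℕ.≤-trans n<a a≤b)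
                         = lem (F n) (F (suc n))
      where
      lem : ∀ x y → x - x + (0ℚ * (y - x) + 0ℚ) ≡ y - y
      lem = solve-∀ ℚ-ring
    ... | inj₂ (s≤s a≤n) with ℕ.≤-<-connex (suc n) b
    ...   | inj₁ n<b rewrite ind-yes ((a <? suc n) ×-dec (suc n ≤? b)) (s≤s a≤n , n<b)
                         | ℕ.m≤n⇒m⊓n≡m a≤n | ℕ.m≤n⇒m⊓n≡m (ℕ.m≤n⇒m≤1+n a≤n)
                         | ℕ.m≥n⇒m⊓n≡n (ℕ.<⇒≤ n<b) | ℕ.m≥n⇒m⊓n≡n n<b
                         = lem (F n) (F (suc n)) (F a)
      where
      lem : ∀ x y z → x - z + (1ℚ * (y - x) + 0ℚ) ≡ y - z
      lem = solve-∀ ℚ-ring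
    ...   | inj₂ (s≤s b≤n) rewrite ind-no ((a <? suc n) ×-dec (suc n ≤? b)) (λ (_ , p) → ℕ.<⇒≱ p b≤n)
                         | ℕ.m≤n⇒m⊓n≡m a≤n | ℕ.m≤n⇒m⊓n≡m (ℕ.m≤n⇒m≤1+n a≤n)
                         | ℕ.m≤n⇒m⊓n≡m b≤n | ℕ.m≤n⇒m⊓n≡m (ℕ.m≤n⇒m≤1+n b≤n)
                         = lem (F n) (F (suc n)) (F b) (F a)
      where
      lem : ∀ x y z t → z - t + (0ℚ * (y - x) + 0ℚ) ≡ z - t
      lem = solve-∀ ℚ-ring
    go : ∀ n → ∑ (applyUpTo suc n) term ≡ F (b ⊓ n) - F (a ⊓ n)
    go zero rewrite ℕ.⊓-zeroʳ b | ℕ.⊓-zeroʳ a = z-z (F 0)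
    go (suc n) = begin
      ∑ (applyUpTo suc (suc n)) term
        ≡⟨ cong (λ l → ∑ l term) (applyUpTo-∷ʳ suc n) ⟨
      ∑ (applyUpTo suc n ∷ʳ suc n) term
        ≡⟨ ∑-++ term (applyUpTo suc n) (suc n ∷ []) ⟩
      ∑ (applyUpTo suc n) term + (term (suc n) + 0ℚ)
        ≡⟨ cong (_+ (term (suc n) + 0ℚ)) (go n) ⟩
      F (b ⊓ n) - F (a ⊓ n) + (term (suc n) + 0ℚ)
        ≡⟨ last n ⟩
      F (b ⊓ suc n) - F (a ⊓ suc n) ∎

-- Interlacing chains

-- The chain x₁ R y₁ S x₂ R y₂ S …, which may end on either side
Alt : (R S : ℕ → ℕ → Set) → List ℕ → List ℕ → Set
Alt R S (x ∷ xs)    (y ∷ ys) = R x y × Alt S R (y ∷ ys) xs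
Alt R S (x ∷ [])    []       = ⊤
Alt R S (x ∷ _ ∷ _) []       = ⊥
Alt R S []          []       = ⊤
Alt R S []          (_ ∷ _)  = ⊥

alt? : ∀ {R S} → Decidable R → Decidable S → Decidable (Alt R S)
alt? r s (x ∷ xs)    (y ∷ ys) = r x y ×-dec alt? s r (y ∷ ys) xs
alt? r s (x ∷ [])    []       = yes tt
alt? r s (x ∷ _ ∷ _) []       = no λ ()
alt? r s []          []       = yes tt
alt? r s []          (_ ∷ _)  = no λ ()

Interlaces : List ℕ → List ℕ → Set
Interlaces = Alt _<_ _≤_

interlaces? : Decidable Interlaces
interlaces? = alt? _<?_ _≤?_

Sorted : List ℕ → Set
Sorted = Linked _≤_

sorted? : ∀ xs → Dec (Sorted xs)
sorted? = Linked.linked? _≤?_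

interlaces⇒sortedˡ : ∀ c x → Interlaces c x → Sorted c
interlaces⇒sortedˡ []           _        _             = []
interlaces⇒sortedˡ (a ∷ [])     _        _             = [-]
interlaces⇒sortedˡ (a ∷ b ∷ c)  (x ∷ xs) (a<x , x≤b , p) =
  ℕ.≤-trans (ℕ.<⇒≤ a<x) x≤b ∷ interlaces⇒sortedˡ (b ∷ c) xs p

interlaces⇒sortedʳ : ∀ c x → Interlaces c x → Sorted x
interlaces⇒sortedʳ c           []            _ = []
interlaces⇒sortedʳ c           (x ∷ [])      _ = [-]
interlaces⇒sortedʳ (a ∷ b ∷ c) (x ∷ x′ ∷ xs) (_ , x≤b , p@(b<x′ , _)) =
  ℕ.≤-trans x≤b (ℕ.<⇒≤ b<x′) ∷ interlaces⇒sortedʳ (b ∷ c) (x′ ∷ xs) p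

sorted-0∷ : ∀ {xs} → Sorted xs → Sorted (0 ∷ xs)
sorted-0∷ []       = [-]
sorted-0∷ [-]      = z≤n ∷ [-]
sorted-0∷ (p ∷ ps) = z≤n ∷ p ∷ ps

sorted-∷ʳ : ∀ {xs n} → Sorted xs → All (_≤ n) xs → Sorted (xs ∷ʳ n)
sorted-∷ʳ []       _            = [-]
sorted-∷ʳ [-]      (x≤n ∷ _)    = x≤n ∷ [-]
sorted-∷ʳ (p ∷ ps) (_ ∷ xs≤n)   = p ∷ sorted-∷ʳ ps xs≤n

sorted-pred : ∀ {xs} → Sorted xs → Sorted (map pred xs)
sorted-pred []       = []
sorted-pred [-]      = [-]
sorted-pred (p ∷ ps) = ℕ.pred-mono-≤ p ∷ sorted-pred ps

-- Interlacing sums by multilinearity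

weigh : List (A → ℚ) → List A → ℚ
weigh []       []       = 1ℚ
weigh []       (_ ∷ _)  = 0ℚ
weigh (_ ∷ _)  []       = 0ℚ
weigh (w ∷ ws) (x ∷ xs) = w x * weigh ws xs

windows : (ℕ → ℚ) → List ℕ → List (ℕ → ℚ)
windows v c = map (λ (a , b) x → window a b x * v x) (steps c)

length-windows : ∀ v c {n} → length c ≡ suc n → length (windows v c) ≡ n
length-windows v (c₀ ∷ c) e = trans (length-map _ (steps (c₀ ∷ c))) (trans (length-steps c₀ c) (ℕ.suc-injective e))

-- An interlacing condition splits into one window for each entry of `xs`. The entries thus carry
-- independent weights, as multilinearity requires.
weigh-windows : ∀ (v : ℕ → ℚ) c xs → length c ≡ suc (length xs) →
  weigh (windows v c) xs ≡ ind (interlaces? c xs) * ∏ xs v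
weigh-windows v (c₀ ∷ [])     []       _ = refl
weigh-windows v (c₀ ∷ c₁ ∷ c) (x ∷ xs) e = begin
  window c₀ c₁ x * v x * weigh (windows v (c₁ ∷ c)) xs
    ≡⟨ cong₂ (λ s t → s * v x * t) (ind-× (c₀ <? x) (x ≤? c₁)) (weigh-windows v (c₁ ∷ c) xs (ℕ.suc-injective e)) ⟩
  p * q * v x * (r * ∏ xs v)
    ≡⟨ lem p q (v x) r (∏ xs v) ⟩
  p * (q * r) * (v x * ∏ xs v)
    ≡⟨ cong (_* (v x * ∏ xs v)) (trans (cong (p *_) (sym (ind-× (x ≤? c₁) (interlaces? (c₁ ∷ c) xs))))
                                       (sym (ind-× (c₀ <? x) (alt? _≤?_ _<?_ (x ∷ xs) (c₁ ∷ c))))) ⟩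
  ind (interlaces? (c₀ ∷ c₁ ∷ c) (x ∷ xs)) * (v x * ∏ xs v) ∎
  where
  p q r : ℚ
  p = ind (c₀ <? x)
  q = ind (x ≤? c₁)
  r = ind (interlaces? (c₁ ∷ c) xs)
  lem : ∀ p q v r w → p * q * v * (r * w) ≡ p * (q * r) * (v * w)
  lem = solve-∀ ℚ-ring

tuples : List A → ℕ → List (List A)
tuples vs zero    = [] ∷ []
tuples vs (suc n) = concatMap (λ v → map (v ∷_) (tuples vs n)) vs

∑-tuples-suc : ∀ (vs : List A) n f → ∑ (tuples vs (suc n)) f ≡ ∑ vs (λ v → ∑ (tuples vs n) (λ xs → f (v ∷ xs)))
∑-tuples-suc vs n f =
  trans (∑-concatMap f (λ v → map (v ∷_) (tuples vs n)) vs) (∑-cong (λ v → ∑-map f (v ∷_) (tuples vs n)) vs)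

tuples-length : ∀ (vs : List A) n → All (λ xs → length xs ≡ n) (tuples vs n)
tuples-length vs zero    = refl ∷ []
tuples-length vs (suc n) =
  All.concat⁺ (All.map⁺ (All.universal (λ v → All.map⁺ (All.map (cong suc) (tuples-length vs n))) vs))

tuples-All : ∀ {P : A → Set} {vs} → All P vs → ∀ n → All (All P) (tuples vs n)
tuples-All pvs zero    = [] ∷ []
tuples-All pvs (suc n) =
  All.concat⁺ (All.map⁺ (All.map (λ pv → All.map⁺ (All.map (pv ∷_) (tuples-All pvs n))) pvs))

-- Each entry of the tuple governs a single row, so the sum over tuples can be carried out row by
-- row inside the determinant.
multilinear-rows : ∀ (vs : List A) (φ : A → B → ℚ) ws bs →
  ∑ (tuples vs (length ws)) (λ xs → weigh ws xs * det φ xs bs) ≡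
  det (λ w b → ∑ vs (λ x → w x * φ x b)) ws bs
multilinear-rows vs φ []       []       = refl
multilinear-rows vs φ []       (b ∷ bs) = refl
multilinear-rows {A} {B} vs φ (w ∷ ws) bs = begin
  ∑ (tuples vs (suc n)) (λ xs → weigh (w ∷ ws) xs * det φ xs bs)
    ≡⟨ ∑-tuples-suc vs n (λ xs → weigh (w ∷ ws) xs * det φ xs bs) ⟩
  ∑ vs (λ x → ∑ (tuples vs n) (λ xs → w x * weigh ws xs * ∑± (λ b bs′ → φ x b * det φ xs bs′) bs))
    ≡⟨ ∑-cong inner vs ⟩
  ∑ vs (λ x → ∑± (λ b bs′ → w x * φ x b * D bs′) bs)
    ≡⟨ ∑±-∑ (λ x b bs′ → w x * φ x b * D bs′) vs bs ⟨
  ∑± (λ b bs′ → ∑ vs (λ x → w x * φ x b * D bs′)) bs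
    ≡⟨ ∑±-cong (λ b bs′ → trans (∑-cong (λ x → lem′ (w x * φ x b) (D bs′)) vs)
                          (trans (sym (∑-* (D bs′) (λ x → w x * φ x b) vs))
                                 (lem′ (D bs′) (∑ vs (λ x → w x * φ x b))))) bs ⟩
  ∑± (λ b bs′ → ∑ vs (λ x → w x * φ x b) * D bs′) bs ∎
  where
  n : ℕ
  n = length ws
  D : List B → ℚ
  D = det (λ w b → ∑ vs (λ x → w x * φ x b)) ws
  lem : ∀ p q r s → p * q * (r * s) ≡ p * r * (q * s)
  lem = solve-∀ ℚ-ring
  lem′ : ∀ p q → p * q ≡ q * p
  lem′ = solve-∀ ℚ-ring
  inner : ∀ x → ∑ (tuples vs n) (λ xs → w x * weigh ws xs * ∑± (λ b bs′ → φ x b * det φ xs bs′) bs) ≡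
                ∑± (λ b bs′ → w x * φ x b * D bs′) bs
  inner x = begin
    ∑ (tuples vs n) (λ xs → w x * weigh ws xs * ∑± (λ b bs′ → φ x b * det φ xs bs′) bs)
      ≡⟨ ∑-cong (λ xs → trans (∑±-* (w x * weigh ws xs) (λ b bs′ → φ x b * det φ xs bs′) bs)
           (∑±-cong (λ b bs′ → lem (w x) (weigh ws xs) (φ x b) (det φ xs bs′)) bs)) (tuples vs n) ⟩
    ∑ (tuples vs n) (λ xs → ∑± (λ b bs′ → w x * φ x b * (weigh ws xs * det φ xs bs′)) bs)
      ≡⟨ ∑±-∑ (λ xs b bs′ → w x * φ x b * (weigh ws xs * det φ xs bs′)) (tuples vs n) bs ⟨
    ∑± (λ b bs′ → ∑ (tuples vs n) (λ xs → w x * φ x b * (weigh ws xs * det φ xs bs′))) bs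
      ≡⟨ ∑±-cong (λ b bs′ → trans (sym (∑-* (w x * φ x b) (λ xs → weigh ws xs * det φ xs bs′) (tuples vs n)))
                                  (cong (w x * φ x b *_) (multilinear-rows vs φ ws bs′))) bs ⟩
    ∑± (λ b bs′ → w x * φ x b * D bs′) bs ∎

det-rows : ∀ (φ : A → B → ℚ) as bs → det φ as bs ≡ rows (map φ as) bs
det-rows φ as bs = trans (sym (det-map id φ id as bs)) (cong (rows (map φ as)) (map-id bs))

det-mapˡ : ∀ (φ : A → B → ℚ) (f : C → A) as bs → det φ (map f as) bs ≡ det (φ ∘ f) as bs
det-mapˡ φ f as bs = trans (cong (det φ (map f as)) (sym (map-id bs))) (det-map φ f id as bs)

det-mapʳ : ∀ (φ : A → B → ℚ) (f : C → B) as bs → det φ as (map f bs) ≡ det (λ a → φ a ∘ f) as bs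
det-mapʳ φ f as bs = trans (cong (λ l → det φ l (map f bs)) (sym (map-id as))) (det-map φ id f as bs)

All-steps : ∀ {P : ℕ → Set} {c} → Sorted c → All P c → All (λ (a , b) → a ≤ b × P a × P b) (steps c)
All-steps []       _              = []
All-steps [-]      _              = []
All-steps (p ∷ ps) (pa ∷ pb ∷ pc) = (p , pa , pb) ∷ All-steps ps (pb ∷ pc)

padˡ padʳ : Bool → ℕ → List ℕ → List ℕ
padˡ true  z xs = z ∷ xs
padˡ false z xs = xs
padʳ true  z xs = xs ∷ʳ z
padʳ false z xs = xs

-- For neighbouring diagonals with `a` and `b` cells, `l` means that the second one opens the
-- interlacing chain and `r` that the first one closes it; the lengths then satisfy a + l = b + r.
Fits : Bool → Bool → ℕ → ℕ → Set
Fits l r a b = (if l then suc a else a) ≡ (if r then suc b else b)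

-- Transport relations for the determinants `K`

module Transport (M : ℕ) where

  open Connector M

  T : ℕ → List (List ℕ)
  T = tuples rng

  T-InRange : ∀ n → All (All InRange) (T n)
  T-InRange = tuples-All rng-InRange

  rise : ℕ → ℕ × ℕ → ℚ
  rise m (c , d) = X m d - X m c

  fall : ℕ × ℕ → ℕ → ℚ
  fall (l , m) n = X l n - X m n

  -- For unsorted bounds every interlacing sum is empty, while the determinant of the differences
  -- can be nonzero; the indicator makes the relations below hold for all bounds.
  K : List ℕ → List ℕ → ℚ
  K m c = ind (sorted? c) * det rise m (steps c)

  K-sorted : ∀ m {c} → Sorted c → K m c ≡ det rise m (steps c)
  K-sorted m {c} s = trans (cong (_* det rise m (steps c)) (ind-yes (sorted? c) s)) (*-identityˡ _)

  det-rise : ∀ m c → det rise m (steps c) ≡ rows (rises (map (flip X) c)) m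
  det-rise m c = begin
    det rise m (steps c)                       ≡⟨ det-transpose rise m (steps c) ⟩
    det (flip rise) (steps c) m                ≡⟨ det-rows (flip rise) (steps c) m ⟩
    rows (map (flip rise) (steps c)) m         ≡⟨ cong (λ l → rows l m) (map-∘ (steps c)) ⟩
    rows (map (λ (u , v) → v ⊖ u) (map (λ (a , b) → flip X a , flip X b) (steps c))) m
      ≡⟨ cong (λ l → rows (map (λ (u , v) → v ⊖ u) l) m) (steps-map (flip X) c) ⟨
    rows (rises (map (flip X) c)) m ∎

  det-fall : ∀ μ d → det fall (steps μ) d ≡ rows (drops (map X μ)) d
  det-fall μ d = begin
    det fall (steps μ) d                ≡⟨ det-rows fall (steps μ) d ⟩
    rows (map fall (steps μ)) d         ≡⟨ cong (λ l → rows l d) (map-∘ (steps μ)) ⟩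
    rows (map (λ (u , v) → u ⊖ v) (map (λ (a , b) → X a , X b) (steps μ))) d
      ≡⟨ cong (λ l → rows (map (λ (u , v) → u ⊖ v) l) d) (steps-map X μ) ⟨
    rows (drops (map X μ)) d ∎

  columns-det : ∀ m c → rows (map (flip X) c) m ≡ det X m c
  columns-det m c = trans (sym (det-rows (flip X) c m)) (sym (det-transpose X m c))

  -- Here and in the next three lemmas the outermost bounds are evaluated. A bound at which `X`
  -- vanishes (`n = 0`, or `m = M` with `n < M`) disappears; otherwise `X = 1` at `m = 0` or at
  -- `n = M` turns the differences into a bordered matrix.
  det-rise-0∷ : ∀ {m} c → All InRange m → det rise m (steps (0 ∷ c)) ≡ det X m c
  det-rise-0∷ {m} c hm = trans (det-rise m (0 ∷ c))
    (trans (rises-zero (flip X 0) (map (flip X) c) (All.map (λ (1≤m , _) → X-< 1≤m) hm)) (columns-det m c))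

  det-rise-row : ∀ m c₀ c → det rise m (steps (c₀ ∷ c)) ≡ det X (0 ∷ m) (c₀ ∷ c)
  det-rise-row m c₀ c = trans (det-rise m (c₀ ∷ c))
    (trans (rises-ones (flip X c₀) (map (flip X) c) m {0} (All.map⁺ (All.universal (λ _ → refl) (c₀ ∷ c))))
           (columns-det (0 ∷ m) (c₀ ∷ c)))

  det-fall-∷ʳM : ∀ μ {d} → All (_< M) d → det fall (steps (μ ∷ʳ M)) d ≡ det X μ d
  det-fall-∷ʳM μ {d} hd = trans (det-fall (μ ∷ʳ M) d)
    (trans (cong (λ l → rows (drops l) d) (map-++ X μ (M ∷ [])))
    (trans (drops-∷ʳ-zero (map X μ) (X M) (All.map X-< hd)) (sym (det-rows X μ d))))

  det-fall-column : ∀ m₀ m d → All (_≤ M) (m₀ ∷ m) → det fall (steps (m₀ ∷ m)) d ≡ det X (m₀ ∷ m) (d ∷ʳ M)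
  det-fall-column m₀ m d h = trans (det-fall (m₀ ∷ m) d)
    (trans (drops-ones (X m₀) (map X m) d (All.map⁺ (All.map X-M h))) (sym (det-rows X (m₀ ∷ m) (d ∷ʳ M))))

  ∑-interlacing-rows : ∀ (v : ℕ → ℚ) (φ : ℕ → B → ℚ) c bs {n} → length c ≡ suc n →
    ∑ (T n) (λ x → ind (interlaces? c x) * (∏ x v * det φ x bs)) ≡
    det (λ (a , b) y → ∑ rng (λ x → window a b x * v x * φ x y)) (steps c) bs
  ∑-interlacing-rows v φ c bs {n} e = begin
    ∑ (T n) (λ x → ind (interlaces? c x) * (∏ x v * det φ x bs))
      ≡⟨ ∑-cong∈ (λ x lx → trans (lem (ind (interlaces? c x)) (∏ x v) (det φ x bs))
           (cong (_* det φ x bs) (sym (weigh-windows v c x (trans e (cong suc (sym lx))))))) (tuples-length rng n) ⟩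
    ∑ (T n) (λ x → weigh (windows v c) x * det φ x bs)
      ≡⟨ cong (λ k → ∑ (T k) (λ x → weigh (windows v c) x * det φ x bs)) (length-windows v c e) ⟨
    ∑ (T (length (windows v c))) (λ x → weigh (windows v c) x * det φ x bs)
      ≡⟨ multilinear-rows rng φ (windows v c) bs ⟩
    det (λ w y → ∑ rng (λ x → w x * φ x y)) (windows v c) bs
      ≡⟨ det-mapˡ (λ w y → ∑ rng (λ x → w x * φ x y)) (λ (a , b) x → window a b x * v x) (steps c) bs ⟩
    det (λ (a , b) y → ∑ rng (λ x → window a b x * v x * φ x y)) (steps c) bs ∎
    where
    lem : ∀ p q r → p * (q * r) ≡ p * q * r
    lem = solve-∀ ℚ-ring

  ∑-interlacing-columns : ∀ (v : ℕ → ℚ) (φ : A → ℕ → ℚ) as c {n} → length c ≡ suc n →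
    ∑ (T n) (λ x → ind (interlaces? c x) * (∏ x v * det φ as x)) ≡
    det (λ y (a , b) → ∑ rng (λ x → window a b x * v x * φ y x)) as (steps c)
  ∑-interlacing-columns v φ as c {n} e = begin
    ∑ (T n) (λ x → ind (interlaces? c x) * (∏ x v * det φ as x))
      ≡⟨ ∑-cong (λ x → cong (λ d → ind (interlaces? c x) * (∏ x v * d)) (det-transpose φ as x)) (T n) ⟩
    ∑ (T n) (λ x → ind (interlaces? c x) * (∏ x v * det (flip φ) x as))
      ≡⟨ ∑-interlacing-rows v (flip φ) c as e ⟩
    det (λ (a , b) y → ∑ rng (λ x → window a b x * v x * φ y x)) (steps c) as
      ≡⟨ det-transpose (λ (a , b) y → ∑ rng (λ x → window a b x * v x * φ y x)) (steps c) as ⟩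
    det (λ y (a , b) → ∑ rng (λ x → window a b x * v x * φ y x)) as (steps c) ∎

  scale-entry : ∀ {m c d} → InRange m → c ≤ d → d ≤ M →
    inv m * rise m (c , d) ≡ ∑ rng (λ x → window c d x * inv x * X m x)
  scale-entry {m} {c} {d} hm c≤d d≤M = begin
    inv m * (X m d - X m c)
      ≡⟨ lem (inv m) (X m d) (X m c) ⟩
    inv m * X m d - inv m * X m c
      ≡⟨ telescope (λ x → inv m * X m x) c≤d d≤M ⟨
    ∑ rng (λ x → window c d x * (inv m * X m x - inv m * X m (pred x)))
      ≡⟨ ∑-cong∈ (λ x hx → trans (cong (window c d x *_) (trans (sym (lem (inv m) (X m x) (X m (pred x))))
           (sym (transport-scale hm hx)))) (lem′ (window c d x) (inv x) (X m x))) rng-InRange ⟩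
    ∑ rng (λ x → window c d x * inv x * X m x) ∎
    where
    lem : ∀ p q r → p * (q - r) ≡ p * q - p * r
    lem = solve-∀ ℚ-ring
    lem′ : ∀ p q r → p * (q * r) ≡ p * q * r
    lem′ = solve-∀ ℚ-ring

  -- The increment over the window from `c` to `d` is written as a telescoping sum over `y`. In the
  -- resulting double sum `transport-diff` exchanges the two kinds of differences, and now the sum
  -- over `x` telescopes.
  cross-entry : ∀ {k l c d} → k ≤ l → l ≤ M → c ≤ d → d ≤ M →
    ∑ rng (λ x → window k l x * inv x * rise x (c , d)) ≡
    ∑ rng (λ y → window c d y * inv (suc M ∸ y) * fall (k , l) (pred y))
  cross-entry {k} {l} {c} {d} k≤l l≤M c≤d d≤M = begin
    ∑ rng (λ x → window k l x * inv x * (X x d - X x c))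
      ≡⟨ ∑-cong (λ x → trans (cong (window k l x * inv x *_) (sym (telescope (X x) c≤d d≤M)))
                             (∑-* (window k l x * inv x) (λ y → window c d y * (X x y - X x (pred y))) rng)) rng ⟩
    ∑ rng (λ x → ∑ rng (λ y → window k l x * inv x * (window c d y * (X x y - X x (pred y)))))
      ≡⟨ ∑-cong∈ (λ x hx → ∑-cong∈ (λ y hy → term hx hy) rng-InRange) rng-InRange ⟩
    ∑ rng (λ x → ∑ rng (λ y → s y * (window k l x * (Y y (pred x) - Y y x))))
      ≡⟨ ∑-swap (λ x y → s y * (window k l x * (Y y (pred x) - Y y x))) rng rng ⟩
    ∑ rng (λ y → ∑ rng (λ x → s y * (window k l x * (Y y (pred x) - Y y x))))
      ≡⟨ ∑-cong (λ y → trans (sym (∑-* (s y) (λ x → window k l x * (Y y (pred x) - Y y x)) rng))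
           -- The difference here decreases in `x`; `neg` rewrites it as an increment of `- Y y`,
           -- the form that `telescope` expects.
           (cong (s y *_) (trans (∑-cong (λ x → cong (window k l x *_) (neg (Y y (pred x)) (Y y x))) rng)
                          (trans (telescope (λ x → 0ℚ - Y y x) k≤l l≤M) (sym (neg (Y y k) (Y y l))))))) rng ⟩
    ∑ rng (λ y → s y * (Y y k - Y y l)) ∎
    where
    s : ℕ → ℚ
    s y = window c d y * inv (suc M ∸ y)
    Y : ℕ → ℕ → ℚ
    Y y x = X x (pred y)
    neg : ∀ p q → p - q ≡ (0ℚ - q) - (0ℚ - p)
    neg = solve-∀ ℚ-ring
    lem : ∀ p q r t → p * q * (r * t) ≡ p * r * (q * t)
    lem = solve-∀ ℚ-ring
    lem′ : ∀ p r v t → p * r * (v * t) ≡ r * v * (p * t)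
    lem′ = solve-∀ ℚ-ring
    term : ∀ {x y} → InRange x → InRange y →
      window k l x * inv x * (window c d y * (X x y - X x (pred y))) ≡ s y * (window k l x * (Y y (pred x) - Y y x))
    term {x} {y} hx hy =
      trans (lem (window k l x) (inv x) (window c d y) (X x y - X x (pred y)))
      (trans (cong (window k l x * window c d y *_) (transport-diff hx hy))
             (lem′ (window k l x) (window c d y) (inv (suc M ∸ y)) (Y y (pred x) - Y y x)))

  -- The value 0 joins the tuple on the left, and M on the right, on whichever side lacks a bounding entry.
  outer inner : Bool → Bool → List ℕ → List ℕ
  outer l r x = padʳ (not r) M (padˡ l 0 x)
  inner l r y = padʳ r M (padˡ (not l) 0 (map pred y))

  length-∷ʳ : ∀ xs (x : ℕ) → length (xs ∷ʳ x) ≡ suc (length xs)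
  length-∷ʳ xs x = trans (length-++ xs) (ℕ.+-comm (length xs) 1)

  length-outer : ∀ l r {x s} → Fits l r (length x) s → length (outer l r x) ≡ suc s
  length-outer true  true  e = e
  length-outer false true  e = e
  length-outer true  false {x} e = trans (length-∷ʳ (0 ∷ x) M) (cong suc e)
  length-outer false false {x} e = trans (length-∷ʳ x M) (cong suc e)

  length-inner : ∀ l r {a y} → Fits l r a (length y) → length (inner l r y) ≡ suc a
  length-inner true  true  {y = y} e = trans (length-∷ʳ (map pred y) M) (trans (cong suc (length-map pred y)) (sym e))
  length-inner false true  {y = y} e = cong suc (trans (length-∷ʳ (map pred y) M) (trans (cong suc (length-map pred y)) (sym e)))
  length-inner true  false {y = y} e = trans (length-map pred y) (sym e)
  length-inner false false {y = y} e = cong suc (trans (length-map pred y) (sym e))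

  All-padˡ : ∀ l {x} → All (_≤ M) x → All (_≤ M) (padˡ l 0 x)
  All-padˡ true  h = z≤n ∷ h
  All-padˡ false h = h

  All-padʳ : ∀ r {x} → All (_≤ M) x → All (_≤ M) (padʳ r M x)
  All-padʳ true  h = All.∷ʳ⁺ h ℕ.≤-refl
  All-padʳ false h = h

  sorted-padˡ : ∀ l {x} → Sorted x → Sorted (padˡ l 0 x)
  sorted-padˡ true  h = sorted-0∷ h
  sorted-padˡ false h = h

  sorted-padʳ : ∀ r {x} → Sorted x → All (_≤ M) x → Sorted (padʳ r M x)
  sorted-padʳ true  h b = sorted-∷ʳ h b
  sorted-padʳ false h b = h

  pred-InRange : ∀ {y} → All InRange y → All (_< M) (map pred y)
  pred-InRange h = All.map⁺ (All.map (λ { (s≤s _ , y≤M) → y≤M }) h)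

  inner-≤M : ∀ l r {y} → All InRange y → All (_≤ M) (inner l r y)
  inner-≤M l r h = All-padʳ r (All-padˡ (not l) (All.map ℕ.<⇒≤ (pred-InRange h)))

  inner-sorted : ∀ l r {y} → All InRange y → Sorted y → Sorted (inner l r y)
  inner-sorted l r h s =
    sorted-padʳ r (sorted-padˡ (not l) (sorted-pred s)) (All-padˡ (not l) (All.map ℕ.<⇒≤ (pred-InRange h)))

  outer-≤M : ∀ l r {x} → All InRange x → All (_≤ M) (outer l r x)
  outer-≤M l r h = All-padʳ (not r) (All-padˡ l (All.map proj₂ h))

  outer-sorted : ∀ l r {x} → All InRange x → Sorted x → Sorted (outer l r x)
  outer-sorted l r h s = sorted-padʳ (not r) (sorted-padˡ l s) (All-padˡ l (All.map proj₂ h))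

  -- both sides are bordered forms of the same determinant
  outer-inner : ∀ l r m y → All InRange m → All InRange y → Fits l r (length m) (length y) →
    det fall (steps (outer l r m)) (map pred y) ≡ det rise m (steps (inner l r y))
  outer-inner true  true  m []      hm hy e =
    trans (det-fall-column 0 m [] (z≤n ∷ All.map proj₂ hm)) (sym (det-rise-row m M []))
  outer-inner true  true  m (b ∷ y) hm hy e =
    trans (det-fall-column 0 m (map pred (b ∷ y)) (z≤n ∷ All.map proj₂ hm))
          (sym (det-rise-row m (pred b) (map pred y ∷ʳ M)))
  outer-inner true  false m (b ∷ y) hm hy e =
    trans (det-fall-∷ʳM (0 ∷ m) (pred-InRange hy)) (sym (det-rise-row m (pred b) (map pred y)))
  outer-inner false true  (a ∷ m) y hm hy e =
    trans (det-fall-column a m (map pred y) (All.map proj₂ hm)) (sym (det-rise-0∷ (map pred y ∷ʳ M) hm))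
  outer-inner false false m y hm hy e =
    trans (det-fall-∷ʳM m (pred-InRange hy)) (sym (det-rise-0∷ (map pred y) hm))

  -- Unsorted bounds make both sides 0. For sorted ones each row absorbs its factor 1/m, which turns
  -- its entries into window sums; multilinearity in the columns extracts the sum over `x`. The
  -- remaining `det X m x` is `K m (0 ∷ x)`, as the bound 0 contributes only zeros.
  K-scale : ∀ m c → All InRange m → length c ≡ suc (length m) → All (_≤ M) c →
    ∏ m inv * K m c ≡ ∑ (T (length m)) (λ x → ind (interlaces? c x) * (∏ x inv * K m (0 ∷ x)))
  K-scale m c hm e hc with sorted? c
  ... | no ¬s = trans (*-zeroʳ′ (∏ m inv) (*-zeroˡ (det rise m (steps c)))) (sym (trans
          (∑-cong (λ x → *-zeroˡ′ (ind-no (interlaces? c x) (¬s ∘ interlaces⇒sortedˡ c x)) (∏ x inv * K m (0 ∷ x))) (T (length m)))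
          (∑-0 (T (length m)))))
  ... | yes s = begin
    ∏ m inv * (1ℚ * det rise m (steps c))
      ≡⟨ cong (∏ m inv *_) (*-identityˡ (det rise m (steps c))) ⟩
    ∏ m inv * det rise m (steps c)
      ≡⟨ det-scale inv rise m (steps c) ⟩
    det (λ a p → inv a * rise a p) m (steps c)
      ≡⟨ det-cong (λ a p ha (c≤d , _ , d≤M) → scale-entry ha c≤d d≤M) hm (All-steps s hc) ⟩
    det (λ y (a , b) → ∑ rng (λ x → window a b x * inv x * X y x)) m (steps c)
      ≡⟨ ∑-interlacing-columns inv X m c e ⟨
    ∑ (T (length m)) (λ x → ind (interlaces? c x) * (∏ x inv * det X m x))
      ≡⟨ ∑-cong (λ x → ind-guard (interlaces? c x) (λ p → cong (∏ x inv *_)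
           (sym (trans (K-sorted m (sorted-0∷ (interlaces⇒sortedʳ c x p))) (det-rise-0∷ x hm))))) (T (length m)) ⟩
    ∑ (T (length m)) (λ x → ind (interlaces? c x) * (∏ x inv * K m (0 ∷ x))) ∎

  -- Multilinearity in the rows absorbs the sum over `m′`, leaving one row for each window of
  -- `outer l r m`. After `cross-entry` the sum over `y` is extracted from the columns, and
  -- `outer-inner` reads what is left as a kernel of `m` again.
  K-cross : ∀ l r {s} m c → All InRange m → Sorted m → Fits l r (length m) s →
    length c ≡ suc s → All (_≤ M) c →
    ∑ (T s) (λ m′ → ind (interlaces? (outer l r m) m′) * (∏ m′ inv * K m′ c)) ≡
    ∑ (T s) (λ y → ind (interlaces? c y) * (∏ y (λ b → inv (suc M ∸ b)) * K m (inner l r y)))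
  K-cross l r {s} m c hm sm fits e hc with sorted? c
  ... | no ¬s = trans
          (trans (∑-cong (λ x → *-zeroʳ′ (ind (interlaces? (outer l r m) x))
                   (*-zeroʳ′ (∏ x inv) (*-zeroˡ (det rise x (steps c))))) (T s)) (∑-0 (T s)))
          (sym (trans (∑-cong (λ x → *-zeroˡ′ (ind-no (interlaces? c x) (¬s ∘ interlaces⇒sortedˡ c x)) _) (T s)) (∑-0 (T s))))
  ... | yes sc = begin
    ∑ (T s) (λ m′ → ind (interlaces? μ m′) * (∏ m′ inv * (1ℚ * det rise m′ (steps c))))
      ≡⟨ ∑-cong (λ m′ → cong (λ t → ind (interlaces? μ m′) * (∏ m′ inv * t)) (*-identityˡ (det rise m′ (steps c)))) (T s) ⟩
    ∑ (T s) (λ m′ → ind (interlaces? μ m′) * (∏ m′ inv * det rise m′ (steps c)))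
      ≡⟨ ∑-interlacing-rows inv rise μ (steps c) (length-outer l r fits) ⟩
    det (λ (k , l) p → ∑ rng (λ x → window k l x * inv x * rise x p)) (steps μ) (steps c)
      ≡⟨ det-cong (λ _ _ (k≤l , _ , l≤M) (c≤d , _ , d≤M) → cross-entry k≤l l≤M c≤d d≤M)
                  (All-steps (outer-sorted l r hm sm) (outer-≤M l r hm)) (All-steps sc hc) ⟩
    det (λ p (c , d) → ∑ rng (λ y → window c d y * v y * fall p (pred y))) (steps μ) (steps c)
      ≡⟨ ∑-interlacing-columns v (λ p y → fall p (pred y)) (steps μ) c e ⟨
    ∑ (T s) (λ y → ind (interlaces? c y) * (∏ y v * det (λ p y → fall p (pred y)) (steps μ) y))
      -- The guard matters: only for `y` interlacing with `c` are the bounds `inner l r y` known to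
      -- be sorted, so that `K` is the plain determinant.
      ≡⟨ ∑-cong∈ (λ y (hy , ly) → ind-guard (interlaces? c y) (λ p → cong (∏ y v *_)
           (trans (sym (det-mapʳ fall pred (steps μ) y))
           (trans (outer-inner l r m y hm hy (subst (Fits l r (length m)) (sym ly) fits))
                  (sym (K-sorted m (inner-sorted l r hy (interlaces⇒sortedʳ c y p)))))))) (All.zip (T-InRange s , tuples-length rng s)) ⟩
    ∑ (T s) (λ y → ind (interlaces? c y) * (∏ y v * K m (inner l r y))) ∎
    where
    μ = outer l r m
    v : ℕ → ℚ
    v b = inv (suc M ∸ b)

-- The tableau sum and the flat sum as iterated sums

infixr 8 _^^_
_^^_ : ℚ → ℕ → ℚ
x ^^ zero  = 1ℚ
x ^^ suc n = x * x ^^ n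

-- (l , r , s , k): a diagonal with s cells and exponent k + 1; l and r say how it fits the preceding diagonal.
Spec : Set
Spec = Bool × Bool × ℕ × ℕ

module Sides (M : ℕ) where

  open Connector M
  open Transport M

  -- The final `a ≤ 1` reflects that two cells on one diagonal of a skew diagram force a cell on the
  -- following diagonal.
  Valid : ℕ → List Spec → Set
  Valid a []                     = a ≤ 1
  Valid a ((l , r , s , k) ∷ sp) = Fits l r a s × Valid s sp

  v : ℕ → ℚ
  v b = inv (suc M ∸ b)

  -- The weighted sum over all ways to continue a tableau beyond a diagonal filled with `m`.
  Z : List ℕ → List Spec → ℚ
  Z m []                     = 1ℚ
  Z m ((l , r , s , k) ∷ sp) =
    ∑ (T s) (λ m′ → ind (interlaces? (outer l r m) m′) * (∏ m′ inv ^^ suc k * Z m′ sp))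

  -- the flat sum with k tuples still to be chosen on a diagonal of length a,
  -- in which the kernel κ takes the place of the condition linking to the earlier tuples
  F : ℕ → ℕ → List Spec → (List ℕ → ℚ) → ℚ
  F (suc k) a sp                     κ =
    ∑ (T a) (λ z → κ (0 ∷ z) * (∏ z inv * F k a sp (λ c → ind (interlaces? c z))))
  -- As `a ≤ 1` here, the bounds are 0 alone or 0 and M. There `K m` and the interlacing indicators
  -- of tuples of length `a` in the range have the value 1, so that both kinds of kernel end in the
  -- same way.
  F zero    a []                     κ = κ (0 ∷ replicate a M)
  F zero    a ((l , r , s , k) ∷ sp) κ =
    ∑ (T s) (λ y → κ (inner l r y) * (∏ y v * F k s sp (λ c → ind (interlaces? c y))))

  F-* : ∀ p k a sp κ → p * F k a sp κ ≡ F k a sp (λ c → p * κ c)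
  F-* p (suc k) a sp κ =
    trans (∑-* p (λ z → κ (0 ∷ z) * W z) (T a)) (∑-cong (λ z → lem p (κ (0 ∷ z)) (W z)) (T a))
    where
    W : List ℕ → ℚ
    W z = ∏ z inv * F k a sp (λ c → ind (interlaces? c z))
    lem : ∀ p q r → p * (q * r) ≡ p * q * r
    lem = solve-∀ ℚ-ring
  F-* p zero a [] κ = refl
  F-* p zero a ((l , r , s , k) ∷ sp) κ =
    trans (∑-* p (λ y → κ (inner l r y) * W y) (T s)) (∑-cong (λ y → lem p (κ (inner l r y)) (W y)) (T s))
    where
    W : List ℕ → ℚ
    W y = ∏ y v * F k s sp (λ c → ind (interlaces? c y))
    lem : ∀ p q r → p * (q * r) ≡ p * q * r
    lem = solve-∀ ℚ-ring

  ∑-pull : ∀ (xs : List A) (ys : List B) (f : A → B → ℚ) (g : B → ℚ) →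
           ∑ ys (λ y → ∑ xs (λ x → f x y) * g y) ≡ ∑ xs (λ x → ∑ ys (λ y → f x y * g y))
  ∑-pull xs ys f g = trans
    (∑-cong (λ y → trans (comm (∑ xs (λ x → f x y)) (g y))
                   (trans (∑-* (g y) (λ x → f x y) xs) (∑-cong (λ x → comm (g y) (f x y)) xs))) ys)
    (∑-swap (λ y x → f x y * g y) ys xs)
    where
    comm : ∀ p q → p * q ≡ q * p
    comm = solve-∀ ℚ-ring

  F-∑ : ∀ (xs : List A) k a sp (κ : A → List ℕ → ℚ) →
        F k a sp (λ c → ∑ xs (λ x → κ x c)) ≡ ∑ xs (λ x → F k a sp (κ x))
  F-∑ xs (suc k) a sp κ =
    ∑-pull xs (T a) (λ x z → κ x (0 ∷ z)) (λ z → ∏ z inv * F k a sp (λ c → ind (interlaces? c z)))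
  F-∑ xs zero a [] κ = refl
  F-∑ xs zero a ((l , r , s , k) ∷ sp) κ =
    ∑-pull xs (T s) (λ x y → κ x (inner l r y)) (λ y → ∏ y v * F k s sp (λ c → ind (interlaces? c y)))

  -- This brings the relations for `K` under the nested sums: a kernel that is a sum over tuples
  -- gives a sum of flat sums, one for each tuple.
  F-linear : ∀ (xs : List A) k a sp (w : A → ℚ) (κ : A → List ℕ → ℚ) →
             F k a sp (λ c → ∑ xs (λ x → w x * κ x c)) ≡ ∑ xs (λ x → w x * F k a sp (κ x))
  F-linear xs k a sp w κ =
    trans (F-∑ xs k a sp (λ x c → w x * κ x c)) (∑-cong (λ x → sym (F-* (w x) k a sp (κ x))) xs)

  -- A kernel is evaluated only on a+1 bounds not exceeding M, precisely the bounds for which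
  -- `K-scale` and `K-cross` are proved.
  F-cong : ∀ k a sp {κ κ′ : List ℕ → ℚ} → Valid a sp →
           (∀ c → length c ≡ suc a → All (_≤ M) c → κ c ≡ κ′ c) → F k a sp κ ≡ F k a sp κ′
  F-cong (suc k) a sp _ h = ∑-cong∈
    (λ z (hz , lz) → cong (_* (∏ z inv * F k a sp (λ c → ind (interlaces? c z))))
      (h (0 ∷ z) (cong suc lz) (z≤n ∷ All.map proj₂ hz)))
    (All.zip (T-InRange a , tuples-length rng a))
  F-cong zero a [] _ h = h (0 ∷ replicate a M) (cong suc (length-replicate a)) (z≤n ∷ All.replicate⁺ a ℕ.≤-refl)
  F-cong zero a ((l , r , s , k) ∷ sp) (fits , _) h = ∑-cong∈
    (λ y (hy , ly) → cong (_* (∏ y v * F k s sp (λ c → ind (interlaces? c y))))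
      (h (inner l r y) (length-inner l r (subst (Fits l r a) (sym ly) fits)) (inner-≤M l r hy)))
    (All.zip (T-InRange s , tuples-length rng s))

  -- Each factor `∏ m inv` is spent on one use of `K-scale`. It expands the kernel into interlacing
  -- indicators with coefficients containing `K m (0 ∷ x)`, and the resulting sum over `x` is the
  -- definition of `F` with one more tuple.
  F-absorb : ∀ k a sp m → All InRange m → length m ≡ a → Valid a sp →
             ∏ m inv ^^ k * F zero a sp (K m) ≡ F k a sp (K m)
  F-absorb zero    a sp m hm lm valid = *-identityˡ (F zero a sp (K m))
  F-absorb (suc k) a sp m hm refl valid = begin
    p * p ^^ k * F zero a sp (K m)
      ≡⟨ assoc p (p ^^ k) (F zero a sp (K m)) ⟩
    p * (p ^^ k * F zero a sp (K m))
      ≡⟨ cong (p *_) (F-absorb k a sp m hm refl valid) ⟩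
    p * F k a sp (K m)
      ≡⟨ F-* p k a sp (K m) ⟩
    F k a sp (λ c → p * K m c)
      ≡⟨ F-cong k a sp valid (λ c lc hc → trans (K-scale m c hm lc hc)
           (∑-cong (λ x → comm (ind (interlaces? c x)) (∏ x inv * K m (0 ∷ x))) (T a))) ⟩
    F k a sp (λ c → ∑ (T a) (λ x → ∏ x inv * K m (0 ∷ x) * ind (interlaces? c x)))
      ≡⟨ F-linear (T a) k a sp (λ x → ∏ x inv * K m (0 ∷ x)) (λ x c → ind (interlaces? c x)) ⟩
    ∑ (T a) (λ x → ∏ x inv * K m (0 ∷ x) * F k a sp (λ c → ind (interlaces? c x)))
      ≡⟨ ∑-cong (λ x → lem (∏ x inv) (K m (0 ∷ x)) (F k a sp (λ c → ind (interlaces? c x)))) (T a) ⟩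
    ∑ (T a) (λ x → K m (0 ∷ x) * (∏ x inv * F k a sp (λ c → ind (interlaces? c x)))) ∎
    where
    p : ℚ
    p = ∏ m inv
    assoc : ∀ p q r → p * q * r ≡ p * (q * r)
    assoc = solve-∀ ℚ-ring
    comm : ∀ p q → p * q ≡ q * p
    comm = solve-∀ ℚ-ring
    lem : ∀ p q r → p * q * r ≡ q * (p * r)
    lem = solve-∀ ℚ-ring

  K-base : ∀ m → All InRange m → length m ≤ 1 → K m (0 ∷ replicate (length m) M) ≡ 1ℚ
  K-base []           _                    _ = refl
  K-base (x ∷ [])     ((1≤x , x≤M) ∷ [])   _ = begin
    K (x ∷ []) (0 ∷ M ∷ [])
      ≡⟨ K-sorted (x ∷ []) {0 ∷ M ∷ []} (z≤n ∷ [-]) ⟩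
    (X x M - X x 0) * 1ℚ - 0ℚ
      ≡⟨ cong₂ (λ s t → (s - t) * 1ℚ - 0ℚ) (X-M x≤M) (X-< 1≤x) ⟩
    1ℚ ∎
  K-base (x ∷ y ∷ m) _ (s≤s ())

  -- Of the k+1 factors on the next diagonal, k become flat tuples through `F-absorb`. The remaining
  -- one feeds `K-cross`, which trades the entries `m′` for the first flat tuple `y` and returns the
  -- kernel to `m`.
  Z≡F : ∀ m sp → All InRange m → Sorted m → Valid (length m) sp → Z m sp ≡ F zero (length m) sp (K m)
  Z≡F m []                     hm sm valid = sym (K-base m hm valid)
  Z≡F m ((l , r , s , k) ∷ sp) hm sm (fits , valid) = begin
    ∑ (T s) (λ m′ → G m′ * (∏ m′ inv * ∏ m′ inv ^^ k * Z m′ sp))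
      ≡⟨ ∑-cong∈ (λ { m′ (hm′ , refl) → trans (ind-guard (interlaces? (outer l r m) m′) (λ p →
           trans (cong (∏ m′ inv * ∏ m′ inv ^^ k *_) (Z≡F m′ sp hm′ (interlaces⇒sortedʳ (outer l r m) m′ p) valid))
           (trans (assoc (∏ m′ inv) (∏ m′ inv ^^ k) (F zero s sp (K m′)))
                  (cong (∏ m′ inv *_) (F-absorb k s sp m′ hm′ refl valid)))))
           (sym (assoc (G m′) (∏ m′ inv) (F k s sp (K m′)))) }) (All.zip (T-InRange s , tuples-length rng s)) ⟩
    ∑ (T s) (λ m′ → G m′ * ∏ m′ inv * F k s sp (K m′))
      -- Linearity read backwards: the whole sum over `m′` moves into the kernel, where `K-cross`
      -- can act on it.
      ≡⟨ F-linear (T s) k s sp (λ m′ → G m′ * ∏ m′ inv) K ⟨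
    F k s sp (λ c → ∑ (T s) (λ m′ → G m′ * ∏ m′ inv * K m′ c))
      ≡⟨ F-cong k s sp valid (λ c lc hc → trans
           (∑-cong (λ m′ → assoc (G m′) (∏ m′ inv) (K m′ c)) (T s))
           (trans (K-cross l r m c hm sm fits lc hc)
           (∑-cong (λ y → comm (ind (interlaces? c y)) (∏ y v * K m (inner l r y))) (T s)))) ⟩
    F k s sp (λ c → ∑ (T s) (λ y → ∏ y v * K m (inner l r y) * ind (interlaces? c y)))
      ≡⟨ F-linear (T s) k s sp (λ y → ∏ y v * K m (inner l r y)) (λ y c → ind (interlaces? c y)) ⟩
    ∑ (T s) (λ y → ∏ y v * K m (inner l r y) * F k s sp (λ c → ind (interlaces? c y)))
      ≡⟨ ∑-cong (λ y → lem (∏ y v) (K m (inner l r y)) (F k s sp (λ c → ind (interlaces? c y)))) (T s) ⟩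
    ∑ (T s) (λ y → K m (inner l r y) * (∏ y v * F k s sp (λ c → ind (interlaces? c y)))) ∎
    where
    G : List ℕ → ℚ
    G m′ = ind (interlaces? (outer l r m) m′)
    assoc : ∀ p q r → p * q * r ≡ p * (q * r)
    assoc = solve-∀ ℚ-ring
    comm : ∀ p q → p * q ≡ q * p
    comm = solve-∀ ℚ-ring
    lem : ∀ p q r → p * q * r ≡ q * (p * r)
    lem = solve-∀ ℚ-ring

-- Sums over assignments as iterated sums over blocks

Unique-resp-↭ : ∀ {A : Set} {xs ys : List A} → xs ↭ ys → Unique xs → Unique ys
Unique-resp-↭ {A} p = ↭ₛ.Unique-resp-↭ (setoid A) (↭.↭⇒↭ₛ p)

module Assignments {S : Set} (_≟_ : DecidableEquality S) (M : ℕ) where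

  open Connector M
  open Transport M

  𝔸 : List S → List (S → ℕ)
  𝔸 = assignments _≟_ (suc M)

  set : S → ℕ → (S → ℕ) → S → ℕ
  set = update _≟_

  set-same : ∀ s v f → set s v f s ≡ v
  set-same s v f with s ≟ s
  ... | yes _  = refl
  ... | no s≢s = contradiction refl s≢s

  set-other : ∀ {s t} v f → t ≢ s → set s v f t ≡ f t
  set-other {s} {t} v f t≢s with t ≟ s
  ... | yes t≡s = contradiction t≡s t≢s
  ... | no _    = refl

  set-cong : ∀ s v {f g} → f ≗ g → set s v f ≗ set s v g
  set-cong s v h t with t ≟ s
  ... | yes _ = refl
  ... | no _  = h t

  set-comm : ∀ {s t} v w f → s ≢ t → set s v (set t w f) ≗ set t w (set s v f)
  set-comm {s} {t} v w f s≢t x with x ≟ s | x ≟ t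
  ... | yes refl | yes refl = contradiction refl s≢t
  ... | yes refl | no _     = sym (set-same x v f)
  ... | no _     | yes refl = set-same x w f
  ... | no x≢s   | no x≢t   = trans (set-other w f x≢t) (sym (set-other v f x≢s))

  ∑-𝔸-∷ : ∀ s ss h → ∑ (𝔸 (s ∷ ss)) h ≡ ∑ (𝔸 ss) (λ f → ∑ rng (λ v → h (set s v f)))
  ∑-𝔸-∷ s ss h =
    trans (∑-concatMap h (λ f → map (λ v → set s v f) rng) (𝔸 ss)) (∑-cong (λ f → ∑-map h (λ v → set s v f) rng) (𝔸 ss))

  Extensional : ((S → ℕ) → ℚ) → Set
  Extensional h = ∀ {f g} → f ≗ g → h f ≡ h g

  -- Cells are listed row by row, while the iterated sum proceeds by diagonals. A transposition of
  -- slots exchanges two inner sums; the two updates commute only pointwise, so the summand has to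
  -- be `Extensional`.
  ∑-𝔸-↭ : ∀ {ss ts h} → Extensional h → Unique ss → ss ↭ ts → ∑ (𝔸 ss) h ≡ ∑ (𝔸 ts) h
  ∑-𝔸-↭ ext _ refl = refl
  ∑-𝔸-↭ {h = h} ext (_ ∷ u) (prep {xs = ss} {ys = ts} s p) = begin
    ∑ (𝔸 (s ∷ ss)) h                             ≡⟨ ∑-𝔸-∷ s ss h ⟩
    ∑ (𝔸 ss) (λ f → ∑ rng (λ v → h (set s v f)))  ≡⟨ ∑-𝔸-↭ (λ e → ∑-cong (λ v → ext (set-cong s v e)) rng) u p ⟩
    ∑ (𝔸 ts) (λ f → ∑ rng (λ v → h (set s v f)))  ≡⟨ ∑-𝔸-∷ s ts h ⟨
    ∑ (𝔸 (s ∷ ts)) h ∎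
  ∑-𝔸-↭ {h = h} ext ((s≢t ∷ _) ∷ _ ∷ u) (swap {xs = ss} {ys = ts} s t p) = begin
    ∑ (𝔸 (s ∷ t ∷ ss)) h
      ≡⟨ trans (∑-𝔸-∷ s (t ∷ ss) h) (∑-𝔸-∷ t ss (λ f → ∑ rng (λ v → h (set s v f)))) ⟩
    ∑ (𝔸 ss) (λ f → ∑ rng (λ w → ∑ rng (λ v → h (set s v (set t w f)))))
      ≡⟨ ∑-𝔸-↭ (λ e → ∑-cong (λ w → ∑-cong (λ v → ext (set-cong s v (set-cong t w e))) rng) rng) u p ⟩
    ∑ (𝔸 ts) (λ f → ∑ rng (λ w → ∑ rng (λ v → h (set s v (set t w f)))))
      ≡⟨ ∑-cong (λ f → trans (∑-swap (λ w v → h (set s v (set t w f))) rng rng)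
           (∑-cong (λ v → ∑-cong (λ w → ext (set-comm v w f s≢t)) rng) rng)) (𝔸 ts) ⟩
    ∑ (𝔸 ts) (λ f → ∑ rng (λ v → ∑ rng (λ w → h (set t w (set s v f)))))
      ≡⟨ trans (∑-𝔸-∷ t (s ∷ ts) h) (∑-𝔸-∷ s ts (λ f → ∑ rng (λ w → h (set t w f)))) ⟨
    ∑ (𝔸 (t ∷ s ∷ ts)) h ∎
  ∑-𝔸-↭ ext u (↭.trans p q) = trans (∑-𝔸-↭ ext u p) (∑-𝔸-↭ ext (Unique-resp-↭ p u) q)

  𝔸-InRange : ∀ ss → All (λ f → ∀ s → s ∈ ss → InRange (f s)) (𝔸 ss)
  𝔸-InRange []       = (λ _ ()) ∷ []
  𝔸-InRange (s ∷ ss) = All.concat⁺ (All.map⁺ (All.map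
    (λ {f} hf → All.map⁺ (All.map (λ {v} hv → go f hf v hv) rng-InRange)) (𝔸-InRange ss)))
    where
    go : ∀ f → (∀ t → t ∈ ss → InRange (f t)) → ∀ v → InRange v → ∀ t → t ∈ s ∷ ss → InRange (set s v f t)
    go f hf v hv t t∈         with t ≟ s
    go f hf v hv t t∈         | yes _  = hv
    go f hf v hv t (here t≡s) | no t≢s = contradiction t≡s t≢s
    go f hf v hv t (there t∈) | no _   = hf t t∈

  write : List S → List ℕ → (S → ℕ) → S → ℕ
  write (s ∷ b) (x ∷ xs) f = set s x (write b xs f)
  write _       _        f = f

  ∑-𝔸-++ : ∀ b ss h → ∑ (𝔸 (b ++ ss)) h ≡ ∑ (T (length b)) (λ xs → ∑ (𝔸 ss) (λ f → h (write b xs f)))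
  ∑-𝔸-++ []      ss h = sym (+-identityʳ _)
  ∑-𝔸-++ (s ∷ b) ss h = begin
    ∑ (𝔸 (s ∷ b ++ ss)) h
      ≡⟨ ∑-𝔸-∷ s (b ++ ss) h ⟩
    ∑ (𝔸 (b ++ ss)) (λ f → ∑ rng (λ v → h (set s v f)))
      ≡⟨ ∑-𝔸-++ b ss (λ f → ∑ rng (λ v → h (set s v f))) ⟩
    ∑ (T n) (λ xs → ∑ (𝔸 ss) (λ f → ∑ rng (λ v → h (set s v (write b xs f)))))
      ≡⟨ ∑-cong (λ xs → ∑-swap (λ f v → h (set s v (write b xs f))) (𝔸 ss) rng) (T n) ⟩
    ∑ (T n) (λ xs → ∑ rng (λ v → ∑ (𝔸 ss) (λ f → h (set s v (write b xs f)))))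
      ≡⟨ ∑-swap (λ xs v → ∑ (𝔸 ss) (λ f → h (set s v (write b xs f)))) (T n) rng ⟩
    ∑ rng (λ v → ∑ (T n) (λ xs → ∑ (𝔸 ss) (λ f → h (set s v (write b xs f)))))
      ≡⟨ ∑-tuples-suc rng n (λ xs → ∑ (𝔸 ss) (λ f → h (write (s ∷ b) xs f))) ⟨
    ∑ (T (suc n)) (λ xs → ∑ (𝔸 ss) (λ f → h (write (s ∷ b) xs f))) ∎
    where
    n : ℕ
    n = length b

  write-∉ : ∀ b xs f {s} → s ∉ b → write b xs f s ≡ f s
  write-∉ []      xs       f s∉ = refl
  write-∉ (t ∷ b) []       f s∉ = refl
  write-∉ (t ∷ b) (x ∷ xs) f s∉ =
    trans (set-other x (write b xs f) (s∉ ∘ here)) (write-∉ b xs f (s∉ ∘ there))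

  map-write : ∀ b xs f → Unique b → length xs ≡ length b → map (write b xs f) b ≡ xs
  map-write []      []       f _          _ = refl
  map-write (s ∷ b) (x ∷ xs) f (s∉b ∷ u) e = cong₂ _∷_ (set-same s x (write b xs f))
    (trans (map-cong-local (All.map (λ s≢t → set-other x (write b xs f) (s≢t ∘ sym)) s∉b))
           (map-write b xs f u (ℕ.suc-injective e)))

  module Chain {I : Set} (blk : I → List S)
               (wt : I → List ℕ → ℚ) (rel : I → I → List ℕ → List ℕ → ℚ) where

    val : (S → ℕ) → I → List ℕ
    val f i = map f (blk i)

    chain : I → List I → (I → List ℕ) → ℚ
    chain i []       x = wt i (x i)
    chain i (j ∷ js) x = wt i (x i) * (rel i j (x i) (x j) * chain j js x)

    nest : I → List I → List ℕ → ℚ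
    nest i []       xs = wt i xs
    nest i (j ∷ js) xs = wt i xs * ∑ (T (length (blk j))) (λ ys → rel i j xs ys * nest j js ys)

    chain-cong : ∀ i is {x y} → All (λ j → x j ≡ y j) (i ∷ is) → chain i is x ≡ chain i is y
    chain-cong i []       (e ∷ [])       = cong (wt i) e
    chain-cong i (j ∷ js) (e ∷ es@(e′ ∷ _)) =
      cong₂ _*_ (cong (wt i) e) (cong₂ _*_ (cong₂ (rel i j) e e′) (chain-cong j js es))

    All-blk : ∀ {P : S → Set} is → (∀ {s} → s ∈ concatMap blk is → P s) → All (λ j → All P (blk j)) is
    All-blk []       h = []
    All-blk (j ∷ js) h = All.tabulate (h ∘ ∈-++⁺ˡ) ∷ All-blk js (h ∘ ∈-++⁺ʳ (blk j))

    private
      Unique-++ˡ : ∀ (xs : List S) {ys} → Unique (xs ++ ys) → Unique xs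
      Unique-++ˡ []       _       = []
      Unique-++ˡ (x ∷ xs) (p ∷ u) = All.++⁻ˡ xs p ∷ Unique-++ˡ xs u

      Unique-++ʳ : ∀ (xs : List S) {ys} → Unique (xs ++ ys) → Unique ys
      Unique-++ʳ []       u       = u
      Unique-++ʳ (x ∷ xs) (p ∷ u) = Unique-++ʳ xs u

      Unique-++-∉ : ∀ (xs : List S) {ys s} → Unique (xs ++ ys) → s ∈ ys → s ∉ xs
      Unique-++-∉ (x ∷ xs) (p ∷ u) s∈ (here refl) = All.lookup (All.++⁻ʳ xs p) s∈ refl
      Unique-++-∉ (x ∷ xs) (p ∷ u) s∈ (there s∈′) = Unique-++-∉ xs u s∈ s∈′

    -- The factor `g` stands for the link to the block before `i`. Carrying it along makes the
    -- induction work: once `xs` is fixed on block `i`, the link to the next block is `rel i j xs`.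
    ∑-chain : ∀ (g : List ℕ → ℚ) i is → Unique (concatMap blk (i ∷ is)) →
      ∑ (𝔸 (concatMap blk (i ∷ is))) (λ f → g (val f i) * chain i is (val f)) ≡
      ∑ (T (length (blk i))) (λ xs → g xs * nest i is xs)
    ∑-chain g i is u =
      trans (∑-𝔸-++ (blk i) (concatMap blk is) (λ f → g (val f i) * chain i is (val f)))
            (∑-cong∈ (λ xs lxs → step is xs lxs u) (tuples-length rng (length (blk i))))
      where
      step : ∀ is xs → length xs ≡ length (blk i) → Unique (concatMap blk (i ∷ is)) →
        ∑ (𝔸 (concatMap blk is)) (λ f → g (val (write (blk i) xs f) i) * chain i is (val (write (blk i) xs f))) ≡
        g xs * nest i is xs
      step [] xs lxs u = trans (+-identityʳ _)
        (cong (λ t → g t * wt i t) (map-write (blk i) xs (λ _ → 0) (Unique-++ˡ (blk i) u) lxs))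
      step (j ∷ js) xs lxs u = begin
        ∑ (𝔸 rest) (λ f → g (val (write (blk i) xs f) i) * chain i (j ∷ js) (val (write (blk i) xs f)))
          ≡⟨ ∑-cong (λ f → trans (cong₂ (λ s t → g s * t) (here-val f) (cong₂ _*_ (cong (wt i) (here-val f))
               (cong₂ _*_ (cong₂ (rel i j) (here-val f) (All.head (there-val f))) (chain-cong j js (there-val f)))))
               (assoc (g xs) (wt i xs) (rel i j xs (val f j) * chain j js (val f)))) (𝔸 rest) ⟩
        ∑ (𝔸 rest) (λ f → g xs * wt i xs * (rel i j xs (val f j) * chain j js (val f)))
          ≡⟨ ∑-* (g xs * wt i xs) (λ f → rel i j xs (val f j) * chain j js (val f)) (𝔸 rest) ⟨
        g xs * wt i xs * ∑ (𝔸 rest) (λ f → rel i j xs (val f j) * chain j js (val f))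
          ≡⟨ cong (g xs * wt i xs *_) (∑-chain (rel i j xs) j js (Unique-++ʳ (blk i) u)) ⟩
        g xs * wt i xs * ∑ (T (length (blk j))) (λ ys → rel i j xs ys * nest j js ys)
          ≡⟨ assoc (g xs) (wt i xs) (∑ (T (length (blk j))) (λ ys → rel i j xs ys * nest j js ys)) ⟨
        g xs * nest i (j ∷ js) xs ∎
        where
        rest : List S
        rest = concatMap blk (j ∷ js)
        assoc : ∀ p q r → p * (q * r) ≡ p * q * r
        assoc = solve-∀ ℚ-ring
        here-val : ∀ f → val (write (blk i) xs f) i ≡ xs
        here-val f = map-write (blk i) xs f (Unique-++ˡ (blk i) u) lxs
        there-val : ∀ f → All (λ j → val (write (blk i) xs f) j ≡ val f j) (j ∷ js)
        there-val f = All.map map-cong-local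
          (All-blk (j ∷ js) (λ s∈ → write-∉ (blk i) xs f (Unique-++-∉ (blk i) u s∈)))

-- Interlacing relations on intervals

upFrom : ℕ → ℕ → List ℕ
upFrom a zero    = []
upFrom a (suc n) = a ∷ upFrom (suc a) n

length-upFrom : ∀ a n → length (upFrom a n) ≡ n
length-upFrom a zero    = refl
length-upFrom a (suc n) = cong suc (length-upFrom (suc a) n)

map-suc-upFrom : ∀ {A : Set} (f : ℕ → A) a n → map f (upFrom (suc a) n) ≡ map (f ∘ suc) (upFrom a n)
map-suc-upFrom f a zero    = refl
map-suc-upFrom f a (suc n) = cong (f (suc a) ∷_) (map-suc-upFrom f (suc a) n)

∈-upFrom⁻ : ∀ {j} a n → j ∈ upFrom a n → a ≤ j × j < a ℕ.+ n
∈-upFrom⁻ a (suc n) (here refl) = ℕ.≤-refl , ℕ.m<m+n a (s≤s z≤n)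
∈-upFrom⁻ a (suc n) (there j∈) with p , q ← ∈-upFrom⁻ (suc a) n j∈ =
  ℕ.<⇒≤ p , ℕ.≤-trans q (ℕ.≤-reflexive (sym (ℕ.+-suc a n)))

∈-upFrom⁺ : ∀ {j} a n → a ≤ j → j < a ℕ.+ n → j ∈ upFrom a n
∈-upFrom⁺ a zero    a≤j j<a = contradiction (ℕ.<-≤-trans j<a (ℕ.≤-trans (ℕ.≤-reflexive (ℕ.+-identityʳ a)) a≤j)) (ℕ.<-irrefl refl)
∈-upFrom⁺ a (suc n) a≤j j<a with ℕ.m≤n⇒m<n∨m≡n a≤j
... | inj₁ a<j  = there (∈-upFrom⁺ (suc a) n a<j (ℕ.≤-trans j<a (ℕ.≤-reflexive (ℕ.+-suc a n))))
... | inj₂ refl = here refl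

Convex : List ℕ → Set
Convex xs = ∀ {j k l} → j ∈ xs → l ∈ xs → j < k → k < l → k ∈ xs

increasing-convex⇒upFrom : ∀ xs → AllPairs _<_ xs → Convex xs → ∃₂ λ a n → xs ≡ upFrom a n
increasing-convex⇒upFrom []       _       _ = 0 , 0 , refl
increasing-convex⇒upFrom (x ∷ xs) (p ∷ ps) c
  with increasing-convex⇒upFrom xs ps tail-convex
  where
  tail-convex : Convex xs
  tail-convex j∈ l∈ j<k k<l with c (there j∈) (there l∈) j<k k<l
  ... | there k∈  = k∈
  ... | here refl = contradiction (All.lookup p j∈) (ℕ.<-asym j<k)
... | a , zero  , refl = x , 1 , refl
... | a , suc n , refl with ℕ.m≤n⇒m<n∨m≡n (All.head p)
...   | inj₂ refl = x , suc (suc n) , refl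
...   | inj₁ sx<a with c (here refl) (there (here refl)) (ℕ.n<1+n x) sx<a
...     | there sx∈ = contradiction sx<a (ℕ.≤⇒≯ (proj₁ (∈-upFrom⁻ a (suc n) sx∈)))
...     | here ()

-- Removing the first entry of `f` leaves a chain that starts with `g` and continues with `f ∘ suc`.
-- So the induction interchanges `R` and `S` and the two admissible differences of length.
Alt-upFrom : ∀ R S f g a m n → m ≡ n ⊎ m ≡ suc n →
  Alt R S (map f (upFrom a m)) (map g (upFrom a n)) ⇔
  ((∀ j → j ∈ upFrom a m → j ∈ upFrom a n → R (f j) (g j)) ×
   (∀ j → j ∈ upFrom a n → suc j ∈ upFrom a m → S (g j) (f (suc j))))
Alt-upFrom R S f g a zero    zero    _ = mk⇔ (λ _ → (λ _ ()) , (λ _ ())) (λ _ → tt)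
Alt-upFrom R S f g a zero    (suc n) (inj₁ ())
Alt-upFrom R S f g a zero    (suc n) (inj₂ ())
Alt-upFrom R S f g a (suc zero) zero _ = mk⇔ (λ _ → (λ _ _ ()) , (λ _ ())) (λ _ → tt)
Alt-upFrom R S f g a (suc (suc m)) zero (inj₁ ())
Alt-upFrom R S f g a (suc (suc m)) zero (inj₂ ())
Alt-upFrom R S f g a (suc m) (suc n) h = mk⇔ pointwise alternating
  where
  Pointwise : Set
  Pointwise = (∀ j → j ∈ upFrom a (suc m) → j ∈ upFrom a (suc n) → R (f j) (g j)) ×
              (∀ j → j ∈ upFrom a (suc n) → suc j ∈ upFrom a (suc m) → S (g j) (f (suc j)))
  h′ : ∀ {m n} → suc m ≡ suc n ⊎ suc m ≡ suc (suc n) → suc n ≡ m ⊎ suc n ≡ suc m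
  h′ (inj₁ refl) = inj₂ refl
  h′ (inj₂ refl) = inj₁ refl
  ih = Alt-upFrom S R g (f ∘ suc) a (suc n) m (h′ h)
  suc⁺ : ∀ {j} → j ∈ upFrom a m → suc j ∈ upFrom a (suc m)
  suc⁺ j∈ with p , q ← ∈-upFrom⁻ a m j∈ =
    ∈-upFrom⁺ a (suc m) (ℕ.m≤n⇒m≤1+n p) (ℕ.≤-trans (s≤s q) (ℕ.≤-reflexive (sym (ℕ.+-suc a m))))
  suc⁻ : ∀ {j} → a ≤ j → suc j ∈ upFrom a (suc m) → j ∈ upFrom a m
  suc⁻ a≤j j∈ = ∈-upFrom⁺ a m a≤j
    (ℕ.s≤s⁻¹ (ℕ.≤-trans (proj₂ (∈-upFrom⁻ a (suc m) j∈)) (ℕ.≤-reflexive (ℕ.+-suc a m))))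
  pointwise : Alt R S (map f (upFrom a (suc m))) (map g (upFrom a (suc n))) → Pointwise
  pointwise (r , alt) with s , t ← to ih (subst (Alt S R (map g (upFrom a (suc n)))) (map-suc-upFrom f a m) alt) = first , second
    where
    first : ∀ j → j ∈ upFrom a (suc m) → j ∈ upFrom a (suc n) → R (f j) (g j)
    first j j∈ j∈′ with ℕ.m≤n⇒m<n∨m≡n (proj₁ (∈-upFrom⁻ a (suc m) j∈))
    first (suc j) j∈ j∈′ | inj₁ (s≤s a≤j) = t j (suc⁻ a≤j j∈) j∈′
    first _       j∈ j∈′ | inj₂ refl      = r
    second : ∀ j → j ∈ upFrom a (suc n) → suc j ∈ upFrom a (suc m) → S (g j) (f (suc j))
    second j j∈ sj∈ = s j j∈ (suc⁻ (proj₁ (∈-upFrom⁻ a (suc n) j∈)) sj∈)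
  alternating : Pointwise → Alt R S (map f (upFrom a (suc m))) (map g (upFrom a (suc n)))
  alternating (s , t) = s a (here refl) (here refl) ,
    subst (Alt S R (map g (upFrom a (suc n)))) (sym (map-suc-upFrom f a m))
      (from ih ((λ j j∈ j∈′ → t j j∈ (suc⁺ j∈′)) , (λ j j∈ sj∈ → s (suc j) (suc⁺ j∈) sj∈)))

Alt-0∷ : ∀ {xs ys} → All (1 ≤_) ys → Alt _≤_ _<_ ys xs ⇔ Alt _<_ _≤_ (0 ∷ xs) ys
Alt-0∷ {xs}     {y ∷ ys} (1≤y ∷ _) = mk⇔ (1≤y ,_) proj₂
Alt-0∷ {[]}     {[]}     _         = ⇔-id _
Alt-0∷ {x ∷ xs} {[]}     _         = ⇔-id _

-- For positive `y`, `x < y` is `x ≤ y - 1` and `y ≤ x` is `y - 1 < x`: applying `pred` to one side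
-- exchanges the strict and the weak places of the chain.
Alt-≤-pred : ∀ {xs ys} → All (1 ≤_) ys → Alt _≤_ _<_ ys xs ⇔ Alt _<_ _≤_ (map pred ys) xs
Alt-<-pred : ∀ {xs ys} → All (1 ≤_) ys → Alt _<_ _≤_ xs ys ⇔ Alt _≤_ _<_ xs (map pred ys)
Alt-≤-pred {x ∷ xs} {suc y ∷ ys}  (_ ∷ h) = ⇔-id _ ×-⇔ Alt-<-pred h
Alt-≤-pred {[]}     {y ∷ []}      h       = ⇔-id _
Alt-≤-pred {[]}     {y ∷ y′ ∷ ys} h       = ⇔-id _
Alt-≤-pred {[]}     {[]}          h       = ⇔-id _
Alt-≤-pred {_ ∷ _}  {[]}          h       = ⇔-id _
Alt-<-pred {x ∷ xs} {suc y ∷ ys}  h@(_ ∷ _) = mk⇔ ℕ.s≤s⁻¹ s≤s ×-⇔ Alt-≤-pred h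
Alt-<-pred {x ∷ []}     {[]}      h       = ⇔-id _
Alt-<-pred {x ∷ y ∷ xs} {[]}      h       = ⇔-id _
Alt-<-pred {[]}     {[]}          h       = ⇔-id _
Alt-<-pred {[]}     {_ ∷ _}       h       = ⇔-id _

Alt-∷ʳ : ∀ {M zs ys} → length zs ≡ length ys → All (_≤ M) ys → Alt _<_ _≤_ zs ys ⇔ Alt _<_ _≤_ (zs ∷ʳ M) ys
Alt-∷ʳ {zs = []}          {[]}          e h         = ⇔-id _
Alt-∷ʳ {zs = z ∷ []}      {y ∷ []}      e (y≤M ∷ _) = ⇔-id _ ×-⇔ mk⇔ (λ _ → y≤M , tt) (λ _ → tt)
Alt-∷ʳ {zs = z ∷ z′ ∷ zs} {y ∷ y′ ∷ ys} e (_ ∷ h)   = ⇔-id _ ×-⇔ ⇔-id _ ×-⇔ Alt-∷ʳ (ℕ.suc-injective e) h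

data Adjacent : Bool → Bool → List ℕ → List ℕ → Set where
  same : ∀ {r a m n} → Fits false r m n → Adjacent false r (upFrom a m) (upFrom a n)
  next : ∀ {r a m n} → Fits true r m n → Adjacent true r (upFrom (suc a) m) (upFrom a n)

-- The hypotheses are what convexity of a skew diagram says about the columns of consecutive
-- diagonals. The first two match the ends of two nonempty intervals; the last two limit one
-- interval to a single point when the other is empty.
adjacent-intervals : ∀ a m b n →
  (∀ {j k} → j ∈ upFrom a m → k ∈ upFrom b n → j ≤ k → j ∈ upFrom b n × k ∈ upFrom a m) →
  (∀ {j k} → suc j ∈ upFrom a m → k ∈ upFrom b n → k ≤ j → j ∈ upFrom b n × suc k ∈ upFrom a m) →
  (∀ {j} → j ∈ upFrom a m → suc j ∈ upFrom a m → j ∈ upFrom b n) →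
  (∀ {j} → j ∈ upFrom b n → suc j ∈ upFrom b n → suc j ∈ upFrom a m) →
  ∃₂ λ l r → Adjacent l r (upFrom a m) (upFrom b n)
-- An empty interval has no start of its own, so one is chosen to suit the other interval.
adjacent-intervals a zero    b zero    h₁ h₂ h₃ h₄ = true , true , next {a = b} refl
adjacent-intervals a zero    b (suc zero) h₁ h₂ h₃ h₄ = true , false , next {a = b} refl
adjacent-intervals a zero    b (suc (suc n)) h₁ h₂ h₃ h₄ with () ← h₄ (here refl) (there (here refl))
adjacent-intervals a (suc zero) b zero h₁ h₂ h₃ h₄ = false , true , same {a = a} refl
adjacent-intervals a (suc (suc m)) b zero h₁ h₂ h₃ h₄ with () ← h₃ (here refl) (there (here refl))
adjacent-intervals a (suc m) b (suc n) h₁ h₂ h₃ h₄ with ℕ.≤-<-connex a b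
... | inj₁ a≤b with ℕ.≤-antisym a≤b (proj₁ (∈-upFrom⁻ b (suc n) (proj₁ (h₁ (here refl) (here refl) a≤b))))
...   | refl with ℕ.≤-<-connex m n
...     | inj₁ m≤n = false , false , same (ℕ.≤-antisym (s≤s m≤n) (s≤s (last (proj₂ (h₁ (here refl) a+n∈ (ℕ.m≤m+n a n))))))
  where
  a+n∈ : a ℕ.+ n ∈ upFrom a (suc n)
  a+n∈ = ∈-upFrom⁺ a (suc n) (ℕ.m≤m+n a n) (ℕ.+-monoʳ-< a (ℕ.n<1+n n))
  last : a ℕ.+ n ∈ upFrom a (suc m) → n ≤ m
  last p = ℕ.s≤s⁻¹ (ℕ.+-cancelˡ-< a n (suc m) (proj₂ (∈-upFrom⁻ a (suc m) p)))
adjacent-intervals a (suc (suc m)) a (suc n) h₁ h₂ h₃ h₄ | inj₁ _ | refl | inj₂ (s≤s n≤m) =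
  false , true , same (cong (suc ∘ suc) (ℕ.≤-antisym (last (proj₁ (h₂ a+m∈ (here refl) (ℕ.m≤m+n a m)))) n≤m))
  where
  a+m∈ : suc (a ℕ.+ m) ∈ upFrom a (suc (suc m))
  a+m∈ = ∈-upFrom⁺ a (suc (suc m)) (ℕ.m≤n⇒m≤1+n (ℕ.m≤m+n a m))
    (ℕ.≤-reflexive (trans (sym (cong suc (ℕ.+-suc a m))) (sym (ℕ.+-suc a (suc m)))))
  last : a ℕ.+ m ∈ upFrom a (suc n) → m ≤ n
  last p = ℕ.s≤s⁻¹ (ℕ.+-cancelˡ-< a m (suc n) (proj₂ (∈-upFrom⁻ a (suc n) p)))
adjacent-intervals (suc a) (suc m) b (suc n) h₁ h₂ h₃ h₄ | inj₂ (s≤s b≤a)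
  with ℕ.≤-antisym b≤a (ℕ.s≤s⁻¹ (proj₁ (∈-upFrom⁻ (suc a) (suc m) (proj₂ (h₂ (here refl) (here refl) b≤a)))))
... | refl with ℕ.≤-<-connex n m
...   | inj₁ n≤m = true , true , next (cong (suc ∘ suc) (ℕ.≤-antisym (last (proj₁ (h₂ a+m∈ (here refl) (ℕ.m≤m+n a m)))) n≤m))
  where
  a+m∈ : suc (a ℕ.+ m) ∈ upFrom (suc a) (suc m)
  a+m∈ = ∈-upFrom⁺ (suc a) (suc m) (s≤s (ℕ.m≤m+n a m)) (s≤s (ℕ.+-monoʳ-< a (ℕ.n<1+n m)))
  last : a ℕ.+ m ∈ upFrom a (suc n) → m ≤ n
  last p = ℕ.s≤s⁻¹ (ℕ.+-cancelˡ-< a m (suc n) (proj₂ (∈-upFrom⁻ a (suc n) p)))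
adjacent-intervals (suc a) (suc m) a (suc (suc n)) h₁ h₂ h₃ h₄ | inj₂ _ | refl | inj₂ (s≤s m≤n) =
  true , false , next (cong (suc ∘ suc) (ℕ.≤-antisym m≤n (last (proj₂ (h₁ (here refl) a+n∈ sa≤)))))
  where
  a+n∈ : a ℕ.+ suc n ∈ upFrom a (suc (suc n))
  a+n∈ = ∈-upFrom⁺ a (suc (suc n)) (ℕ.m≤m+n a (suc n)) (ℕ.+-monoʳ-< a (ℕ.n<1+n (suc n)))
  sa≤ : suc a ≤ a ℕ.+ suc n
  sa≤ = ℕ.≤-trans (s≤s (ℕ.m≤m+n a n)) (ℕ.≤-reflexive (sym (ℕ.+-suc a n)))
  last : a ℕ.+ suc n ∈ upFrom (suc a) (suc m) → n ≤ m
  last p = ℕ.s≤s⁻¹ (ℕ.+-cancelˡ-≤ a (suc n) (suc m) (ℕ.s≤s⁻¹ (proj₂ (∈-upFrom⁻ (suc a) (suc m) p))))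

intervals-adjacent : ∀ {J J′} → (∃₂ λ a m → J ≡ upFrom a m) → (∃₂ λ b n → J′ ≡ upFrom b n) →
  (∀ {j k} → j ∈ J → k ∈ J′ → j ≤ k → j ∈ J′ × k ∈ J) →
  (∀ {j k} → suc j ∈ J → k ∈ J′ → k ≤ j → j ∈ J′ × suc k ∈ J) →
  (∀ {j} → j ∈ J → suc j ∈ J → j ∈ J′) →
  (∀ {j} → j ∈ J′ → suc j ∈ J′ → suc j ∈ J) →
  ∃₂ λ l r → Adjacent l r J J′
intervals-adjacent (a , m , refl) (b , n , refl) = adjacent-intervals a m b n

interval-short : ∀ {J} → (∃₂ λ a m → J ≡ upFrom a m) →
                 (∀ {j} → j ∈ J → suc j ∈ J → ⊥) → length J ≤ 1
interval-short (a , zero        , refl) h = z≤n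
interval-short (a , suc zero    , refl) h = s≤s z≤n
interval-short (a , suc (suc m) , refl) h with () ← h (here refl) (there (here refl))

◁-⇔ : ∀ J m J′ n → ((J , m) ◁ (J′ , n)) ⇔
  ((∀ j → j ∈ J → j ∈ J′ → m j < n j) × (∀ j → j ∈ J′ → suc j ∈ J → n j ≤ m (suc j)))
◁-⇔ J m J′ n = mk⇔
  (λ h → (λ j j∈ → proj₁ (All.lookup h j∈)) , (λ j j∈ sj∈ → All.lookup (proj₂ (All.lookup h sj∈)) j∈ refl))
  (λ (p , q) → All.tabulate (λ {j} j∈ → p j j∈ , All.tabulate (λ { {j′} j′∈ refl → q j′ j′∈ j∈ })))

⊴-⇔ : ∀ J m J′ n → ((J , m) ⊴ (J′ , n)) ⇔
  ((∀ j → j ∈ J → j ∈ J′ → m j ≤ n j) × (∀ j → j ∈ J′ → suc j ∈ J → n j < m (suc j)))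
⊴-⇔ J m J′ n = mk⇔
  (λ h → (λ j j∈ → proj₁ (All.lookup h j∈)) , (λ j j∈ sj∈ → All.lookup (proj₂ (All.lookup h sj∈)) j∈ refl))
  (λ (p , q) → All.tabulate (λ {j} j∈ → p j j∈ , All.tabulate (λ { {j′} j′∈ refl → q j′ j′∈ j∈ })))

-- The chain `m₁ ≤ n₁ < m₂ ≤ ...` becomes one of the standard shape once `0 < m₁` is put in front.
⊴-interlaces : ∀ {J} m n → (∃₂ λ a s → J ≡ upFrom a s) → All (1 ≤_) (map m J) →
  ((J , m) ⊴ (J , n)) ⇔ Interlaces (0 ∷ map n J) (map m J)
⊴-interlaces m n (a , s , refl) h =
  Alt-0∷ h ⇔-∘ (⇔-sym (Alt-upFrom _≤_ _<_ m n a s s (inj₁ refl)) ⇔-∘ ⊴-⇔ (upFrom a s) m (upFrom a s) n)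

◁-same : ∀ m n a s t → s ≡ t ⊎ s ≡ suc t →
  ((upFrom a s , m) ◁ (upFrom a t , n)) ⇔ Alt _<_ _≤_ (map m (upFrom a s)) (map n (upFrom a t))
◁-same m n a s t h =
  ⇔-sym (Alt-upFrom _<_ _≤_ m n a s t h) ⇔-∘ ◁-⇔ (upFrom a s) m (upFrom a t) n

-- The chain starts with `n` here, and shifting `m` by one column makes both intervals start
-- together; the two halves of `◁` thereby exchange their roles.
◁-next : ∀ m n a s t → t ≡ s ⊎ t ≡ suc s →
  ((upFrom (suc a) s , m) ◁ (upFrom a t , n)) ⇔ Alt _≤_ _<_ (map n (upFrom a t)) (map m (upFrom (suc a) s))
◁-next m n a s t h rewrite map-suc-upFrom m a s =
  ⇔-sym (Alt-upFrom _≤_ _<_ n (m ∘ suc) a t s h) ⇔-∘ (mk⇔ shift unshift ⇔-∘ ◁-⇔ (upFrom (suc a) s) m (upFrom a t) n)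
  where
  J J′ : List ℕ
  J = upFrom (suc a) s
  J′ = upFrom a t
  suc⁺ : ∀ {j} → j ∈ upFrom a s → suc j ∈ J
  suc⁺ j∈ with p , q ← ∈-upFrom⁻ a s j∈ = ∈-upFrom⁺ (suc a) s (s≤s p) (s≤s q)
  suc⁻ : ∀ {j} → suc j ∈ J → j ∈ upFrom a s
  suc⁻ j∈ with p , q ← ∈-upFrom⁻ (suc a) s j∈ = ∈-upFrom⁺ a s (ℕ.s≤s⁻¹ p) (ℕ.s≤s⁻¹ q)
  shift : (∀ j → j ∈ J → j ∈ J′ → m j < n j) × (∀ j → j ∈ J′ → suc j ∈ J → n j ≤ m (suc j)) →
          (∀ j → j ∈ J′ → j ∈ upFrom a s → n j ≤ m (suc j)) × (∀ j → j ∈ upFrom a s → suc j ∈ J′ → m (suc j) < n (suc j))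
  shift (p , q) = (λ j j∈ j∈′ → q j j∈ (suc⁺ j∈′)) , (λ j j∈ sj∈ → p (suc j) (suc⁺ j∈) sj∈)
  unshift : (∀ j → j ∈ J′ → j ∈ upFrom a s → n j ≤ m (suc j)) × (∀ j → j ∈ upFrom a s → suc j ∈ J′ → m (suc j) < n (suc j)) →
            (∀ j → j ∈ J → j ∈ J′ → m j < n j) × (∀ j → j ∈ J′ → suc j ∈ J → n j ≤ m (suc j))
  unshift (p , q) = first , (λ j j∈ sj∈ → p j j∈ (suc⁻ sj∈))
    where
    first : ∀ j → j ∈ J → j ∈ J′ → m j < n j
    first zero    j∈ j∈′ with () ← proj₁ (∈-upFrom⁻ (suc a) s j∈)
    first (suc j) j∈ j∈′ = q j (suc⁻ j∈) j∈′

module Relations (M : ℕ) where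

  open Connector M
  open Transport M

  fits-next : ∀ r {s t} → Fits true r s t → t ≡ s ⊎ t ≡ suc s
  fits-next true  e = inj₁ (sym (ℕ.suc-injective e))
  fits-next false e = inj₂ (sym e)

  len : ∀ {f : ℕ → ℕ} a s → length (map f (upFrom a s)) ≡ s
  len {f} a s = trans (length-map f (upFrom a s)) (length-upFrom a s)

  len-pred : ∀ {f : ℕ → ℕ} a s → length (map pred (map f (upFrom a s))) ≡ s
  len-pred {f} a s = trans (length-map pred (map f (upFrom a s))) (len a s)

  -- The relation read as bounds on the later tuple, which is how a tableau is extended. `◁-inner`
  -- reads it as bounds on the earlier tuple, as a kernel on the flat side does.
  ◁-outer : ∀ {l r J J′} m n → Adjacent l r J J′ → All InRange (map n J′) →
    ((J , m) ◁ (J′ , n)) ⇔ Interlaces (outer l r (map m J)) (map n J′)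
  ◁-outer m n (same {true}  {a} {s} {t} e) h = ◁-same m n a s t (inj₂ e)
  ◁-outer m n (same {false} {a} {s} {t} e) h =
    Alt-∷ʳ (trans (len a s) (trans e (sym (len a t)))) (All.map proj₂ h) ⇔-∘ ◁-same m n a s t (inj₁ e)
  ◁-outer m n (next {true}  {a} {s} {t} e) h =
    Alt-0∷ (All.map proj₁ h) ⇔-∘ ◁-next m n a s t (fits-next true e)
  ◁-outer m n (next {false} {a} {s} {t} e) h =
    Alt-∷ʳ (trans (cong suc (len (suc a) s)) (trans e (sym (len a t)))) (All.map proj₂ h)
    ⇔-∘ (Alt-0∷ (All.map proj₁ h) ⇔-∘ ◁-next m n a s t (fits-next false e))

  ◁-inner : ∀ {l r J J′} m n → Adjacent l r J J′ → All InRange (map m J) → All InRange (map n J′) →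
    ((J , m) ◁ (J′ , n)) ⇔ Interlaces (inner l r (map n J′)) (map m J)
  ◁-inner m n (same {true}  {a} {s} {t} e) h h′ =
    Alt-∷ʳ (trans (cong suc (len-pred a t)) (trans (sym e) (sym (len a s)))) (All.map proj₂ h)
    ⇔-∘ (Alt-0∷ (All.map proj₁ h) ⇔-∘ (Alt-<-pred (All.map proj₁ h′) ⇔-∘ ◁-same m n a s t (inj₂ e)))
  ◁-inner m n (same {false} {a} {s} {t} e) h h′ =
    Alt-0∷ (All.map proj₁ h) ⇔-∘ (Alt-<-pred (All.map proj₁ h′) ⇔-∘ ◁-same m n a s t (inj₁ e))
  ◁-inner m n (next {true}  {a} {s} {t} e) h h′ =
    Alt-∷ʳ (trans (len-pred a t) (trans (sym (ℕ.suc-injective e)) (sym (len (suc a) s)))) (All.map proj₂ h)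
    ⇔-∘ (Alt-≤-pred (All.map proj₁ h′) ⇔-∘ ◁-next m n a s t (fits-next true e))
  ◁-inner m n (next {false} {a} {s} {t} e) h h′ =
    Alt-≤-pred (All.map proj₁ h′) ⇔-∘ ◁-next m n a s t (fits-next false e)

-- Diagonals of a skew diagram

∈-nrange⁺ : ∀ {a b x} → a ≤ x → x ≤ b → x ∈ nrange a b
∈-nrange⁺ {a} {b} {x} a≤x x≤b = subst (_∈ nrange a b) (ℕ.m+[n∸m]≡n a≤x)
  (∈-applyUpTo⁺ (a ℕ.+_) (ℕ.∸-monoˡ-< (s≤s x≤b) a≤x))

∈-nrange⁻ : ∀ {a b x} → x ∈ nrange a b → a ≤ x × x ≤ b
∈-nrange⁻ {a} {b} x∈ with i , i<n , refl ← ∈-applyUpTo⁻ (a ℕ.+_) x∈ =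
  ℕ.m≤m+n a i , ℕ.s≤s⁻¹ (ℕ.≤-trans (ℕ.≤-reflexive (sym (ℕ.+-suc a i)))
    (ℕ.≤-trans (ℕ.+-monoʳ-≤ a i<n) (ℕ.≤-reflexive (ℕ.m+[n∸m]≡n a≤sb))))
  where
  a≤sb : a ≤ suc b
  a≤sb with ℕ.≤-total a (suc b)
  ... | inj₁ p = p
  ... | inj₂ q = contradiction (ℕ.≤-trans i<n (ℕ.≤-reflexive (ℕ.m≤n⇒m∸n≡0 q))) λ ()

nrange-increasing : ∀ a b → AllPairs _<_ (nrange a b)
nrange-increasing a b = AllPairs.applyUpTo⁺₁ (a ℕ.+_) _ (λ i<j _ → ℕ.+-monoʳ-< a i<j)

part-antitone : ∀ {l} → IsPartition l → ∀ {i i′} → 1 ≤ i → i ≤ i′ → part l i′ ≤ part l i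
part-antitone {[]}         h {i′ = i′} 1≤i i≤i′ = z≤n
part-antitone {x ∷ []}     h {suc zero}    {suc zero}     _ _ = ℕ.≤-refl
part-antitone {x ∷ []}     h {suc i}       {suc (suc i′)} _ _ = z≤n
part-antitone {x ∷ y ∷ l}  (p ∷ h) {suc zero} {suc zero}      _ _ = ℕ.≤-refl
part-antitone {x ∷ y ∷ l}  (p ∷ h) {suc zero} {suc (suc i′)}  _ _ =
  ℕ.≤-trans (part-antitone h {1} {suc i′} (s≤s z≤n) (s≤s z≤n)) p
part-antitone {x ∷ y ∷ l}  (p ∷ h) {suc (suc i)} {suc (suc i′)} _ (s≤s i≤i′) = part-antitone h (s≤s z≤n) i≤i′
part-antitone {x ∷ []}     h {suc (suc i)} {suc zero} _ (s≤s ())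

part-support : ∀ l {i j} → j < part l i → 1 ≤ i × i ≤ length l
part-support (x ∷ l) {suc zero}    _   = s≤s z≤n , s≤s z≤n
part-support (x ∷ l) {suc (suc i)} j<p = s≤s z≤n , s≤s (proj₂ (part-support l j<p))

diag-≡⁻ : ∀ {i j i′ j′} → diag (i , j) ≡ diag (i′ , j′) → i ℕ.+ j′ ≡ i′ ℕ.+ j
diag-≡⁻ {i} {j} {i′} {j′} e = ℤ.+-injective (begin
  + i ℤ.+ + j′                                    ≡⟨ lem (+ i) (+ j) (+ j′) ⟩
  + i ℤ.- + j ℤ.+ (+ j ℤ.+ + j′)                  ≡⟨ cong (ℤ._+ (+ j ℤ.+ + j′)) e ⟩
  + i′ ℤ.- + j′ ℤ.+ (+ j ℤ.+ + j′)                ≡⟨ lem′ (+ i′) (+ j) (+ j′) ⟩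
  + i′ ℤ.+ + j ∎)
  where
  lem : ∀ a b c → a ℤ.+ c ≡ a ℤ.- b ℤ.+ (b ℤ.+ c)
  lem = ℤSolver.solve-∀
  lem′ : ∀ a b c → a ℤ.- c ℤ.+ (b ℤ.+ c) ≡ a ℤ.+ b
  lem′ = ℤSolver.solve-∀

diag-≡⁺ : ∀ {i j i′ j′} → i ℕ.+ j′ ≡ i′ ℕ.+ j → diag (i , j) ≡ diag (i′ , j′)
diag-≡⁺ {i} {j} {i′} {j′} e = begin
  + i ℤ.- + j                                     ≡⟨ lem (+ i) (+ j) (+ j′) ⟩
  + i ℤ.+ + j′ ℤ.- (+ j ℤ.+ + j′)                 ≡⟨ cong (λ t → + t ℤ.- (+ j ℤ.+ + j′)) e ⟩
  + i′ ℤ.+ + j ℤ.- (+ j ℤ.+ + j′)                 ≡⟨ lem′ (+ i′) (+ j) (+ j′) ⟩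
  + i′ ℤ.- + j′ ∎
  where
  lem : ∀ a b c → a ℤ.- b ≡ a ℤ.+ c ℤ.- (b ℤ.+ c)
  lem = ℤSolver.solve-∀
  lem′ : ∀ a b c → a ℤ.+ b ℤ.- (b ℤ.+ c) ≡ a ℤ.- c
  lem′ = ℤSolver.solve-∀

diag-suc : ∀ i j → diag (suc i , j) ≡ diag (i , j) ℤ.+ ℤ.1ℤ
diag-suc i j = lem (+ i) (+ j)
  where
  lem : ∀ a b → ℤ.1ℤ ℤ.+ a ℤ.- b ≡ a ℤ.- b ℤ.+ ℤ.1ℤ
  lem = ℤSolver.solve-∀

AllPairs-strengthen : ∀ {A : Set} {P : A → Set} {R S : A → A → Set} → (∀ {x y} → P x → P y → R x y → S x y) →
                      ∀ {xs} → All P xs → AllPairs R xs → AllPairs S xs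
AllPairs-strengthen h []         []         = []
AllPairs-strengthen h (px ∷ pxs) (rx ∷ rxs) =
  All.zipWith (λ (py , r) → h px py r) (pxs , rx) ∷ AllPairs-strengthen h pxs rxs

infix 4 _≺_
_≺_ : Cell → Cell → Set
(i , j) ≺ (i′ , j′) = i < i′ ⊎ (i ≡ i′ × j < j′)

module Geometry {lam mu : List ℕ} (skew : IsSkew lam mu) where

  D : List Cell
  D = cells lam mu

  private
    row : ℕ → List Cell
    row i = map (i ,_) (nrange (suc (part mu i)) (part lam i))

  ∈-cells⁺ : ∀ {i j} → part mu i < j → j ≤ part lam i → (i , j) ∈ D
  ∈-cells⁺ {i} {j} p q with 1≤i , i≤n ← part-support lam {i} (ℕ.<-≤-trans p q) =
    ∈-concatMap⁺ row (lose (∈-nrange⁺ 1≤i i≤n) (∈-map⁺ (i ,_) (∈-nrange⁺ p q)))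

  ∈-cells⁻ : ∀ {i j} → (i , j) ∈ D → 1 ≤ i × part mu i < j × j ≤ part lam i
  ∈-cells⁻ c∈ with i , i∈ , c∈′ ← find (∈-concatMap⁻ row {xs = nrange 1 (length lam)} c∈)
              with j , j∈ , refl ← ∈-map⁻ (i ,_) c∈′
              = proj₁ (∈-nrange⁻ i∈) , ∈-nrange⁻ j∈

  -- Both partitions decrease: row `k` starts no further right than row `i` and ends no further left
  -- than row `m`.
  cells-convex : ∀ {i j k l m n} → (i , j) ∈ D → (m , n) ∈ D → i ≤ k → k ≤ m → j ≤ l → l ≤ n → (k , l) ∈ D
  cells-convex c∈ d∈ i≤k k≤m j≤l l≤n
    with 1≤i , p , _ ← ∈-cells⁻ c∈ | _ , _ , q ← ∈-cells⁻ d∈ =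
    ∈-cells⁺ (ℕ.≤-<-trans (part-antitone (proj₁ (proj₂ skew)) 1≤i i≤k) (ℕ.<-≤-trans p j≤l))
             (ℕ.≤-trans l≤n (ℕ.≤-trans q (part-antitone (proj₁ skew) (ℕ.≤-trans 1≤i i≤k) k≤m)))

  cells-increasing : AllPairs _≺_ D
  cells-increasing = AllPairs.concat⁺
    (All.map⁺ (All.universal (λ i → AllPairs.map⁺ (AllPairs.map (λ j<j′ → inj₂ (refl , j<j′)) (nrange-increasing _ _))) _))
    (AllPairs.map⁺ (AllPairs.map (λ i<i′ → All.map⁺ (All.universal (λ j → All.map⁺ (All.universal (λ j′ → inj₁ i<i′) _)) _))
                                 (nrange-increasing 1 (length lam))))

  cells-unique : Unique D
  cells-unique = AllPairs.map (λ { (inj₁ i<i) refl → ℕ.<-irrefl refl i<i ; (inj₂ (_ , j<j)) refl → ℕ.<-irrefl refl j<j })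
                              cells-increasing

  Dp : ℤ → List Cell
  Dp p = filter (λ c → diag c ℤ.≟ p) D

  Jp : ℤ → List ℕ
  Jp p = map proj₂ (Dp p)

  ∈-Jp⁻ : ∀ {p j} → j ∈ Jp p → ∃ λ i → (i , j) ∈ D × diag (i , j) ≡ p
  ∈-Jp⁻ {p} j∈ with (i , j) , c∈ , refl ← ∈-map⁻ proj₂ j∈ = i , ∈-filter⁻ (λ c → diag c ℤ.≟ p) {xs = D} c∈

  ∈-Jp⁺ : ∀ {p i j} → (i , j) ∈ D → diag (i , j) ≡ p → j ∈ Jp p
  ∈-Jp⁺ {p} c∈ e = ∈-map⁺ proj₂ (∈-filter⁺ (λ c → diag c ℤ.≟ p) c∈ e)

  -- The cells are listed row by row, and on a fixed diagonal a larger row means a larger column.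
  Jp-increasing : ∀ p → AllPairs _<_ (Jp p)
  Jp-increasing p = AllPairs.map⁺ (AllPairs-strengthen order
    (All.all-filter (λ c → diag c ℤ.≟ p) D) (AllPairs.filter⁺ (λ c → diag c ℤ.≟ p) cells-increasing))
    where
    order : ∀ {c d} → diag c ≡ p → diag d ≡ p → c ≺ d → proj₂ c < proj₂ d
    order e e′ (inj₂ (_ , j<j′)) = j<j′
    order {i , j} {i′ , j′} e e′ (inj₁ i<i′) = ℕ.+-cancelˡ-< i j j′ (ℕ.<-≤-trans (ℕ.+-monoˡ-< j i<i′)
      (ℕ.≤-reflexive (sym (diag-≡⁻ {i} {j} {i′} {j′} (trans e (sym e′))))))

  Jp-convex : ∀ p → Convex (Jp p)
  Jp-convex p {j} {k} {l} j∈ l∈ j<k k<l with i , c∈ , e ← ∈-Jp⁻ j∈ | m , d∈ , e′ ← ∈-Jp⁻ l∈ =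
    ∈-Jp⁺ (cells-convex c∈ d∈ (ℕ.m≤m+n i (k ∸ j)) i+k∸j≤m (ℕ.<⇒≤ j<k) (ℕ.<⇒≤ k<l))
          (trans (diag-≡⁺ {i ℕ.+ (k ∸ j)} {k} {i} {j} (trans (ℕ.+-assoc i (k ∸ j) j) (cong (i ℕ.+_) (ℕ.m∸n+n≡m (ℕ.<⇒≤ j<k))))) e)
    where
    i+k∸j≤m : i ℕ.+ (k ∸ j) ≤ m
    i+k∸j≤m = ℕ.+-cancelʳ-≤ j _ _ (ℕ.≤-trans (ℕ.≤-reflexive (trans (ℕ.+-assoc i (k ∸ j) j) (cong (i ℕ.+_) (ℕ.m∸n+n≡m (ℕ.<⇒≤ j<k)))))
      (ℕ.≤-trans (ℕ.+-monoʳ-≤ i (ℕ.<⇒≤ k<l)) (ℕ.≤-reflexive (diag-≡⁻ {i} {j} {m} {l} (trans e (sym e′))))))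

  Jp-interval : ∀ p → ∃₂ λ a n → Jp p ≡ upFrom a n
  Jp-interval p = increasing-convex⇒upFrom (Jp p) (Jp-increasing p) (Jp-convex p)

  module _ (p : ℤ) where

    private
      p⁺ : ℤ
      p⁺ = p ℤ.+ ℤ.1ℤ

      diag-pred : ∀ i j → diag (suc i , j) ≡ p⁺ → diag (i , j) ≡ p
      diag-pred i j e = ∙-cancelʳ ℤ.1ℤ (diag (i , j)) p (trans (sym (diag-suc i j)) e)

      offset : ∀ i j m k → diag (i , j) ≡ p → diag (m , k) ≡ p⁺ → m ℕ.+ j ≡ suc i ℕ.+ k
      offset i j m k e e′ =
        diag-≡⁻ {m} {k} {suc i} {j} (trans e′ (trans (cong (ℤ._+ ℤ.1ℤ) (sym e)) (sym (diag-suc i j))))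

    -- Let (i,j) and (m,k) be the two cells; `j ≤ k` forces i < m. The rectangle between them
    -- contains (i+1,j) on the second diagonal and (m-1,k) on the first. In `Jp->` it runs from
    -- (m,k) to (i,j+1) and contains (i,j) and (m,k+1).
    Jp-≤ : ∀ {j k} → j ∈ Jp p → k ∈ Jp p⁺ → j ≤ k → j ∈ Jp p⁺ × k ∈ Jp p
    Jp-≤ {j} {k} j∈ k∈ j≤k with i , c∈ , e ← ∈-Jp⁻ j∈ | m , d∈ , e′ ← ∈-Jp⁻ k∈ = go m d∈ e′ si≤m
      where
      si≤m : suc i ≤ m
      si≤m = ℕ.+-cancelʳ-≤ j _ _ (ℕ.≤-trans (ℕ.+-monoʳ-≤ (suc i) j≤k) (ℕ.≤-reflexive (sym (offset i j m k e e′))))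
      go : ∀ m → (m , k) ∈ D → diag (m , k) ≡ p⁺ → suc i ≤ m → j ∈ Jp p⁺ × k ∈ Jp p
      go (suc m) d∈ e′ (s≤s i≤m) =
        ∈-Jp⁺ (cells-convex c∈ d∈ (ℕ.n≤1+n i) (s≤s i≤m) ℕ.≤-refl j≤k) (trans (diag-suc i j) (cong (ℤ._+ ℤ.1ℤ) e)) ,
        ∈-Jp⁺ (cells-convex c∈ d∈ i≤m (ℕ.n≤1+n m) j≤k ℕ.≤-refl) (diag-pred m k e′)

    Jp-> : ∀ {j k} → suc j ∈ Jp p → k ∈ Jp p⁺ → k ≤ j → j ∈ Jp p⁺ × suc k ∈ Jp p
    Jp-> {j} {k} j∈ k∈ k≤j with i , c∈ , e ← ∈-Jp⁻ j∈ | m , d∈ , e′ ← ∈-Jp⁻ k∈ =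
      ∈-Jp⁺ (cells-convex d∈ c∈ m≤i ℕ.≤-refl k≤j (ℕ.n≤1+n j)) (trans (diag-≡⁺ {i} {j} {m} {k} (sym m+j)) e′) ,
      ∈-Jp⁺ (cells-convex d∈ c∈ ℕ.≤-refl m≤i (ℕ.n≤1+n k) (s≤s k≤j))
            (trans (diag-≡⁺ {m} {suc k} {i} {suc j} (trans (offset i (suc j) m k e e′) (sym (ℕ.+-suc i k)))) e)
      where
      m+j : m ℕ.+ j ≡ i ℕ.+ k
      m+j = ℕ.suc-injective (trans (sym (ℕ.+-suc m j)) (offset i (suc j) m k e e′))
      m≤i : m ≤ i
      m≤i = ℕ.+-cancelʳ-≤ k m i (ℕ.≤-trans (ℕ.+-monoʳ-≤ m k≤j) (ℕ.≤-reflexive m+j))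

    -- Two successive cells (i,j) and (i+1,j+1) of a diagonal span a 2 by 2 square. Its corner
    -- (i+1,j) lies on the following diagonal, and the corner (i,j+1) used in `Jp⁺-suc` on the
    -- preceding one.
    Jp-suc : ∀ {j} → j ∈ Jp p → suc j ∈ Jp p → j ∈ Jp p⁺
    Jp-suc {j} j∈ sj∈ with i , c∈ , e ← ∈-Jp⁻ j∈ | m , d∈ , e′ ← ∈-Jp⁻ sj∈ =
      ∈-Jp⁺ (cells-convex c∈ d∈ (ℕ.n≤1+n i) (ℕ.≤-reflexive si≡m) ℕ.≤-refl (ℕ.n≤1+n j)) (trans (diag-suc i j) (cong (ℤ._+ ℤ.1ℤ) e))
      where
      si≡m : suc i ≡ m
      si≡m = ℕ.+-cancelʳ-≡ j (suc i) m (trans (sym (ℕ.+-suc i j)) (diag-≡⁻ {i} {j} {m} {suc j} (trans e (sym e′))))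

    Jp⁺-suc : ∀ {j} → j ∈ Jp p⁺ → suc j ∈ Jp p⁺ → suc j ∈ Jp p
    Jp⁺-suc {j} j∈ sj∈ with i , c∈ , e ← ∈-Jp⁻ j∈ | m , d∈ , e′ ← ∈-Jp⁻ sj∈ =
      ∈-Jp⁺ (cells-convex c∈ d∈ ℕ.≤-refl (ℕ.≤-trans (ℕ.n≤1+n i) (ℕ.≤-reflexive si≡m)) (ℕ.n≤1+n j) ℕ.≤-refl)
            (diag-pred i (suc j) (trans (diag-≡⁺ {suc i} {suc j} {i} {j} (sym (ℕ.+-suc i j))) e))
      where
      si≡m : suc i ≡ m
      si≡m = ℕ.+-cancelʳ-≡ j (suc i) m (trans (sym (ℕ.+-suc i j)) (diag-≡⁻ {i} {j} {m} {suc j} (trans e (sym e′))))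

  Jp-adjacent : ∀ p → ∃₂ λ l r → Adjacent l r (Jp p) (Jp (p ℤ.+ ℤ.1ℤ))
  Jp-adjacent p = intervals-adjacent (Jp-interval p) (Jp-interval (p ℤ.+ ℤ.1ℤ)) (Jp-≤ p) (Jp-> p) (Jp-suc p) (Jp⁺-suc p)

  Jp-last : ∀ p → Jp (p ℤ.+ ℤ.1ℤ) ≡ [] → length (Jp p) ≤ 1
  Jp-last p e = interval-short (Jp-interval p) (λ j∈ sj∈ → ¬Any[] (subst (_ ∈_) e (Jp-suc p j∈ sj∈)))

  Jp-first : ∀ p → Jp p ≡ [] → length (Jp (p ℤ.+ ℤ.1ℤ)) ≤ 1
  Jp-first p e = interval-short (Jp-interval (p ℤ.+ ℤ.1ℤ)) (λ j∈ sj∈ → ¬Any[] (subst (_ ∈_) e (Jp⁺-suc p j∈ sj∈)))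

-- Products and ranges

∏-cong∈ : ∀ {P : A → Set} {f g : A → ℚ} → (∀ x → P x → f x ≡ g x) → ∀ {xs} → All P xs → ∏ xs f ≡ ∏ xs g
∏-cong∈ h []         = refl
∏-cong∈ h (px ∷ pxs) = cong₂ _*_ (h _ px) (∏-cong∈ h pxs)

∏-cong : ∀ {f g : A → ℚ} → (∀ x → f x ≡ g x) → ∀ xs → ∏ xs f ≡ ∏ xs g
∏-cong h xs = cong prodℚ (map-cong h xs)

∏-map : ∀ (f : B → ℚ) (g : A → B) xs → ∏ (map g xs) f ≡ ∏ xs (f ∘ g)
∏-map f g xs = cong prodℚ (sym (map-∘ xs))

∏-++ : ∀ (f : A → ℚ) xs ys → ∏ (xs ++ ys) f ≡ ∏ xs f * ∏ ys f
∏-++ f []       ys = sym (*-identityˡ (∏ ys f))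
∏-++ f (x ∷ xs) ys = trans (cong (f x *_) (∏-++ f xs ys)) (lem (f x) (∏ xs f) (∏ ys f))
  where
  lem : ∀ a b c → a * (b * c) ≡ a * b * c
  lem = solve-∀ ℚ-ring

∏-concatMap : ∀ (f : B → ℚ) (g : A → List B) xs → ∏ (concatMap g xs) f ≡ ∏ xs (λ x → ∏ (g x) f)
∏-concatMap f g []       = refl
∏-concatMap f g (x ∷ xs) = trans (∏-++ f (g x) (concatMap g xs)) (cong (∏ (g x) f *_) (∏-concatMap f g xs))

∏-↭ : ∀ (f : A → ℚ) {xs ys} → xs ↭ ys → ∏ xs f ≡ ∏ ys f
∏-↭ f refl         = refl
∏-↭ f (prep x p)   = cong (f x *_) (∏-↭ f p)
∏-↭ f (swap {xs} {ys} x y p) = trans (lem (f x) (f y) (∏ xs f)) (cong (λ t → f y * (f x * t)) (∏-↭ f p))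
  where
  lem : ∀ a b c → a * (b * c) ≡ b * (a * c)
  lem = solve-∀ ℚ-ring
∏-↭ f (↭.trans p q) = trans (∏-↭ f p) (∏-↭ f q)

*-^^ : ∀ x y n → (x * y) ^^ n ≡ x ^^ n * y ^^ n
*-^^ x y zero    = refl
*-^^ x y (suc n) = trans (cong (x * y *_) (*-^^ x y n)) (lem x y (x ^^ n) (y ^^ n))
  where
  lem : ∀ a b c d → a * b * (c * d) ≡ a * c * (b * d)
  lem = solve-∀ ℚ-ring

1-^^ : ∀ n → 1ℚ ^^ n ≡ 1ℚ
1-^^ zero    = refl
1-^^ (suc n) = trans (*-identityˡ (1ℚ ^^ n)) (1-^^ n)

∏-^^ : ∀ (f : A → ℚ) n xs → ∏ xs (λ x → f x ^^ n) ≡ ∏ xs f ^^ n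
∏-^^ f n []       = sym (1-^^ n)
∏-^^ f n (x ∷ xs) = trans (cong (f x ^^ n *_) (∏-^^ f n xs)) (sym (*-^^ (f x) (∏ xs f) n))

inv-^ : ∀ x n → inv (x ℕ.^ n) ≡ inv x ^^ n
inv-^ x zero    = refl
inv-^ x (suc n) = trans (inv-* x (x ℕ.^ n)) (cong (inv x *_) (inv-^ x n))

inv-product : ∀ (f : A → ℕ) xs → inv (product (map f xs)) ≡ ∏ xs (inv ∘ f)
inv-product f []       = refl
inv-product f (x ∷ xs) = trans (inv-* (f x) (product (map f xs))) (cong (inv (f x) *_) (inv-product f xs))

ind-all : ∀ {P : A → Set} (P? : ∀ x → Dec (P x)) xs → ind (all? P? xs) ≡ ∏ xs (λ x → ind (P? x))
ind-all P? []       = refl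
ind-all P? (x ∷ xs) with P? x
... | yes _ = trans (ind-all P? xs) (sym (*-identityˡ (∏ xs (λ x → ind (P? x)))))
... | no _  = sym (*-zeroˡ (∏ xs (λ x → ind (P? x))))

if-ind : ∀ {P : Set} (p? : Dec P) x → (if does p? then x else 0ℚ) ≡ ind p? * x
if-ind (yes _) x = sym (*-identityˡ x)
if-ind (no _)  x = sym (*-zeroˡ x)

zup : ℤ → ℕ → List ℤ
zup p zero    = []
zup p (suc n) = p ∷ zup (p ℤ.+ ℤ.1ℤ) n

zup-shift : ∀ p t → p ℤ.+ + suc t ≡ p ℤ.+ ℤ.1ℤ ℤ.+ + t
zup-shift p t = sym (ℤ.+-assoc p ℤ.1ℤ (+ t))

applyUpTo≡zup : ∀ p n (f : ℕ → ℤ) → (∀ t → f t ≡ p ℤ.+ + t) → applyUpTo f n ≡ zup p n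
applyUpTo≡zup p zero    f h = refl
applyUpTo≡zup p (suc n) f h =
  cong₂ _∷_ (trans (h 0) (ℤ.+-identityʳ p)) (applyUpTo≡zup (p ℤ.+ ℤ.1ℤ) n (f ∘ suc) (λ t → trans (h (suc t)) (zup-shift p t)))

zup≡map : ∀ p n → zup p n ≡ map (λ t → p ℤ.+ + t) (upTo n)
zup≡map p n = trans (sym (applyUpTo≡zup p n (λ t → p ℤ.+ + t) (λ _ → refl))) (sym (map-applyUpTo id (λ t → p ℤ.+ + t) n))

zrange≡zup : ∀ p n q → q ℤ.+ ℤ.1ℤ ≡ p ℤ.+ + n → zrange p q ≡ zup p n
zrange≡zup p n q e = trans (cong (λ k → map (λ t → p ℤ.+ + t) (upTo ℤ.∣ k ℤ.⊔ ℤ.0ℤ ∣)) (trans (cong (ℤ._- p) e) (lem p (+ n))))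
  (trans (cong (λ k → map (λ t → p ℤ.+ + t) (upTo k)) (ℕ.⊔-identityʳ n)) (sym (zup≡map p n)))
  where
  lem : ∀ a b → a ℤ.+ b ℤ.- a ≡ b
  lem = ℤSolver.solve-∀

zup-unique : ∀ p n → Unique (zup p n)
zup-unique p n = subst Unique (sym (zup≡map p n)) (Unique.map⁺ (λ e → ℤ.+-injective (∙-cancelˡ p _ _ e)) (Unique.upTo⁺ n))

∈-zup⁺ : ∀ {p n t} → t < n → p ℤ.+ + t ∈ zup p n
∈-zup⁺ {p} {n} {t} t<n = subst (p ℤ.+ + t ∈_) (sym (zup≡map p n)) (∈-map⁺ (λ t → p ℤ.+ + t) (∈-applyUpTo⁺ id t<n))

-- An element determines its block through `key`, so different blocks are disjoint.
unique-concatMap : ∀ (key : B → A) (f : A → List B) → (∀ x → Unique (f x)) → (∀ x {y} → y ∈ f x → key y ≡ x) →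
                   ∀ {xs} → Unique xs → Unique (concatMap f xs)
unique-concatMap {B} key f uf hf {xs} u =
  Unique.concat⁺ (All.map⁺ (All.universal uf xs)) (AllPairs.map⁺ (AllPairs.map (λ {x} {y} → disjoint x y) u))
  where
  disjoint : ∀ x y → x ≢ y → Disjoint (f x) (f y)
  disjoint x y x≢y (z∈ , z∈′) = x≢y (trans (sym (hf x z∈)) (hf y z∈′))

foldr-⊓-≤ : ∀ d ds → foldr ℤ._⊓_ d ds ℤ.≤ d × All (foldr ℤ._⊓_ d ds ℤ.≤_) ds
foldr-⊓-≤ d []       = ℤ.≤-refl , []
foldr-⊓-≤ d (e ∷ ds) with p , q ← foldr-⊓-≤ d ds =
  ℤ.≤-trans (ℤ.i⊓j≤j e _) p , ℤ.i⊓j≤i e _ ∷ All.map (ℤ.≤-trans (ℤ.i⊓j≤j e _)) q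

foldr-⊔-≥ : ∀ d ds → d ℤ.≤ foldr ℤ._⊔_ d ds × All (ℤ._≤ foldr ℤ._⊔_ d ds) ds
foldr-⊔-≥ d []       = ℤ.≤-refl , []
foldr-⊔-≥ d (e ∷ ds) with p , q ← foldr-⊔-≥ d ds =
  ℤ.≤-trans p (ℤ.i≤j⊔i e _) , ℤ.i≤i⊔j e _ ∷ All.map (λ r → ℤ.≤-trans r (ℤ.i≤j⊔i e _)) q

p₀-≤ : ∀ D k N → All (λ c → Flat.p₀ D k N ℤ.≤ diag c) D
p₀-≤ []      k N = []
p₀-≤ (c ∷ D) k N with p , q ← foldr-⊓-≤ (diag c) (map diag D) = p ∷ All.map⁻ q

p₁-≥ : ∀ D k N → All (λ c → diag c ℤ.≤ Flat.p₁ D k N) D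
p₁-≥ []      k N = []
p₁-≥ (c ∷ D) k N with p , q ← foldr-⊔-≥ (diag c) (map diag D) = p ∷ All.map⁻ q

kp-cases : ∀ D k N p → (Flat.Dp D k N p ≡ [] × Flat.kp D k N p ≡ 1) ⊎
                       (∃ λ c → c ∈ Flat.Dp D k N p × Flat.kp D k N p ≡ k c)
kp-cases D k N p with Flat.Dp D k N p
... | []    = inj₁ (refl , refl)
... | c ∷ _ = inj₂ (c , here refl , refl)

nrange≡upFrom : ∀ a b → nrange a b ≡ upFrom a (suc b ∸ a)
nrange≡upFrom a b = go a (suc b ∸ a) (a ℕ.+_) (λ _ → refl)
  where
  go : ∀ a n (f : ℕ → ℕ) → (∀ t → f t ≡ a ℕ.+ t) → applyUpTo f n ≡ upFrom a n
  go a zero    f h = refl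
  go a (suc n) f h = cong₂ _∷_ (trans (h 0) (ℕ.+-identityʳ a)) (go (suc a) n (f ∘ suc) (λ t → trans (h (suc t)) (ℕ.+-suc a t)))

Jp-empty : ∀ {lam mu} (skew : IsSkew lam mu) p → (∀ c → c ∈ cells lam mu → diag c ≢ p) → Geometry.Jp skew p ≡ []
Jp-empty skew p h with Geometry.Dp skew p in eq
... | []    = refl
... | c ∷ _ with c∈ , e ← ∈-filter⁻ (λ c → diag c ℤ.≟ p) {xs = Geometry.D skew} (subst (c ∈_) (sym eq) (here refl))
  = contradiction e (h c c∈)

adjacent-fits : ∀ {l r J J′} → Adjacent l r J J′ → Fits l r (length J) (length J′)
adjacent-fits (same {r} {a} {m} {n} e) rewrite length-upFrom a m | length-upFrom a n = e
adjacent-fits (next {r} {a} {m} {n} e) rewrite length-upFrom (suc a) m | length-upFrom a n = e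

-- Identification of both sides with the iterated sums

module Main {lam mu : List ℕ} (skew : IsSkew lam mu)
            (k : Cell → ℕ) (index : IsIndex (cells lam mu) k) (constant : DiagConst (cells lam mu) k) (M : ℕ) where

  open Geometry skew
  open Flat D k (suc M) using (kp)
  open Connector M
  open Transport M
  open Sides M
  open Relations M

  next-diag : ℤ → ℤ
  next-diag p = p ℤ.+ ℤ.1ℤ

  kp-positive : ∀ p → 1 ≤ kp p
  kp-positive p with kp-cases D k (suc M) p
  ... | inj₁ (_ , e)      = ℕ.≤-reflexive (sym e)
  ... | inj₂ (c , c∈ , e) = subst (1 ≤_) (sym e) (All.lookup index (proj₁ (∈-filter⁻ (λ c → diag c ℤ.≟ p) {xs = D} c∈)))

  kp-value : ∀ {p c} → c ∈ Dp p → k c ≡ kp p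
  kp-value {p} {c} c∈ with kp-cases D k (suc M) p | ∈-filter⁻ (λ c → diag c ℤ.≟ p) {xs = D} c∈
  ... | inj₂ (d , d∈ , e) | c∈D , ec with d∈D , ed ← ∈-filter⁻ (λ c → diag c ℤ.≟ p) {xs = D} d∈ =
    trans (All.lookup (All.lookup constant c∈D) d∈D (trans ec (sym ed))) (sym e)
  ... | inj₁ (empty , _) | _ = contradiction (subst (c ∈_) empty c∈) λ ()

  lft rgt : ℤ → Bool
  lft p = proj₁ (Jp-adjacent p)
  rgt p = proj₁ (proj₂ (Jp-adjacent p))

  adjacent : ∀ p → Adjacent (lft p) (rgt p) (Jp p) (Jp (next-diag p))
  adjacent p = proj₂ (proj₂ (Jp-adjacent p))

  -- Diagonals that are empty because the diagram is disconnected stay in the list; their exponent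
  -- is 1 and their sum consists of the empty tuple.
  specs : ℤ → ℕ → List Spec
  specs p zero    = []
  specs p (suc n) = (lft p , rgt p , length (Jp (next-diag p)) , pred (kp (next-diag p))) ∷ specs (next-diag p) n

  specs-valid : ∀ p n → Jp (p ℤ.+ + suc n) ≡ [] → Valid (length (Jp p)) (specs p n)
  specs-valid p zero    e = Jp-last p e
  specs-valid p (suc n) e = adjacent-fits (adjacent p) , specs-valid (next-diag p) n (trans (cong Jp (sym (zup-shift p (suc n)))) e)

  -- Cells grouped by diagonal

  module ByDiagonal where

    open Assignments _≟C_ M public

    wt : ℤ → List ℕ → ℚ
    wt p xs = ∏ xs inv ^^ kp p

    rel : ℤ → ℤ → List ℕ → List ℕ → ℚ
    rel p _ xs ys = ind (interlaces? (outer (lft p) (rgt p) xs) ys)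

    open Chain Dp wt rel public

    nest≡Z : ∀ p n xs → nest p (zup (next-diag p) n) xs ≡ ∏ xs inv ^^ kp p * Z xs (specs p n)
    nest≡Z p zero    xs = sym (*-identityʳ (∏ xs inv ^^ kp p))
    nest≡Z p (suc n) xs = cong (wt p xs *_) (trans
      (cong (λ m → ∑ (T m) (λ ys → rel p q xs ys * nest q (zup (next-diag q) n) ys)) (sym (length-map proj₂ (Dp q))))
      (∑-cong (λ ys → cong (rel p q xs ys *_) (trans (nest≡Z q n ys)
        (cong (λ e → ∏ ys inv ^^ e * Z ys (specs q n)) (sym (ℕ.suc-pred (kp q) {{ℕ.>-nonZero (kp-positive q)}}))))) (T (length (Jp q)))))
      where
      q : ℤ
      q = next-diag p

    -- On a diagonal p the column determines the row p+j. This integer is nonnegative for cells of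
    -- `D`, where the absolute value changes nothing.
    cellAt : ℤ → ℕ → Cell
    cellAt p j = ℤ.∣ p ℤ.+ + j ∣ , j

    cellAt-Dp : ∀ {p c} → c ∈ Dp p → cellAt p (proj₂ c) ≡ c
    cellAt-Dp {p} {i , j} c∈ = cong (λ i → ℤ.∣ i ∣ , j)
      (trans (cong (ℤ._+ + j) (sym (proj₂ (∈-filter⁻ (λ c → diag c ℤ.≟ p) {xs = D} c∈)))) (lem (+ i) (+ j)))
      where
      lem : ∀ a b → a ℤ.- b ℤ.+ b ≡ a
      lem = ℤSolver.solve-∀

    tupleAt : (Cell → ℕ) → ℤ → Tuple
    tupleAt m p = Jp p , (λ j → m (cellAt p j))

    tupleAt-val : ∀ m p → map (λ j → m (cellAt p j)) (Jp p) ≡ val m p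
    tupleAt-val m p = trans (sym (map-∘ (Dp p))) (map-cong-local (All.tabulate (λ c∈ → cong m (cellAt-Dp c∈))))

    cellAt-row : ∀ {p j} → j ∈ Jp p → cellAt p j ∈ D × diag (cellAt p j) ≡ p
    cellAt-row {p} {j} j∈ with c , c∈ , refl ← ∈-map⁻ proj₂ j∈ =
      subst (λ c → c ∈ D × diag c ≡ p) (sym (cellAt-Dp c∈)) (∈-filter⁻ (λ c → diag c ℤ.≟ p) {xs = D} c∈)

    LinkedDiagonals : (Cell → ℕ) → ℤ → Set
    LinkedDiagonals m p = tupleAt m p ◁ tupleAt m (next-diag p)

    linked? : ∀ m p → Dec (LinkedDiagonals m p)
    linked? m p = tupleAt m p ◁? tupleAt m (next-diag p)

    rel≡ind : ∀ m p → All InRange (val m (next-diag p)) →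
              rel p (next-diag p) (val m p) (val m (next-diag p)) ≡ ind (linked? m p)
    rel≡ind m p h = sym (trans
      (ind-⇔ (◁-outer (λ j → m (cellAt p j)) (λ j → m (cellAt q j)) (adjacent p) (subst (All InRange) (sym (tupleAt-val m q)) h))
             (linked? m p) (interlaces? (outer (lft p) (rgt p) (map (λ j → m (cellAt p j)) (Jp p))) (map (λ j → m (cellAt q j)) (Jp q))))
      (cong₂ (λ xs ys → ind (interlaces? (outer (lft p) (rgt p) xs) ys)) (tupleAt-val m p) (tupleAt-val m q)))
      where
      q : ℤ
      q = next-diag p

    chain≡product : ∀ m p n → All (λ q → All InRange (val m q)) (zup p (suc n)) →
      chain p (zup (next-diag p) n) (val m) ≡
      ∏ (zup p n) (λ q → ind (linked? m q)) * ∏ (zup p (suc n)) (λ q → wt q (val m q))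
    chain≡product m p zero    h = sym (trans (*-identityˡ (wt p (val m p) * 1ℚ)) (*-identityʳ (wt p (val m p))))
    chain≡product m p (suc n) (_ ∷ h@(hq ∷ _)) = trans
      (cong₂ (λ s t → wt p (val m p) * (s * t)) (rel≡ind m p hq) (chain≡product m (next-diag p) n h))
      (lem (wt p (val m p)) (ind (linked? m p))
           (∏ (zup (next-diag p) n) (λ q → ind (linked? m q))) (∏ (zup (next-diag p) (suc n)) (λ q → wt q (val m q))))
      where
      lem : ∀ a b c d → a * (b * (c * d)) ≡ b * c * (a * d)
      lem = solve-∀ ℚ-ring

    SSYT⇒linked : ∀ {m} → SSYT D m → ∀ p → LinkedDiagonals m p
    SSYT⇒linked {m} ssyt p = from (◁-⇔ (Jp p) (m ∘ cellAt p) (Jp q) (m ∘ cellAt q)) (below , beside)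
      where
      q : ℤ
      q = next-diag p
      i i′ : ℕ → ℕ
      i j = proj₁ (cellAt p j)
      i′ j = proj₁ (cellAt q j)
      below : ∀ j → j ∈ Jp p → j ∈ Jp q → m (cellAt p j) < m (cellAt q j)
      below j j∈ j∈′ with c∈ , e ← cellAt-row {p} j∈ | c∈′ , e′ ← cellAt-row {q} j∈′ =
        subst (λ i′ → m (i j , j) < m (i′ , j)) (sym si) (proj₂ (All.lookup ssyt c∈) (subst (λ i → (i , j) ∈ D) si c∈′))
        where
        si : i′ j ≡ suc (i j)
        si = ℕ.+-cancelʳ-≡ j (i′ j) (suc (i j)) (diag-≡⁻ {i′ j} {j} {suc (i j)} {j}
          (trans e′ (trans (cong next-diag (sym e)) (sym (diag-suc (i j) j)))))
      beside : ∀ j → j ∈ Jp q → suc j ∈ Jp p → m (cellAt q j) ≤ m (cellAt p (suc j))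
      beside j j∈ sj∈ with c∈ , e ← cellAt-row {q} j∈ | c∈′ , e′ ← cellAt-row {p} sj∈ =
        subst (λ i → m (i′ j , j) ≤ m (i , suc j)) same-row (proj₁ (All.lookup ssyt c∈) (subst (λ i → (i , suc j) ∈ D) (sym same-row) c∈′))
        where
        same-row : i′ j ≡ i (suc j)
        same-row = ℕ.+-cancelʳ-≡ (suc j) (i′ j) (i (suc j)) (trans (diag-≡⁻ {i′ j} {j} {suc (i (suc j))} {suc j}
          (trans e (trans (cong next-diag (sym e′)) (sym (diag-suc (i (suc j)) (suc j)))))) (sym (ℕ.+-suc (i (suc j)) j)))

    -- The link is assumed only where a cell of `D` lies on the following diagonal too; these are
    -- the links between `p₀` and `p₁` that the product records.
    linked⇒SSYT : ∀ {m} → (∀ c → c ∈ D → ∀ {d} → d ∈ D → diag d ≡ next-diag (diag c) → LinkedDiagonals m (diag c)) → SSYT D m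
    linked⇒SSYT {m} linked = All.tabulate (λ { {i , j} c∈ → beside c∈ , below c∈ })
      where
      value : ∀ {p c} → c ∈ D → diag c ≡ p → m (cellAt p (proj₂ c)) ≡ m c
      value {p} c∈ e = cong m (cellAt-Dp (∈-filter⁺ (λ c → diag c ℤ.≟ p) c∈ e))
      beside : ∀ {i j} → (i , j) ∈ D → (i , suc j) ∈ D → m (i , j) ≤ m (i , suc j)
      -- The right neighbour lies on the preceding diagonal, so a row condition is the second half
      -- of `◁` and a column condition the first.
      beside {i} {j} c∈ c∈′ = subst₂ _≤_ (value c∈ e) (value c∈′ refl)
        (proj₂ (to (◁-⇔ (Jp p) (m ∘ cellAt p) (Jp q) (m ∘ cellAt q)) (linked (i , suc j) c∈′ c∈ e))
               j (∈-Jp⁺ c∈ e) (∈-Jp⁺ c∈′ refl))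
        where
        p q : ℤ
        p = diag (i , suc j)
        q = next-diag p
        e : diag (i , j) ≡ next-diag (diag (i , suc j))
        e = trans (diag-≡⁺ {i} {j} {suc i} {suc j} (ℕ.+-suc i j)) (diag-suc i (suc j))
      below : ∀ {i j} → (i , j) ∈ D → (suc i , j) ∈ D → m (i , j) < m (suc i , j)
      below {i} {j} c∈ c∈′ = subst₂ _<_ (value c∈ refl) (value c∈′ (diag-suc i j))
        (proj₁ (to (◁-⇔ (Jp p) (m ∘ cellAt p) (Jp q) (m ∘ cellAt q)) (linked (i , j) c∈ c∈′ (diag-suc i j)))
               j (∈-Jp⁺ c∈ refl) (∈-Jp⁺ c∈′ (diag-suc i j)))
        where
        p q : ℤ
        p = diag (i , j)
        q = next-diag p

    summand : (Cell → ℕ) → ℚ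
    summand m = if does (SSYT? D m) then ∏ D (λ c → inv (m c ℕ.^ k c)) else 0ℚ

    summand-ext : Extensional summand
    summand-ext {f} {g} e = cong₂ (λ b x → if b then x else 0ℚ)
      (does-⇔ (mk⇔ (transfer e) (transfer (sym ∘ e))) (SSYT? D f) (SSYT? D g))
                                 (∏-cong (λ c → cong (λ x → inv (x ℕ.^ k c)) (e c)) D)
      where
      transfer : ∀ {f g} → f ≗ g → SSYT D f → SSYT D g
      transfer e = All.map (λ { {i , j} (p , q) →
        (λ h → subst₂ _≤_ (e (i , j)) (e (i , suc j)) (p h)) , (λ h → subst₂ _<_ (e (i , j)) (e (suc i , j)) (q h)) })

    module _ (p₀ : ℤ) (n : ℕ) (span : ∀ c → c ∈ D → ∃ λ t → t ≤ n × diag c ≡ p₀ ℤ.+ + t) where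

      diagonals : List Cell
      diagonals = concatMap Dp (zup p₀ (suc n))

      diagonals-unique : Unique diagonals
      diagonals-unique = unique-concatMap diag Dp
        (λ p → Unique.filter⁺ (λ c → diag c ℤ.≟ p) cells-unique)
        (λ p c∈ → proj₂ (∈-filter⁻ (λ c → diag c ℤ.≟ p) {xs = D} c∈)) (zup-unique p₀ (suc n))

      cells↭diagonals : D ↭ diagonals
      cells↭diagonals = ∼bag⇒↭ (unique∧set⇒bag cells-unique diagonals-unique (mk⇔ forth back))
        where
        forth : ∀ {c} → c ∈ D → c ∈ diagonals
        forth {c} c∈ with t , t≤n , e ← span c c∈ =
          ∈-concatMap⁺ Dp (lose (∈-zup⁺ (s≤s t≤n)) (∈-filter⁺ (λ c → diag c ℤ.≟ p₀ ℤ.+ + t) c∈ e))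
        back : ∀ {c} → c ∈ diagonals → c ∈ D
        back c∈ with p , _ , c∈′ ← find (∈-concatMap⁻ Dp {xs = zup p₀ (suc n)} c∈) =
          proj₁ (∈-filter⁻ (λ c → diag c ℤ.≟ p) {xs = D} c∈′)

      SSYT-linked : ∀ m → SSYT D m ⇔ All (LinkedDiagonals m) (zup p₀ n)
      SSYT-linked m = mk⇔ (λ ssyt → All.universal (SSYT⇒linked ssyt) (zup p₀ n))
                          (λ h → linked⇒SSYT (λ c c∈ {d} d∈ e → All.lookup h (in-range c c∈ d d∈ e)))
        where
        in-range : ∀ c → c ∈ D → ∀ d → d ∈ D → diag d ≡ next-diag (diag c) → diag c ∈ zup p₀ n
        in-range c c∈ d d∈ e with t , _ , et ← span c c∈ | u , u≤n , eu ← span d d∈ =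
          subst (_∈ zup p₀ n) (sym et) (∈-zup⁺ (ℕ.≤-trans (ℕ.≤-reflexive (sym u≡st)) u≤n))
          where
          u≡st : u ≡ suc t
          u≡st = ℤ.+-injective (∙-cancelˡ p₀ (+ u) (+ suc t)
            (trans (sym eu) (trans e (trans (cong next-diag et) (lem p₀ (+ t))))))
            where
            lem : ∀ a b → a ℤ.+ b ℤ.+ ℤ.1ℤ ≡ a ℤ.+ (ℤ.1ℤ ℤ.+ b)
            lem = ℤSolver.solve-∀

      summand≡chain : ∀ m → (∀ c → c ∈ diagonals → InRange (m c)) →
                      summand m ≡ chain p₀ (zup (next-diag p₀) n) (val m)
      summand≡chain m h = begin
        summand m
          ≡⟨ if-ind (SSYT? D m) (∏ D (λ c → inv (m c ℕ.^ k c))) ⟩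
        ind (SSYT? D m) * ∏ D (λ c → inv (m c ℕ.^ k c))
          ≡⟨ cong₂ _*_ (trans (ind-⇔ (SSYT-linked m) (SSYT? D m) (all? (linked? m) (zup p₀ n))) (ind-all (linked? m) (zup p₀ n)))
               (trans (∏-↭ (λ c → inv (m c ℕ.^ k c)) cells↭diagonals)
               (trans (∏-concatMap (λ c → inv (m c ℕ.^ k c)) Dp (zup p₀ (suc n))) (∏-cong diagonal-weight (zup p₀ (suc n))))) ⟩
        ∏ (zup p₀ n) (λ q → ind (linked? m q)) * ∏ (zup p₀ (suc n)) (λ q → wt q (val m q))
          ≡⟨ chain≡product m p₀ n (All.map All.map⁺ (All-blk (zup p₀ (suc n)) (λ {c} → h c))) ⟨
        chain p₀ (zup (next-diag p₀) n) (val m) ∎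
        where
        diagonal-weight : ∀ q → ∏ (Dp q) (λ c → inv (m c ℕ.^ k c)) ≡ wt q (val m q)
        diagonal-weight q = begin
          ∏ (Dp q) (λ c → inv (m c ℕ.^ k c))
            ≡⟨ ∏-cong∈ (λ c c∈ → trans (inv-^ (m c) (k c)) (cong (inv (m c) ^^_) (kp-value c∈))) (All.tabulate id) ⟩
          ∏ (Dp q) (λ c → inv (m c) ^^ kp q)
            ≡⟨ ∏-^^ (inv ∘ m) (kp q) (Dp q) ⟩
          ∏ (Dp q) (inv ∘ m) ^^ kp q
            ≡⟨ cong (_^^ kp q) (∏-map inv m (Dp q)) ⟨
          ∏ (val m q) inv ^^ kp q ∎

      zeta≡∑Z : zeta D k (suc M) ≡ ∑ (T (length (Jp p₀))) (λ xs → ∏ xs inv ^^ kp p₀ * Z xs (specs p₀ n))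
      zeta≡∑Z = begin
        ∑ (𝔸 D) summand
          ≡⟨ ∑-𝔸-↭ summand-ext cells-unique cells↭diagonals ⟩
        ∑ (𝔸 diagonals) summand
          -- The first block has no predecessor, hence the trivial link 1.
          ≡⟨ ∑-cong∈ (λ m h → trans (summand≡chain m h) (sym (*-identityˡ _))) (𝔸-InRange diagonals) ⟩
        ∑ (𝔸 diagonals) (λ m → 1ℚ * chain p₀ (zup (next-diag p₀) n) (val m))
          ≡⟨ ∑-chain (λ _ → 1ℚ) p₀ (zup (next-diag p₀) n) diagonals-unique ⟩
        ∑ (T (length (Dp p₀))) (λ xs → 1ℚ * nest p₀ (zup (next-diag p₀) n) xs)
          ≡⟨ ∑-cong (λ xs → trans (*-identityˡ _) (nest≡Z p₀ n xs)) (T (length (Dp p₀))) ⟩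
        ∑ (T (length (Dp p₀))) (λ xs → ∏ xs inv ^^ kp p₀ * Z xs (specs p₀ n))
          ≡⟨ cong (λ s → ∑ (T s) (λ xs → ∏ xs inv ^^ kp p₀ * Z xs (specs p₀ n))) (length-map proj₂ (Dp p₀)) ⟨
        ∑ (T (length (Jp p₀))) (λ xs → ∏ xs inv ^^ kp p₀ * Z xs (specs p₀ n)) ∎

  -- Slots grouped by diagonal and layer

  module ByLayer where

    open Flat D k (suc M) using (Slot; _≟S_; slots; tup; denom; weight; Admissible?)
    open Assignments _≟S_ M public

    Layer : Set
    Layer = ℤ × ℕ

    blk : Layer → List Slot
    blk (p , l) = map (λ j → (p , l , j)) (Jp p)

    wt : Layer → List ℕ → ℚ
    wt (p , suc zero) xs = ∏ xs v
    wt (p , _)        xs = ∏ xs inv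

    -- Along the list of layers, layer 1 is entered only from the preceding diagonal, so the
    -- target's index decides between `◁` and `⊴`.
    rel : Layer → Layer → List ℕ → List ℕ → ℚ
    rel (p , _) (_ , suc zero) xs ys = ind (interlaces? (inner (lft p) (rgt p) ys) xs)
    rel _       _              xs ys = ind (interlaces? (0 ∷ ys) xs)

    open Chain blk wt rel public

    layers : ℤ → ℕ → ℕ → List Layer
    layers p l c = map (p ,_) (upFrom l c)

    levels : List ℤ → List Layer
    levels = concatMap (λ p → (p , 1) ∷ layers p 2 (pred (kp p)))

    -- Here `c` counts the layers still to come on diagonal `p`; the link to the tuple `xs` just
    -- chosen becomes the kernel of `F`.
    nest≡F : ∀ p n l c xs → Jp (p ℤ.+ + suc n) ≡ [] → All InRange xs → length xs ≡ length (Jp p) →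
      nest (p , suc l) (layers p (suc (suc l)) c ++ levels (zup (next-diag p) n)) xs ≡
      wt (p , suc l) xs * F c (length (Jp p)) (specs p n) (λ b → ind (interlaces? b xs))
    nest≡F p n l (suc c) xs e hx lx = cong (wt (p , suc l) xs *_) (trans
      (cong (λ m → ∑ (T m) (λ ys → ind (interlaces? (0 ∷ ys) xs) * nest (p , suc (suc l)) rest ys)) (length-map _ (Jp p)))
      (∑-cong∈ (λ ys (hy , ly) → cong (ind (interlaces? (0 ∷ ys) xs) *_) (nest≡F p n (suc l) c ys e hy ly))
        (All.zip (T-InRange (length (Jp p)) , tuples-length rng (length (Jp p))))))
      where
      rest : List Layer
      rest = layers p (suc (suc (suc l))) c ++ levels (zup (next-diag p) n)
    nest≡F p zero l zero xs e hx lx =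
      trans (sym (*-identityʳ (wt (p , suc l) xs)))
            (cong (wt (p , suc l) xs *_) (sym (ind-yes (interlaces? boundary xs) (ends xs hx lx (Jp-last p e)))))
      where
      boundary : List ℕ
      boundary = 0 ∷ replicate (length (Jp p)) M
      ends : ∀ {a} xs → All InRange xs → length xs ≡ a → a ≤ 1 → Interlaces (0 ∷ replicate a M) xs
      ends []           hx                   refl a≤1      = _
      ends (x ∷ [])     ((1≤x , x≤M) ∷ [])   refl a≤1      = 1≤x , x≤M , _
      ends (x ∷ y ∷ xs) hx                   refl (s≤s ())
    nest≡F p (suc n) l zero xs e hx lx = cong (wt (p , suc l) xs *_) (trans
      (cong (λ m → ∑ (T m) (λ ys → J ys * nest (q , 1) rest ys)) (length-map _ (Jp q)))
      (∑-cong∈ (λ ys (hy , ly) → cong (J ys *_) (nest≡F q n 0 (pred (kp q)) ys (trans (cong Jp (sym (zup-shift p (suc n)))) e) hy ly))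
        (All.zip (T-InRange (length (Jp q)) , tuples-length rng (length (Jp q))))))
      where
      q : ℤ
      q = next-diag p
      rest : List Layer
      rest = layers q 2 (pred (kp q)) ++ levels (zup (next-diag q) n)
      J : List ℕ → ℚ
      J ys = ind (interlaces? (inner (lft p) (rgt p) ys) xs)

    module _ (f : Slot → ℕ) where

      layer-val : ∀ p l → map (λ j → f (p , l , j)) (Jp p) ≡ val f (p , l)
      layer-val p l = map-∘ (Jp p)

      within : ℤ → ℕ → ℚ
      within p l = ind (tup f p l ⊴? tup f p (suc l))

      between : ℤ → ℚ
      between p = ind (tup f p (kp p) ◁? tup f (next-diag p) 1)

      rel≡within : ∀ p l → All InRange (val f (p , suc l)) →
        rel (p , suc l) (p , suc (suc l)) (val f (p , suc l)) (val f (p , suc (suc l))) ≡ within p (suc l)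
      rel≡within p l h = sym (trans
        (ind-⇔ (⊴-interlaces m n (Jp-interval p) (subst (All (1 ≤_)) (sym (layer-val p (suc l))) (All.map proj₁ h)))
               (tup f p (suc l) ⊴? tup f p (suc (suc l))) (interlaces? (0 ∷ map n (Jp p)) (map m (Jp p))))
        (cong₂ (λ xs ys → ind (interlaces? (0 ∷ ys) xs)) (layer-val p (suc l)) (layer-val p (suc (suc l)))))
        where
        m n : ℕ → ℕ
        m j = f (p , suc l , j)
        n j = f (p , suc (suc l) , j)

      rel≡between : ∀ p l → l ≡ kp p → All InRange (val f (p , l)) → All InRange (val f (next-diag p , 1)) →
        rel (p , l) (next-diag p , 1) (val f (p , l)) (val f (next-diag p , 1)) ≡ between p
      rel≡between p l refl h h′ = sym (trans
        (ind-⇔ (◁-inner m n (adjacent p) (subst (All InRange) (sym (layer-val p l)) h) (subst (All InRange) (sym (layer-val q 1)) h′))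
               (tup f p l ◁? tup f q 1) (interlaces? (inner (lft p) (rgt p) (map n (Jp q))) (map m (Jp p))))
        (cong₂ (λ xs ys → ind (interlaces? (inner (lft p) (rgt p) ys) xs)) (layer-val p l) (layer-val q 1)))
        where
        q : ℤ
        q = next-diag p
        m n : ℕ → ℕ
        m j = f (p , l , j)
        n j = f (q , 1 , j)

      upper : ℤ → ℕ → ℚ
      upper p l = ∏ (val f (p , l)) inv

      tail : ℤ → ℕ → ℚ
      tail p zero    = 1ℚ
      tail p (suc n) = between p *
        chain (next-diag p , 1) (layers (next-diag p) 2 (pred (kp (next-diag p))) ++ levels (zup (next-diag (next-diag p)) n)) (val f)

      chain-layers : ∀ p n l c → suc l ℕ.+ c ≡ kp p →
        All (λ i → All InRange (val f i)) ((p , suc l) ∷ layers p (suc (suc l)) c ++ levels (zup (next-diag p) n)) →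
        chain (p , suc l) (layers p (suc (suc l)) c ++ levels (zup (next-diag p) n)) (val f) ≡
        wt (p , suc l) (val f (p , suc l)) * ∏ (upFrom (suc (suc l)) c) (upper p) * (∏ (upFrom (suc l) c) (within p) * tail p n)
      chain-layers p n l (suc c) e (h ∷ hs) = trans
        (cong₂ (λ s t → w * (s * t)) (rel≡within p l h) (chain-layers p n (suc l) c (trans (sym (ℕ.+-suc (suc l) c)) e) hs))
        (lem w (within p (suc l)) (upper p (suc (suc l))) (∏ (upFrom (suc (suc (suc l))) c) (upper p))
             (∏ (upFrom (suc (suc l)) c) (within p)) (tail p n))
        where
        w : ℚ
        w = wt (p , suc l) (val f (p , suc l))
        lem : ∀ w a u U B t → w * (a * (u * U * (B * t))) ≡ w * (u * U) * (a * B * t)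
        lem = solve-∀ ℚ-ring
      chain-layers p zero l zero e (h ∷ hs) = lem (wt (p , suc l) (val f (p , suc l)))
        where
        lem : ∀ w → w ≡ w * 1ℚ * (1ℚ * 1ℚ)
        lem = solve-∀ ℚ-ring
      chain-layers p (suc n) l zero e (h ∷ h′ ∷ hs) = trans
        (cong (λ s → w * (s * chain (q , 1) rest (val f))) (rel≡between p (suc l) (trans (sym (ℕ.+-identityʳ (suc l))) e) h h′))
        (lem w (tail p (suc n)))
        where
        q : ℤ
        q = next-diag p
        rest : List Layer
        rest = layers q 2 (pred (kp q)) ++ levels (zup (next-diag q) n)
        w : ℚ
        w = wt (p , suc l) (val f (p , suc l))
        lem : ∀ w t → w * t ≡ w * 1ℚ * (1ℚ * t)
        lem = solve-∀ ℚ-ring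

      inv-denom : ∀ p → inv (denom f p) ≡ ∏ (val f (p , 1)) v * ∏ (upFrom 2 (pred (kp p))) (upper p)
      inv-denom p = trans (inv-* (product (map (λ j → suc M ∸ f (p , 1 , j)) (Jp p))) _) (cong₂ _*_
        (trans (inv-product (λ j → suc M ∸ f (p , 1 , j)) (Jp p))
               (trans (sym (∏-map v (λ j → f (p , 1 , j)) (Jp p))) (cong (λ xs → ∏ xs v) (layer-val p 1))))
        (trans (inv-product (λ l → product (map (λ j → f (p , l , j)) (Jp p))) (nrange 2 (kp p)))
        (trans (∏-cong (λ l → trans (inv-product (λ j → f (p , l , j)) (Jp p))
                              (trans (sym (∏-map inv (λ j → f (p , l , j)) (Jp p)))
                                     (cong (λ xs → ∏ xs inv) (layer-val p l)))) (nrange 2 (kp p)))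
               (cong (λ ls → ∏ ls (upper p)) (nrange≡upFrom 2 (kp p))))))

      within-all between-all : ℤ → ℕ → ℚ
      within-all p n = ∏ (zup p n) (λ q → ∏ (upFrom 1 (pred (kp q))) (within q))
      between-all p n = ∏ (zup p n) between

      chain≡product : ∀ p n → All (λ i → All InRange (val f i)) (levels (zup p (suc n))) →
        chain (p , 1) (layers p 2 (pred (kp p)) ++ levels (zup (next-diag p) n)) (val f) ≡
        within-all p (suc n) * between-all p n * ∏ (zup p (suc n)) (λ q → inv (denom f q))
      chain≡product p n h = trans (chain-layers p n 0 (pred (kp p)) (ℕ.suc-pred (kp p) {{ℕ.>-nonZero (kp-positive p)}}) h)
        (trans (cong (_* (∏ (upFrom 1 (pred (kp p))) (within p) * tail p n)) (sym (inv-denom p))) (rest n h))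
        where
        ws d : ℚ
        ws = ∏ (upFrom 1 (pred (kp p))) (within p)
        d = inv (denom f p)
        rest : ∀ n → All (λ i → All InRange (val f i)) (levels (zup p (suc n))) →
          d * (ws * tail p n) ≡ within-all p (suc n) * between-all p n * ∏ (zup p (suc n)) (λ q → inv (denom f q))
        rest zero    h = lem d ws
          where
          lem : ∀ d w → d * (w * 1ℚ) ≡ w * 1ℚ * 1ℚ * (d * 1ℚ)
          lem = solve-∀ ℚ-ring
        rest (suc n) h = trans (cong (λ t → d * (ws * (between p * t))) (chain≡product (next-diag p) n h′))
          (lem d ws (between p) (within-all (next-diag p) (suc n)) (between-all (next-diag p) n)
               (∏ (zup (next-diag p) (suc n)) (λ q → inv (denom f q))))
          where
          h′ : All (λ i → All InRange (val f i)) (levels (zup (next-diag p) (suc n)))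
          h′ = All.++⁻ʳ ((p , 1) ∷ layers p 2 (pred (kp p))) h
          lem : ∀ d w b W B D → d * (w * (b * (W * B * D))) ≡ w * W * (b * B) * (d * D)
          lem = solve-∀ ℚ-ring

    slots≡levels : ∀ ps → concatMap (λ p → concatMap (λ l → blk (p , l)) (nrange 1 (kp p))) ps ≡ concatMap blk (levels ps)
    slots≡levels []       = refl
    slots≡levels (p ∷ ps) = trans (cong₂ _++_ level (slots≡levels ps))
      (sym (concatMap-++ blk (layers p 1 (suc (pred (kp p)))) (levels ps)))
      where
      level : concatMap (λ l → blk (p , l)) (nrange 1 (kp p)) ≡ concatMap blk (layers p 1 (suc (pred (kp p))))
      level = trans
        (cong (concatMap (λ l → blk (p , l)))
              (trans (nrange≡upFrom 1 (kp p)) (cong (upFrom 1) (sym (ℕ.suc-pred (kp p) {{ℕ.>-nonZero (kp-positive p)}})))))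
        (sym (concatMap-map blk (p ,_) (upFrom 1 (suc (pred (kp p))))))

    levels-unique : ∀ {ps} → Unique ps → Unique (concatMap blk (levels ps))
    levels-unique u = unique-concatMap (λ (p , l , j) → p , l) blk
      (λ (p , l) → Unique.map⁺ (λ { refl → refl }) (AllPairs.map ℕ.<⇒≢ (Jp-increasing p)))
      (λ { (p , l) s∈ → blk-key p l s∈ })
      (unique-concatMap proj₁ (λ p → (p , 1) ∷ layers p 2 (pred (kp p)))
        (λ p → Unique.map⁺ (λ { refl → refl })
               (AllPairs.map ℕ.<⇒≢ (subst (AllPairs _<_) (nrange≡upFrom 1 (suc (pred (kp p)))) (nrange-increasing 1 (suc (pred (kp p)))))))
        (λ p i∈ → layers-key p i∈) u)
      where
      blk-key : ∀ p l {s} → s ∈ blk (p , l) → (proj₁ s , proj₁ (proj₂ s)) ≡ (p , l)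
      blk-key p l s∈ with _ , _ , refl ← ∈-map⁻ (λ j → (p , l , j)) s∈ = refl
      layers-key : ∀ p {i} → i ∈ layers p 1 (suc (pred (kp p))) → proj₁ i ≡ p
      layers-key p i∈ with _ , _ , refl ← ∈-map⁻ (p ,_) i∈ = refl

    open Flat D k (suc M) using (p₀; p₁)

    module _ (n : ℕ) (e₁ : zrange p₀ p₁ ≡ zup p₀ (suc n)) (e₀ : zrange p₀ (p₁ ℤ.- ℤ.1ℤ) ≡ zup p₀ n)
             (end : Jp (p₀ ℤ.+ + suc n) ≡ []) where

      all-levels : List Layer
      all-levels = levels (zup p₀ (suc n))

      summand : (Slot → ℕ) → ℚ
      summand f = if does (Admissible? f) then weight f else 0ℚ

      summand≡chain : ∀ f → (∀ s → s ∈ concatMap blk all-levels → InRange (f s)) →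
        summand f ≡ chain (p₀ , 1) (layers p₀ 2 (pred (kp p₀)) ++ levels (zup (next-diag p₀) n)) (val f)
      summand≡chain f h = begin
        summand f
          ≡⟨ if-ind (Admissible? f) (weight f) ⟩
        ind (Admissible? f) * weight f
          ≡⟨ cong (_* weight f) (ind-× (all? within-level? (zrange p₀ p₁)) (all? between? (zrange p₀ (p₁ ℤ.- ℤ.1ℤ)))) ⟩
        ind (all? within-level? (zrange p₀ p₁)) * ind (all? between? (zrange p₀ (p₁ ℤ.- ℤ.1ℤ))) * weight f
          ≡⟨ cong₂ (λ s t → s * t * weight f) (ind-all within-level? (zrange p₀ p₁)) (ind-all between? (zrange p₀ (p₁ ℤ.- ℤ.1ℤ))) ⟩
        ∏ (zrange p₀ p₁) (λ p → ind (within-level? p)) * ∏ (zrange p₀ (p₁ ℤ.- ℤ.1ℤ)) (between f) * weight f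
          ≡⟨ cong (λ t → t * ∏ (zrange p₀ (p₁ ℤ.- ℤ.1ℤ)) (between f) * weight f)
               (∏-cong (λ p → trans (ind-all (λ l → tup f p l ⊴? tup f p (suc l)) (nrange 1 (kp p ∸ 1)))
                                    (cong (λ ls → ∏ ls (within f p)) (nrange≡upFrom 1 (kp p ∸ 1)))) (zrange p₀ p₁)) ⟩
        ∏ (zrange p₀ p₁) (λ p → ∏ (upFrom 1 (pred (kp p))) (within f p)) * ∏ (zrange p₀ (p₁ ℤ.- ℤ.1ℤ)) (between f) * weight f
          ≡⟨ cong₂ (λ ps qs → ∏ ps (λ p → ∏ (upFrom 1 (pred (kp p))) (within f p)) *
                     ∏ qs (between f) * ∏ ps (λ p → inv (denom f p))) e₁ e₀ ⟩
        within-all f p₀ (suc n) * between-all f p₀ n * ∏ (zup p₀ (suc n)) (λ p → inv (denom f p))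
          ≡⟨ chain≡product f p₀ n (All.map All.map⁺ (All-blk all-levels (λ {s} → h s))) ⟨
        chain (p₀ , 1) (layers p₀ 2 (pred (kp p₀)) ++ levels (zup (next-diag p₀) n)) (val f) ∎
        where
        within-level? : ∀ p → Dec (All (λ l → tup f p l ⊴ tup f p (suc l)) (nrange 1 (kp p ∸ 1)))
        within-level? p = all? (λ l → tup f p l ⊴? tup f p (suc l)) (nrange 1 (kp p ∸ 1))
        between? : ∀ p → Dec (tup f p (kp p) ◁ tup f (next-diag p) 1)
        between? p = tup f p (kp p) ◁? tup f (next-diag p) 1

      zetaFlat≡∑F : zetaFlat D k (suc M) ≡ ∑ (T (length (Jp p₀))) (λ xs →
        ∏ xs v * F (pred (kp p₀)) (length (Jp p₀)) (specs p₀ n) (λ b → ind (interlaces? b xs)))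
      zetaFlat≡∑F = begin
        ∑ (𝔸 slots) summand
          ≡⟨ cong (λ ss → ∑ (𝔸 ss) summand) (trans (slots≡levels (zrange p₀ p₁)) (cong (concatMap blk ∘ levels) e₁)) ⟩
        ∑ (𝔸 (concatMap blk all-levels)) summand
          ≡⟨ ∑-cong∈ (λ f h → trans (summand≡chain f h) (sym (*-identityˡ _))) (𝔸-InRange (concatMap blk all-levels)) ⟩
        ∑ (𝔸 (concatMap blk all-levels)) (λ f → 1ℚ * chain (p₀ , 1) rest (val f))
          ≡⟨ ∑-chain (λ _ → 1ℚ) (p₀ , 1) rest (levels-unique (zup-unique p₀ (suc n))) ⟩
        ∑ (T (length (blk (p₀ , 1)))) (λ xs → 1ℚ * nest (p₀ , 1) rest xs)
          ≡⟨ cong (λ s → ∑ (T s) (λ xs → 1ℚ * nest (p₀ , 1) rest xs)) (length-map _ (Jp p₀)) ⟩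
        ∑ (T (length (Jp p₀))) (λ xs → 1ℚ * nest (p₀ , 1) rest xs)
          ≡⟨ ∑-cong∈ (λ xs (hx , lx) → trans (*-identityˡ _) (nest≡F p₀ n 0 (pred (kp p₀)) xs end hx lx))
               (All.zip (T-InRange (length (Jp p₀)) , tuples-length rng (length (Jp p₀)))) ⟩
        ∑ (T (length (Jp p₀))) (λ xs → ∏ xs v * F (pred (kp p₀)) (length (Jp p₀)) (specs p₀ n) (λ b → ind (interlaces? b xs))) ∎
        where
        rest : List Layer
        rest = layers p₀ 2 (pred (kp p₀)) ++ levels (zup (next-diag p₀) n)

  open Flat D k (suc M) using (p₀; p₁)

  -- An empty diagonal is imagined before the first one, with flags for which it imposes no
  -- condition on the entries. The first diagonal can then be treated like all others.
  first-diagonal : ∀ s → s ≤ 1 → ∃₂ λ l r → Fits l r 0 s ×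
    (∀ x → All InRange x → length x ≡ s → Interlaces (outer l r []) x)
  first-diagonal zero          _        = true , true , refl , λ { [] _ _ → _ }
  first-diagonal (suc zero)    _        = true , false , refl , λ { (x ∷ []) ((1≤x , x≤M) ∷ []) _ → 1≤x , x≤M , _ }
  first-diagonal (suc (suc s)) (s≤s ())

  K-[] : ∀ c → length c ≡ 1 → K [] c ≡ 1ℚ
  K-[] (x ∷ []) _ = refl

  -- `Z≡F` is applied to the empty tuple on the imagined diagonal, so the crossing into diagonal
  -- `p₀` creates its weight 1/(N-n) as well. The kernel left over, `K []`, has the value 1.
  ∑Z≡∑F : ∀ n → Jp (p₀ ℤ.+ + suc n) ≡ [] → length (Jp p₀) ≤ 1 →
    ∑ (T (length (Jp p₀))) (λ xs → ∏ xs inv ^^ kp p₀ * Z xs (specs p₀ n)) ≡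
    ∑ (T (length (Jp p₀))) (λ xs → ∏ xs v * F (pred (kp p₀)) (length (Jp p₀)) (specs p₀ n) (λ b → ind (interlaces? b xs)))
  ∑Z≡∑F n end short with l , r , fits , first ← first-diagonal (length (Jp p₀)) short = begin
    ∑ (T s) (λ xs → ∏ xs inv ^^ kp p₀ * Z xs sp)
      ≡⟨ ∑-cong∈ (λ xs (hx , lx) → trans (sym (*-identityˡ _)) (cong₂ _*_
           (sym (ind-yes (interlaces? (outer l r []) xs) (first xs hx lx)))
           (cong (λ e → ∏ xs inv ^^ e * Z xs sp) (sym (ℕ.suc-pred (kp p₀) {{ℕ.>-nonZero (kp-positive p₀)}}))))) ranges ⟩
    Z [] ((l , r , s , κ) ∷ sp)
      ≡⟨ Z≡F [] ((l , r , s , κ) ∷ sp) [] Linked.[] (fits , specs-valid p₀ n end) ⟩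
    ∑ (T s) (λ y → K [] (inner l r y) * W y)
      ≡⟨ ∑-cong∈ (λ y (hy , ly) → trans
           (cong (_* W y) (K-[] (inner l r y) (length-inner l r (subst (Fits l r 0) (sym ly) fits))))
           (*-identityˡ (W y))) ranges ⟩
    ∑ (T s) W ∎
    where
    s κ : ℕ
    s = length (Jp p₀)
    κ = pred (kp p₀)
    sp : List Spec
    sp = specs p₀ n
    W : List ℕ → ℚ
    W y = ∏ y v * F κ s sp (λ b → ind (interlaces? b y))
    ranges : All (λ x → All InRange x × length x ≡ s) (T s)
    ranges = All.zip (T-InRange s , tuples-length rng s)

  zeta≡zetaFlat : D ≢ [] → zeta D k (suc M) ≡ zetaFlat D k (suc M)
  zeta≡zetaFlat D≢[] = trans (ByDiagonal.zeta≡∑Z p₀ n span) (trans (∑Z≡∑F n end short) (sym (ByLayer.zetaFlat≡∑F n e₁ e₀ end)))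
    where
    n : ℕ
    n = ℤ.∣ p₁ ℤ.- p₀ ∣

    offset : ∀ {a b} → a ℤ.≤ b → b ≡ a ℤ.+ + ℤ.∣ b ℤ.- a ∣
    offset {a} {b} a≤b = sym (trans (cong (λ x → a ℤ.+ x) (ℤ.0≤i⇒+∣i∣≡i (ℤ.i≤j⇒0≤j-i a≤b))) (lem a b))
      where
      lem : ∀ a b → a ℤ.+ (b ℤ.- a) ≡ b
      lem = ℤSolver.solve-∀

    p₀≤ : ∀ c → c ∈ D → p₀ ℤ.≤ diag c
    p₀≤ c c∈ = All.lookup (p₀-≤ D k (suc M)) c∈

    ≤p₁ : ∀ c → c ∈ D → diag c ℤ.≤ p₁
    ≤p₁ c c∈ = All.lookup (p₁-≥ D k (suc M)) c∈

    some-cell : ∀ {D : List Cell} → D ≢ [] → ∃ (_∈ D)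
    some-cell {[]}    h = contradiction refl h
    some-cell {c ∷ D} h = c , here refl

    p₁≡ : p₁ ≡ p₀ ℤ.+ + n
    p₁≡ with c , c∈ ← some-cell D≢[] = offset (ℤ.≤-trans (p₀≤ c c∈) (≤p₁ c c∈))

    span : ∀ c → c ∈ D → ∃ λ t → t ≤ n × diag c ≡ p₀ ℤ.+ + t
    span c c∈ = t , t≤n , offset (p₀≤ c c∈)
      where
      t : ℕ
      t = ℤ.∣ diag c ℤ.- p₀ ∣
      t≤n : t ≤ n
      t≤n = ℤ.drop‿+≤+ (subst₂ ℤ._≤_
        (sym (ℤ.0≤i⇒+∣i∣≡i (ℤ.i≤j⇒0≤j-i (p₀≤ c c∈))))
        (sym (ℤ.0≤i⇒+∣i∣≡i (ℤ.i≤j⇒0≤j-i (ℤ.≤-trans (p₀≤ c c∈) (≤p₁ c c∈)))))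
        (ℤ.+-monoˡ-≤ (ℤ.- p₀) (≤p₁ c c∈)))

    -- This is the diagonal `p₁ + 1`; its emptiness bounds the length of the last diagonal.
    end : Jp (p₀ ℤ.+ + suc n) ≡ []
    end = Jp-empty skew (p₀ ℤ.+ + suc n) beyond
      where
      beyond : ∀ c → c ∈ D → diag c ≢ p₀ ℤ.+ + suc n
      beyond c c∈ e with t , t≤n , et ← span c c∈ =
        ℕ.<⇒≢ (s≤s t≤n) (ℤ.+-injective (∙-cancelˡ p₀ (+ t) (+ suc n) (trans (sym et) e)))

    -- Two cells on diagonal `p₀` would force one on diagonal `p₀ - 1`.
    short : length (Jp p₀) ≤ 1
    short = subst (λ p → length (Jp p) ≤ 1) (lem p₀) (Jp-first (p₀ ℤ.- ℤ.1ℤ) (Jp-empty skew (p₀ ℤ.- ℤ.1ℤ) before))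
      where
      lem : ∀ a → a ℤ.- ℤ.1ℤ ℤ.+ ℤ.1ℤ ≡ a
      lem = ℤSolver.solve-∀
      lem′ : ∀ a → a ℤ.- ℤ.1ℤ ℤ.- a ≡ ℤ.-1ℤ
      lem′ = ℤSolver.solve-∀
      before : ∀ c → c ∈ D → diag c ≢ p₀ ℤ.- ℤ.1ℤ
      before c c∈ e with () ← subst (ℤ.0ℤ ℤ.≤_) (trans (cong (ℤ._- p₀) e) (lem′ p₀)) (ℤ.i≤j⇒0≤j-i (p₀≤ c c∈))

    e₁ : zrange p₀ p₁ ≡ zup p₀ (suc n)
    e₁ = zrange≡zup p₀ (suc n) p₁ (trans (cong next-diag p₁≡) (lem p₀ (+ n)))
      where
      lem : ∀ a b → a ℤ.+ b ℤ.+ ℤ.1ℤ ≡ a ℤ.+ (ℤ.1ℤ ℤ.+ b)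
      lem = ℤSolver.solve-∀

    e₀ : zrange p₀ (p₁ ℤ.- ℤ.1ℤ) ≡ zup p₀ n
    e₀ = zrange≡zup p₀ n (p₁ ℤ.- ℤ.1ℤ) (trans (lem p₁) p₁≡)
      where
      lem : ∀ a → a ℤ.- ℤ.1ℤ ℤ.+ ℤ.1ℤ ≡ a
      lem = ℤSolver.solve-∀

theorem3p6 : (lam mu : List ℕ) → IsSkew lam mu → cells lam mu ≢ [] →
    (k : Cell → ℕ) → IsIndex (cells lam mu) k → DiagConst (cells lam mu) k →
    (N : ℕ) → 1 ≤ N →
    zeta (cells lam mu) k N ≡ zetaFlat (cells lam mu) k N
theorem3p6 lam mu skew nonempty k index constant (suc M) _ = Main.zeta≡zetaFlat skew k index constant M nonempty
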